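{- Let $\zeta_5$ be a primitive fifth root of unity, $c=\zeta_5+\zeta_5^4$, and let $$PP_4(z,q)=\sum_{n=1}^\infty \frac{q^{n^2}(q^{2n+1};q)_\infty}{(zq^n;q)_\infty(z^{ -1}q^n;q)_\infty}.$$ Then $$PP_4(\zeta_5,q)=(q^{25};q^{25})_\infty\Big(-(1+c)q^5\frac{[q^{10};q^{75}]_\infty}{[q^5,q^{20},q^{25},q^{30};q^{75}]_\infty}+\frac{q}{[q^{10},q^{15},q^{25};q^{75}]_\infty}+(1+c)\frac{q^2}{[q^{10};q^{25}]_\infty}$$ $$-\frac{q^2}{[q^5,q^{25},q^{30};q^{75}]_\infty}-c\,q^8\frac{[q^5;q^{75}]_\infty}{[q^{10},q^{15},q^{25},q^{35};q^{75}]_\infty}\Big).$$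
   Context: $(a;q)_\infty=\prod_{j\ge0}(1-aq^j)$; $[z;q]_\infty=(z;q)_\infty(q/z;q)_\infty$ and $[z_1,\dots,z_k;q]_\infty=[z_1;q]_\infty\cdots[z_k;q]_\infty$. -}

module Defs where

open import Data.Nat using (ℕ; zero; suc; _∸_) renaming (_+_ to _+ℕ_; _*_ to _*ℕ_)
open import Data.Nat using (_≟_)
open import Data.Integer using (ℤ; +_; _+_; _*_; -_; _-_)
open import Data.List using (List; foldr; map; upTo)
open import Relation.Nullary using (yes; no)
open import Relation.Binary.PropositionalEquality using (_≡_)

-- The cyclotomic ring ℤ[ζ₅] = ℤ[x]/(1+x+x²+x³+x⁴), elements in normal
-- form a₀ + a₁ζ + a₂ζ² + a₃ζ³ (ζ⁴ = -1-ζ-ζ²-ζ³, ζ⁵ = 1).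

record Z5 : Set where
  constructor z5
  field
    a0 a1 a2 a3 : ℤ

open Z5 public

infixl 6 _+ᶻ_ _-ᶻ_
infixl 7 _*ᶻ_

_+ᶻ_ : Z5 → Z5 → Z5
z5 a b c d +ᶻ z5 a' b' c' d' = z5 (a + a') (b + b') (c + c') (d + d')

-ᶻ_ : Z5 → Z5
-ᶻ z5 a b c d = z5 (- a) (- b) (- c) (- d)

_-ᶻ_ : Z5 → Z5 → Z5
x -ᶻ y = x +ᶻ (-ᶻ y)

-- multiply as polynomials (degree ≤ 6), then reduce with
-- x⁴ = -(1+x+x²+x³), x⁵ = 1, x⁶ = x.
_*ᶻ_ : Z5 → Z5 → Z5
z5 a0 a1 a2 a3 *ᶻ z5 b0 b1 b2 b3 =
  let p0 = a0 * b0
      p1 = a0 * b1 + a1 * b0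
      p2 = a0 * b2 + a1 * b1 + a2 * b0
      p3 = a0 * b3 + a1 * b2 + a2 * b1 + a3 * b0
      p4 = a1 * b3 + a2 * b2 + a3 * b1
      p5 = a2 * b3 + a3 * b2
      p6 = a3 * b3
  in z5 (p0 - p4 + p5) (p1 - p4 + p6) (p2 - p4) (p3 - p4)

0ᶻ 1ᶻ ζ : Z5
0ᶻ = z5 (+ 0) (+ 0) (+ 0) (+ 0)
1ᶻ = z5 (+ 1) (+ 0) (+ 0) (+ 0)
ζ  = z5 (+ 0) (+ 1) (+ 0) (+ 0)

ζ⁴ : Z5
ζ⁴ = ζ *ᶻ ζ *ᶻ ζ *ᶻ ζ

c : Z5
c = ζ +ᶻ ζ⁴

-- Formal power series in q over ℤ[ζ₅]: the n-th coefficient.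

Series : Set
Series = ℕ → Z5

sumZ : List Z5 → Z5
sumZ = foldr _+ᶻ_ 0ᶻ

infixl 6 _⊕_ _⊖_
infixl 7 _⊛_

_⊕_ : Series → Series → Series
(f ⊕ g) n = f n +ᶻ g n

_⊖_ : Series → Series → Series
(f ⊖ g) n = f n -ᶻ g n

_·_ : Z5 → Series → Series
(a · f) n = a *ᶻ f n

_⊛_ : Series → Series → Series
(f ⊛ g) n = sumZ (map (λ k → f k *ᶻ g (n ∸ k)) (upTo (suc n)))

qpow : ℕ → Series
qpow k n with k ≟ n
... | yes _ = 1ᶻ
... | no  _ = 0ᶻ

one : Series
one = qpow 0

sumFin : (ℕ → Series) → ℕ → Series
sumFin t zero    = λ _ → 0ᶻ
sumFin t (suc K) = sumFin t K ⊕ t K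

prodFin : (ℕ → Series) → ℕ → Series
prodFin t zero    = one
prodFin t (suc K) = prodFin t K ⊛ t K

spow : Series → ℕ → Series
spow f zero    = one
spow f (suc k) = spow f k ⊛ f

-- Multiplicative inverse of a series f with constant term 1:
-- f⁻¹ = Σ_k (1 - f)^k; the coefficient of q^N only involves k ≤ N.
-- (Only applied to series with constant term 1.)
inv : Series → Series
inv f N = sumFin (λ k → spow (one ⊖ f) k) (suc N) N

-- (u q^e ; q^d)_∞ = ∏_{j ≥ 0} (1 - u q^{e + j d}), for e, d ≥ 1.
-- Since e + j d > N for j ≥ N + 1... (indeed for j ≥ N), the coefficient
-- of q^N is that of the finite product over j ≤ N.
poch : Z5 → ℕ → ℕ → Series
poch u e d N = prodFin (λ j → one ⊖ (u · qpow (e +ℕ j *ℕ d))) (suc N) N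

-- [q^a ; q^m]_∞ = (q^a ; q^m)_∞ (q^{m-a} ; q^m)_∞   (0 < a < m)
theta : ℕ → ℕ → Series
theta a m = poch 1ᶻ a m ⊛ poch 1ᶻ (m ∸ a) m

-- PP₄(z,q) at z = ζ₅ (so z⁻¹ = ζ₅⁴):
-- Σ_{n ≥ 1} q^{n²} (q^{2n+1};q)_∞ / ((ζ q^n;q)_∞ (ζ⁻¹ q^n;q)_∞).
-- The n-th term is O(q^{n²}), so the coefficient of q^N only needs n ≤ N+1.
PP4term : ℕ → Series
PP4term n = qpow (n *ℕ n) ⊛ poch 1ᶻ (2 *ℕ n +ℕ 1) 1
            ⊛ inv (poch ζ n 1) ⊛ inv (poch ζ⁴ n 1)

PP4ζ : Series
PP4ζ N = sumFin (λ j → PP4term (suc j)) (suc N) N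

RHS : Series
RHS = poch 1ᶻ 25 25 ⊛
  ( (-ᶻ (1ᶻ +ᶻ c)) · (qpow 5 ⊛ theta 10 75
        ⊛ inv (theta 5 75 ⊛ theta 20 75 ⊛ theta 25 75 ⊛ theta 30 75))
  ⊕ (qpow 1 ⊛ inv (theta 10 75 ⊛ theta 15 75 ⊛ theta 25 75))
  ⊕ ((1ᶻ +ᶻ c) · (qpow 2 ⊛ inv (theta 10 25)))
  ⊖ (qpow 2 ⊛ inv (theta 5 75 ⊛ theta 25 75 ⊛ theta 30 75))
  ⊖ (c · (qpow 8 ⊛ theta 5 75
        ⊛ inv (theta 10 75 ⊛ theta 15 75 ⊛ theta 25 75 ⊛ theta 35 75))) )

_≈ₛ_ : Series → Series → Set
f ≈ₛ g = ∀ n → f n ≡ g n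

{-# OPTIONS --safe #-}

-- Write z = ζ₅ and [n;k] for the q-binomial coefficient.  The finite triple product
--   (x)_n (q/x)_n = Σ_j (-1)^j x^j q^(j(j-1)/2) [2n; n+j]
-- and Durfee's identity Σ_n q^(n²) / ((q)_(n-j) (q)_(n+j)) = q^(j²) / (q)_∞ give
--   (q)_∞ Σ_n q^(n²) (x)_n (q/x)_n / (q)_2n = Σ_j (-1)^j x^j q^(j(3j-1)/2).
-- Since (1+z)(z)_n(1/z)_n = z (z)_n(q/z)_n + (1/z)_n(zq)_n, the product of PP₄(z,q) with
-- (zq)_∞(q/z)_∞ is a theta series whose coefficients depend on j modulo 5; three of its
-- five residue classes survive, each a triple product to the base q^75.
-- On the other hand 1/((zq)_∞(q/z)_∞) = (q)_∞(z²q)_∞(q/z²)_∞ / (q⁵;q⁵)_∞, and the triple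
-- product at z² splits modulo 5 into two theta functions to the base q^25.  Multiplying
-- out, the five terms of the theorem appear up to two theta identities.  These are the
-- residue classes 0 and 2 of the pentagonal number series, compared with the product of
-- the dissections at z² and at its conjugate.
module Submission where

open import Algebra.Bundles using (CommutativeMonoid; CommutativeRing)
open import Algebra.Structures using (IsCommutativeRing)
open import Data.Bool as Bool using (Bool; true; false)
open import Data.Fin using (Fin; #_)
open import Data.Integer as ℤ using (ℤ; +_; -[1+_]; +0)
import Data.Integer.Properties as ℤₚ
import Data.Integer.Tactic.RingSolver as ℤSolver
open import Data.List using (_∷_; foldr; map; upTo)
open import Data.List.Properties using (map-upTo)
open import Data.Maybe using (nothing)
open import Data.Nat as ℕ using (ℕ; zero; suc; _∸_; z≤n; s≤s)
open import Data.Nat.Divisibility using (_∣_; _∣?_; _∣0; ∣-refl; ∣m+n∣m⇒∣n; ∣m∣n⇒∣m+n; >⇒∤)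
import Data.Nat.Properties as ℕₚ
open import Data.Nat.Tactic.RingSolver using (solve-∀)
open import Data.Product using (_,_)
open import Data.Sum using (inj₁; inj₂)
open import Data.Vec using (Vec; []; _∷_; lookup)
open import Function using (_∘_)
open import Level using (0ℓ)
open import Relation.Binary.PropositionalEquality as ≡ using (_≡_; _≢_)
open import Relation.Nullary using (¬_; yes; no; contradiction)
import Tactic.RingSolver.Core.AlmostCommutativeRing as ACR
open import Tactic.RingSolver.Core.Polynomial.Parameters using (Homomorphism)
import Tactic.RingSolver.NonReflective ℤSolver.ring as ℤNF

open import Defs

-- Nothing is left to convergence: each coefficient is computed modulo q^N, where q is nilpotent and
-- an infinite product equals the product of its first N factors. What has to be handled with care
-- is division, and three kinds of divisor shape the proof. Factors 1 - q^k and series with constant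
-- term 1 can be cancelled outright; the q-binomials are therefore written with the complementary
-- products (q^(n+1))_∞ instead of 1/(q)_n. Powers of q are zero divisors: q/x is replaced by a
-- partner y with x y = q, and one of the two theta identities is obtained only after multiplication
-- by q². Cyclotomic numbers such as 1 - ζ are not units, but they divide 5, and multiplication by 5
-- is injective on the coefficients.

negᶻ : Z5 → Z5
negᶻ x = -ᶻ x

-- Ring laws of the cyclotomic integers

module Cyclotomic where

  open import Tactic.RingSolver.Core.Expression using (Expr; Κ; Ι) renaming (_⊕_ to _:+_; _⊗_ to _:*_; ⊝_ to :-_)

  -- Components are solver expressions multiplied as in Defs, so that an identity in
  -- ℤ[ζ] becomes four identities in ℤ.
  record Symbolic (n : ℕ) : Set where
    constructor e5
    field e0 e1 e2 e3 : Expr ℤ n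

  infixl 6 _⊞_
  infixl 7 _⊠_

  _⊞_ _⊠_ : ∀ {n} → Symbolic n → Symbolic n → Symbolic n
  e5 x0 x1 x2 x3 ⊞ e5 y0 y1 y2 y3 = e5 (x0 :+ y0) (x1 :+ y1) (x2 :+ y2) (x3 :+ y3)
  e5 x0 x1 x2 x3 ⊠ e5 y0 y1 y2 y3 =
    let p0 = x0 :* y0
        p1 = x0 :* y1 :+ x1 :* y0
        p2 = x0 :* y2 :+ x1 :* y1 :+ x2 :* y0
        p3 = x0 :* y3 :+ x1 :* y2 :+ x2 :* y1 :+ x3 :* y0
        p4 = x1 :* y3 :+ x2 :* y2 :+ x3 :* y1
        p5 = x2 :* y3 :+ x3 :* y2
        p6 = x3 :* y3
    in e5 (p0 :+ :- p4 :+ p5) (p1 :+ :- p4 :+ p6) (p2 :+ :- p4) (p3 :+ :- p4)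

  ⊟_ : ∀ {n} → Symbolic n → Symbolic n
  ⊟ e5 x0 x1 x2 x3 = e5 (:- x0) (:- x1) (:- x2) (:- x3)

  const : ∀ {n} → Z5 → Symbolic n
  const (z5 x0 x1 x2 x3) = e5 (Κ x0) (Κ x1) (Κ x2) (Κ x3)

  X Y Z : Symbolic 12
  X = e5 (Ι (# 0)) (Ι (# 1)) (Ι (# 2)) (Ι (# 3))
  Y = e5 (Ι (# 4)) (Ι (# 5)) (Ι (# 6)) (Ι (# 7))
  Z = e5 (Ι (# 8)) (Ι (# 9)) (Ι (# 10)) (Ι (# 11))

  env : Z5 → Z5 → Z5 → Vec ℤ 12
  env x y z = a0 x ∷ a1 x ∷ a2 x ∷ a3 x ∷ a0 y ∷ a1 y ∷ a2 y ∷ a3 y ∷ a0 z ∷ a1 z ∷ a2 z ∷ a3 z ∷ []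

  module _ (x y z : Z5) where

    eval : Symbolic 12 → Z5
    eval (e5 x0 x1 x2 x3) = z5 (go x0) (go x1) (go x2) (go x3)
      where go = λ e → ℤNF.Ops.⟦ e ⟧ (env x y z)

    normal : Symbolic 12 → Z5
    normal (e5 x0 x1 x2 x3) = z5 (go x0) (go x1) (go x2) (go x3)
      where go = λ e → ℤNF.Ops.⟦ e ⇓⟧ (env x y z)

    normal≡eval : ∀ e → normal e ≡ eval e
    normal≡eval (e5 x0 x1 x2 x3)
      rewrite ℤNF.Ops.correct x0 (env x y z) | ℤNF.Ops.correct x1 (env x y z)
            | ℤNF.Ops.correct x2 (env x y z) | ℤNF.Ops.correct x3 (env x y z) = ≡.refl

    identity : ∀ l r → normal l ≡ normal r → eval l ≡ eval r
    identity l r eq = ≡.trans (≡.sym (normal≡eval l)) (≡.trans eq (normal≡eval r))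

  commutativeRing : CommutativeRing 0ℓ 0ℓ
  commutativeRing = record
    { Carrier = Z5 ; _≈_ = _≡_ ; _+_ = _+ᶻ_ ; _*_ = _*ᶻ_ ; -_ = negᶻ ; 0# = 0ᶻ ; 1# = 1ᶻ
    ; isCommutativeRing = record
      { isRing = record
        { +-isAbelianGroup = record
          { isGroup = record
            { isMonoid = record
              { isSemigroup = record
                { isMagma = record { isEquivalence = ≡.isEquivalence ; ∙-cong = ≡.cong₂ _+ᶻ_ }
                ; assoc = λ x y z → identity x y z (X ⊞ Y ⊞ Z) (X ⊞ (Y ⊞ Z)) ≡.refl }
              ; identity = (λ x → identity x x x (const 0ᶻ ⊞ X) X ≡.refl)
                         , (λ x → identity x x x (X ⊞ const 0ᶻ) X ≡.refl) }
            ; inverse = (λ x → identity x x x (⊟ X ⊞ X) (const 0ᶻ) ≡.refl)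
                      , (λ x → identity x x x (X ⊞ ⊟ X) (const 0ᶻ) ≡.refl)
            ; ⁻¹-cong = ≡.cong negᶻ }
          ; comm = λ x y → identity x y x (X ⊞ Y) (Y ⊞ X) ≡.refl }
        ; *-cong = ≡.cong₂ _*ᶻ_
        ; *-assoc = λ x y z → identity x y z (X ⊠ Y ⊠ Z) (X ⊠ (Y ⊠ Z)) ≡.refl
        ; *-identity = (λ x → identity x x x (const 1ᶻ ⊠ X) X ≡.refl)
                     , (λ x → identity x x x (X ⊠ const 1ᶻ) X ≡.refl)
        ; distrib = (λ x y z → identity x y z (X ⊠ (Y ⊞ Z)) (X ⊠ Y ⊞ X ⊠ Z) ≡.refl)
                  , (λ x y z → identity x y z ((Y ⊞ Z) ⊠ X) (Y ⊠ X ⊞ Z ⊠ X) ≡.refl) }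
      ; *-comm = λ x y → identity x y x (X ⊠ Y) (Y ⊠ X) ≡.refl } }

-- Convolution and power series modulo q^N

module PowerSeries (A : CommutativeRing 0ℓ 0ℓ) (δ : ℕ → CommutativeRing.Carrier A)
  (δ-zero : CommutativeRing._≈_ A (δ 0) (CommutativeRing.1# A))
  (δ-suc : ∀ n → CommutativeRing._≈_ A (δ (suc n)) (CommutativeRing.0# A)) where

  open CommutativeRing A

  open import Algebra.Properties.CommutativeSemigroup +-commutativeSemigroup using (interchange)
  open import Relation.Binary.Reasoning.Setoid setoid

  infix 4 _≋_
  _≋_ : (f g : ℕ → Carrier) → Set
  f ≋ g = ∀ n → f n ≈ g n

  infixl 20 _✶_
  -- Spelled exactly like `⊛`, so that the ring laws proved here apply to `⊛` by conversion.
  _✶_ : (ℕ → Carrier) → (ℕ → Carrier) → ℕ → Carrier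
  (f ✶ g) n = foldr _+_ 0# (map (λ k → f k * g (n ∸ k)) (upTo (suc n)))

  ✶-zero : ∀ f g → (f ✶ g) 0 ≈ f 0 * g 0
  ✶-zero f g = +-identityʳ _

  -- Detaching k = 0 leaves a convolution with the shifted series, so the ring laws follow by
  -- induction on n without reindexing sums.
  ✶-suc : ∀ f g n → (f ✶ g) (suc n) ≈ f 0 * g (suc n) + ((f ∘ suc) ✶ g) n
  ✶-suc f g n = reflexive (≡.cong (foldr _+_ 0#) (≡.trans (map-upTo _ (2 ℕ.+ n))
    (≡.cong (f 0 * g (suc n) ∷_) (≡.sym (map-upTo _ (suc n))))))

  ✶-cong : ∀ n {f f′ g g′} → (∀ k → k ℕ.≤ n → f k ≈ f′ k) → (∀ k → k ℕ.≤ n → g k ≈ g′ k) →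
           (f ✶ g) n ≈ (f′ ✶ g′) n
  ✶-cong zero {f} {f′} {g} {g′} p r = trans (✶-zero f g)
    (trans (*-cong (p 0 z≤n) (r 0 z≤n)) (sym (✶-zero f′ g′)))
  ✶-cong (suc n) {f} {f′} {g} {g′} p r = trans (✶-suc f g n) (trans
    (+-cong (*-cong (p 0 z≤n) (r (suc n) ℕₚ.≤-refl))
      (✶-cong n (λ k k≤n → p (suc k) (s≤s k≤n)) (λ k k≤n → r k (ℕₚ.m≤n⇒m≤1+n k≤n))))
    (sym (✶-suc f′ g′ n)))

  ✶-distribʳ : ∀ h f g → ((λ k → f k + g k) ✶ h) ≋ (λ n → (f ✶ h) n + (g ✶ h) n)
  ✶-distribʳ h f g zero = trans (✶-zero (λ k → f k + g k) h) (trans (distribʳ (h 0) (f 0) (g 0))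
    (sym (+-cong (✶-zero f h) (✶-zero g h))))
  ✶-distribʳ h f g (suc n) = begin
    ((λ k → f k + g k) ✶ h) (suc n)
      ≈⟨ ✶-suc (λ k → f k + g k) h n ⟩
    (f 0 + g 0) * h (suc n) + ((λ k → f (suc k) + g (suc k)) ✶ h) n
      ≈⟨ +-cong (distribʳ (h (suc n)) (f 0) (g 0)) (✶-distribʳ h (f ∘ suc) (g ∘ suc) n) ⟩
    (f 0 * h (suc n) + g 0 * h (suc n)) + (((f ∘ suc) ✶ h) n + ((g ∘ suc) ✶ h) n)
      ≈⟨ interchange _ _ _ _ ⟩
    (f 0 * h (suc n) + ((f ∘ suc) ✶ h) n) + (g 0 * h (suc n) + ((g ∘ suc) ✶ h) n)
      ≈⟨ sym (+-cong (✶-suc f h n) (✶-suc g h n)) ⟩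
    (f ✶ h) (suc n) + (g ✶ h) (suc n) ∎

  *-✶ : ∀ u f g → ((λ k → u * f k) ✶ g) ≋ (λ n → u * (f ✶ g) n)
  *-✶ u f g zero = trans (✶-zero (λ k → u * f k) g) (trans (*-assoc u _ _) (*-congˡ (sym (✶-zero f g))))
  *-✶ u f g (suc n) = begin
    ((λ k → u * f k) ✶ g) (suc n)                                        ≈⟨ ✶-suc (λ k → u * f k) g n ⟩
    (u * f 0) * g (suc n) + ((λ k → u * f (suc k)) ✶ g) n           ≈⟨ +-cong (*-assoc u _ _) (*-✶ u (f ∘ suc) g n) ⟩
    u * (f 0 * g (suc n)) + u * ((f ∘ suc) ✶ g) n            ≈⟨ sym (distribˡ u _ _) ⟩
    u * (f 0 * g (suc n) + ((f ∘ suc) ✶ g) n)                 ≈⟨ *-congˡ (sym (✶-suc f g n)) ⟩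
    u * (f ✶ g) (suc n)                                         ∎

  ✶-assoc : ∀ f g h → ((f ✶ g) ✶ h) ≋ (f ✶ (g ✶ h))
  ✶-assoc f g h zero = begin
    ((f ✶ g) ✶ h) 0          ≈⟨ ✶-zero (f ✶ g) h ⟩
    (f ✶ g) 0 * h 0         ≈⟨ *-congʳ (✶-zero f g) ⟩
    f 0 * g 0 * h 0        ≈⟨ *-assoc _ _ _ ⟩
    f 0 * (g 0 * h 0)      ≈⟨ *-congˡ (sym (✶-zero g h)) ⟩
    f 0 * (g ✶ h) 0         ≈⟨ sym (✶-zero f (g ✶ h)) ⟩
    (f ✶ (g ✶ h)) 0          ∎
  ✶-assoc f g h (suc n) = begin
    ((f ✶ g) ✶ h) (suc n)
      ≈⟨ ✶-suc (f ✶ g) h n ⟩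
    (f ✶ g) 0 * h (suc n) + (((f ✶ g) ∘ suc) ✶ h) n
      ≈⟨ +-cong (trans (*-congʳ (✶-zero f g)) (*-assoc _ _ _))
           (trans (✶-cong n {g = h} (λ k _ → ✶-suc f g k) (λ _ _ → refl))
             (✶-distribʳ h (λ k → f 0 * g (suc k)) ((f ∘ suc) ✶ g) n)) ⟩
    f 0 * (g 0 * h (suc n)) + (((λ k → f 0 * g (suc k)) ✶ h) n + (((f ∘ suc) ✶ g) ✶ h) n)
      ≈⟨ sym (+-assoc _ _ _) ⟩
    (f 0 * (g 0 * h (suc n)) + ((λ k → f 0 * g (suc k)) ✶ h) n) + (((f ∘ suc) ✶ g) ✶ h) n
      ≈⟨ +-cong (trans (+-congˡ (*-✶ (f 0) (g ∘ suc) h n)) (sym (distribˡ (f 0) _ _)))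
           (✶-assoc (f ∘ suc) g h n) ⟩
    f 0 * (g 0 * h (suc n) + ((g ∘ suc) ✶ h) n) + ((f ∘ suc) ✶ (g ✶ h)) n
      ≈⟨ +-congʳ (*-congˡ (sym (✶-suc g h n))) ⟩
    f 0 * (g ✶ h) (suc n) + ((f ∘ suc) ✶ (g ✶ h)) n
      ≈⟨ sym (✶-suc f (g ✶ h) n) ⟩
    (f ✶ (g ✶ h)) (suc n) ∎

  ✶-sucʳ : ∀ f g n → (f ✶ g) (suc n) ≈ (f ✶ (g ∘ suc)) n + f (suc n) * g 0
  ✶-sucʳ f g zero = trans (✶-suc f g 0)
    (+-cong (sym (✶-zero f (g ∘ suc))) (✶-zero (f ∘ suc) g))
  ✶-sucʳ f g (suc n) = trans (✶-suc f g (suc n)) (trans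
    (+-congˡ (✶-sucʳ (f ∘ suc) g n)) (trans (sym (+-assoc _ _ _))
    (+-congʳ (sym (✶-suc f (g ∘ suc) n)))))

  ✶-comm : ∀ f g → (f ✶ g) ≋ (g ✶ f)
  ✶-comm f g zero = trans (✶-zero f g) (trans (*-comm _ _) (sym (✶-zero g f)))
  ✶-comm f g (suc n) = trans (✶-suc f g n) (trans (+-comm _ _) (trans
    (+-cong (✶-comm (f ∘ suc) g n) (*-comm _ _)) (sym (✶-sucʳ g f n))))

  ✶-zeroˡ : ∀ f → ((λ _ → 0#) ✶ f) ≋ (λ _ → 0#)
  ✶-zeroˡ f zero = trans (✶-zero (λ _ → 0#) f) (zeroˡ (f 0))
  ✶-zeroˡ f (suc n) = trans (✶-suc (λ _ → 0#) f n)
    (trans (+-cong (zeroˡ (f (suc n))) (✶-zeroˡ f n)) (+-identityˡ 0#))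

  ✶-identityˡ : ∀ f → (δ ✶ f) ≋ f
  ✶-identityˡ f zero = trans (✶-zero δ f) (trans (*-congʳ δ-zero) (*-identityˡ _))
  ✶-identityˡ f (suc n) = trans (✶-suc δ f n) (trans
    (+-cong (trans (*-congʳ δ-zero) (*-identityˡ _))
      (trans (✶-cong n {g = f} (λ k _ → δ-suc k) (λ _ _ → refl)) (✶-zeroˡ f n))) (+-identityʳ _))

  infix 4 _≈[_]_
  _≈[_]_ : (ℕ → Carrier) → ℕ → (ℕ → Carrier) → Set
  f ≈[ N ] g = ∀ n → n ℕ.< N → f n ≈ g n

  -- Power series modulo q^N, where every infinite sum and product of the
  -- theorem becomes finite.
  truncatedRing : ℕ → CommutativeRing 0ℓ 0ℓ
  truncatedRing N = record
    { Carrier = ℕ → Carrier ; _≈_ = _≈[ N ]_ ; _+_ = λ f g n → f n + g n ; _*_ = _✶_ ; -_ = λ f n → - f n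
    ; 0# = λ _ → 0# ; 1# = δ
    ; isCommutativeRing = record
      { isRing = record
        { +-isAbelianGroup = record
          { isGroup = record
            { isMonoid = record
              { isSemigroup = record
                { isMagma = record
                  { isEquivalence = record
                    { refl = λ _ _ → refl ; sym = λ p n n<N → sym (p n n<N)
                    ; trans = λ p r n n<N → trans (p n n<N) (r n n<N) }
                  ; ∙-cong = λ p r n n<N → +-cong (p n n<N) (r n n<N) }
                ; assoc = λ f g h n _ → +-assoc (f n) (g n) (h n) }
              ; identity = (λ f n _ → +-identityˡ (f n)) , (λ f n _ → +-identityʳ (f n)) }
            ; inverse = (λ f n _ → -‿inverseˡ (f n)) , (λ f n _ → -‿inverseʳ (f n))
            ; ⁻¹-cong = λ p n n<N → -‿cong (p n n<N) }
          ; comm = λ f g n _ → +-comm (f n) (g n) }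
        ; *-cong = λ p r n n<N → ✶-cong n (λ k k≤n → p k (ℕₚ.≤-<-trans k≤n n<N))
                                          (λ k k≤n → r k (ℕₚ.≤-<-trans k≤n n<N))
        ; *-assoc = λ f g h n _ → ✶-assoc f g h n
        ; *-identity = (λ f n _ → ✶-identityˡ f n)
                     , (λ f n _ → trans (✶-comm f δ n) (✶-identityˡ f n))
        ; distrib = (λ f g h n _ → trans (✶-comm f (λ k → g k + h k) n) (trans (✶-distribʳ f g h n)
                       (+-cong (✶-comm g f n) (✶-comm h f n))))
                  , (λ f g h n _ → ✶-distribʳ f g h n) }
      ; *-comm = λ f g n _ → ✶-comm f g n } }


-- Polynomial identities with cyclotomic coefficients

isZero : Z5 → Bool
isZero (z5 +0 +0 +0 +0) = true
isZero _                = false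

isZero-sound : ∀ u → Bool.T (isZero u) → u ≡ 0ᶻ
isZero-sound (z5 +0 +0 +0 +0) _ = ≡.refl

-- Coefficients are taken in ℤ[ζ] and not in `R`: relations between roots of unity are then settled
-- by computation, while series remain opaque variables.
module Solver {c ℓ} (R : CommutativeRing c ℓ)
  (morphism : CommutativeRing.rawRing Cyclotomic.commutativeRing ACR.-Raw-AlmostCommutative⟶ ACR.fromCommutativeRing R (λ _ → nothing)) where

  open CommutativeRing R
  open ACR._-Raw-AlmostCommutative⟶_ morphism

  homomorphism : Homomorphism 0ℓ 0ℓ c ℓ
  homomorphism = record
    { from = record { rawRing = CommutativeRing.rawRing Cyclotomic.commutativeRing ; isZero = isZero }
    ; to = ACR.fromCommutativeRing R (λ _ → nothing)
    ; morphism = morphism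
    ; Zero-C⟶Zero-R = λ u z → trans (sym 0-homo) (reflexive (≡.cong ⟦_⟧ (≡.sym (isZero-sound u z)))) }

  open import Tactic.RingSolver.Core.Polynomial.Base (Homomorphism.from homomorphism)
  open import Tactic.RingSolver.Core.Polynomial.Semantics homomorphism renaming (⟦_⟧ to ⟦_⟧ₚ)
  open import Tactic.RingSolver.Core.Polynomial.Homomorphism homomorphism

  infixl 6 _:+_ _:-_
  infixl 7 _:*_
  infix  8 :-_
  data Expr (n : ℕ) : Set where
    var       : Fin n → Expr n
    con       : Z5 → Expr n
    -- Kept apart from `con 1ᶻ`, whose value is only equivalent to `1#`.
    :1        : Expr n
    _:+_ _:*_ : (x y : Expr n) → Expr n
    :-_       : (x : Expr n) → Expr n

  _:-_ : ∀ {n} → Expr n → Expr n → Expr n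
  x :- y = x :+ :- y

  eval : ∀ {n} → Expr n → Vec Carrier n → Carrier
  eval (var i)  ρ = lookup ρ i
  eval (con u)  ρ = ⟦ u ⟧
  eval :1       ρ = 1#
  eval (x :+ y) ρ = eval x ρ + eval y ρ
  eval (x :* y) ρ = eval x ρ * eval y ρ
  eval (:- x)   ρ = - eval x ρ

  norm : ∀ {n} → Expr n → Poly n
  norm (var i)  = ι i
  norm (con u)  = κ u
  norm :1       = κ 1ᶻ
  norm (x :+ y) = norm x ⊞ norm y
  norm (x :* y) = norm x ⊠ norm y
  norm (:- x)   = ⊟ norm x

  normal : ∀ {n} → Expr n → Vec Carrier n → Carrier
  normal e = ⟦ norm e ⟧ₚ

  correct : ∀ {n} (e : Expr n) ρ → normal e ρ ≈ eval e ρ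
  correct (var i)  ρ = ι-hom i ρ
  correct (con u)  ρ = κ-hom u ρ
  correct :1       ρ = trans (κ-hom 1ᶻ ρ) 1-homo
  correct (x :+ y) ρ = trans (⊞-hom (norm x) (norm y) ρ) (+-cong (correct x ρ) (correct y ρ))
  correct (x :* y) ρ = trans (⊠-hom (norm x) (norm y) ρ) (*-cong (correct x ρ) (correct y ρ))
  correct (:- x)   ρ = trans (⊟-hom (norm x) ρ) (-‿cong (correct x ρ))

  open import Relation.Binary.Reflection setoid var eval normal correct public using (solve; _⊜_)

-- Finite sums and products, antidiagonals

module Fold {a ℓ} (M : CommutativeMonoid a ℓ) where

  open CommutativeMonoid M
  open import Algebra.Properties.CommutativeSemigroup commutativeSemigroup using (interchange)
  open import Relation.Binary.Reasoning.Setoid setoid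

  fold : ℕ → (ℕ → Carrier) → Carrier
  fold zero    f = ε
  fold (suc n) f = fold n f ∙ f n

  fold-cong : ∀ n {f g} → (∀ i → i ℕ.< n → f i ≈ g i) → fold n f ≈ fold n g
  fold-cong zero    p = refl
  fold-cong (suc n) p = ∙-cong (fold-cong n (λ i i<n → p i (ℕₚ.m<n⇒m<1+n i<n))) (p n ℕₚ.≤-refl)

  fold-cong′ : ∀ n {f g} → (∀ i → f i ≈ g i) → fold n f ≈ fold n g
  fold-cong′ n p = fold-cong n (λ i _ → p i)

  fold-ε : ∀ n {f} → (∀ i → f i ≈ ε) → fold n f ≈ ε
  fold-ε zero    p = refl
  fold-ε (suc n) p = trans (∙-cong (fold-ε n p) (p n)) (identityˡ ε)

  fold-suc : ∀ n f → fold (suc n) f ≈ f 0 ∙ fold n (λ i → f (suc i))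
  fold-suc zero    f = comm ε (f 0)
  fold-suc (suc n) f = trans (∙-congʳ (fold-suc n f)) (assoc _ _ _)

  fold-∙ : ∀ n f g → fold n (λ i → f i ∙ g i) ≈ fold n f ∙ fold n g
  fold-∙ zero    f g = sym (identityˡ ε)
  fold-∙ (suc n) f g = trans (∙-congʳ (fold-∙ n f g)) (interchange _ _ _ _)

  fold-+ : ∀ m n f → fold (m ℕ.+ n) f ≈ fold m f ∙ fold n (λ i → f (m ℕ.+ i))
  fold-+ m zero f rewrite ℕₚ.+-identityʳ m = sym (identityʳ _)
  fold-+ m (suc n) f rewrite ℕₚ.+-suc m n = trans (∙-congʳ (fold-+ m n f)) (assoc _ _ _)

  fold-pad : ∀ {m n} → m ℕ.≤ n → ∀ {f} → (∀ i → m ℕ.≤ i → f i ≈ ε) → fold n f ≈ fold m f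
  fold-pad {m} m≤n {f} p with ℕₚ.m≤n⇒∃[o]m+o≡n m≤n
  ... | o , ≡.refl = trans (fold-+ m o f)
    (trans (∙-congˡ (fold-ε o (λ i → p (m ℕ.+ i) (ℕₚ.m≤m+n m i)))) (identityʳ _))

  fold-blocks : ∀ k n f → fold (n ℕ.* k) f ≈ fold k (λ s → fold n (λ i → f (s ℕ.+ i ℕ.* k)))
  fold-blocks k zero f = sym (fold-ε k (λ _ → refl))
  fold-blocks k (suc n) f = begin
    fold (k ℕ.+ n ℕ.* k) f
      ≡⟨ ≡.cong (λ m → fold m f) (ℕₚ.+-comm k (n ℕ.* k)) ⟩
    fold (n ℕ.* k ℕ.+ k) f
      ≈⟨ fold-+ (n ℕ.* k) k f ⟩
    fold (n ℕ.* k) f ∙ fold k (λ s → f (n ℕ.* k ℕ.+ s))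
      ≈⟨ ∙-cong (fold-blocks k n f) (fold-cong′ k (λ s → reflexive (≡.cong f (ℕₚ.+-comm (n ℕ.* k) s)))) ⟩
    fold k (λ s → fold n (λ i → f (s ℕ.+ i ℕ.* k))) ∙ fold k (λ s → f (s ℕ.+ n ℕ.* k))
      ≈⟨ sym (fold-∙ k _ _) ⟩
    fold k (λ s → fold (suc n) (λ i → f (s ℕ.+ i ℕ.* k))) ∎

  diag : ℕ → (ℕ → ℕ → Carrier) → Carrier
  diag zero    F = F 0 0
  diag (suc n) F = F 0 (suc n) ∙ diag n (λ a b → F (suc a) b)

  diag-cong : ∀ n {F G} → (∀ a b → a ℕ.+ b ≡ n → F a b ≈ G a b) → diag n F ≈ diag n G
  diag-cong zero    p = p 0 0 ≡.refl
  diag-cong (suc n) p = ∙-cong (p 0 (suc n) ≡.refl) (diag-cong n (λ a b e → p (suc a) b (≡.cong suc e)))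

  diag-∙ : ∀ n F G → diag n (λ a b → F a b ∙ G a b) ≈ diag n F ∙ diag n G
  diag-∙ zero    F G = refl
  diag-∙ (suc n) F G = trans (∙-congˡ (diag-∙ n _ _)) (interchange _ _ _ _)

  diag-last : ∀ n F → diag (suc n) F ≈ diag n (λ a b → F a (suc b)) ∙ F (suc n) 0
  diag-last zero    F = refl
  diag-last (suc n) F = trans (∙-congˡ (diag-last n (λ a b → F (suc a) b))) (sym (assoc _ _ _))

  diag-fold : ∀ n f → diag n (λ a b → f a) ≈ fold (suc n) f
  diag-fold zero    f = sym (identityˡ (f 0))
  diag-fold (suc n) f = trans (∙-congˡ (diag-fold n (λ i → f (suc i)))) (sym (fold-suc (suc n) f))

  -- Induction strips the row a = 0. The square of side n that is left is widened by the column b =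
  -- n, on which `F` vanishes.
  triangle-square : ∀ n F → (∀ a b → n ℕ.≤ a ℕ.+ b → F a b ≈ ε) →
                    fold n (λ k → diag k F) ≈ fold n (λ a → fold n (F a))
  triangle-square zero    F p = refl
  triangle-square (suc n) F p = begin
    fold (suc n) (λ k → diag k F)
      ≈⟨ fold-suc n _ ⟩
    F 0 0 ∙ fold n (λ k → F 0 (suc k) ∙ diag k (λ a b → F (suc a) b))
      ≈⟨ ∙-congˡ (fold-∙ n _ _) ⟩
    F 0 0 ∙ (fold n (λ k → F 0 (suc k)) ∙ fold n (λ k → diag k (λ a b → F (suc a) b)))
      ≈⟨ sym (assoc _ _ _) ⟩
    F 0 0 ∙ fold n (λ k → F 0 (suc k)) ∙ fold n (λ k → diag k (λ a b → F (suc a) b))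
      ≈⟨ ∙-cong (sym (fold-suc n (F 0)))
           (triangle-square n (λ a b → F (suc a) b) (λ a b n≤a+b → p (suc a) b (s≤s n≤a+b))) ⟩
    fold (suc n) (F 0) ∙ fold n (λ a → fold n (F (suc a)))
      ≈⟨ ∙-congˡ (fold-cong′ n (λ a → sym (trans (∙-congˡ (p (suc a) n (s≤s (ℕₚ.m≤n+m n a)))) (identityʳ _)))) ⟩
    fold (suc n) (F 0) ∙ fold n (λ a → fold (suc n) (F (suc a)))
      ≈⟨ sym (fold-suc n (λ a → fold (suc n) (F a))) ⟩
    fold (suc n) (λ a → fold (suc n) (F a)) ∎

-- q-Pochhammer symbols over a nilpotent base

triangular : ℕ → ℕ
triangular zero    = 0
triangular (suc j) = triangular j ℕ.+ j

module QSeries {c ℓ} (R : CommutativeRing c ℓ)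
  (morphism : CommutativeRing.rawRing Cyclotomic.commutativeRing ACR.-Raw-AlmostCommutative⟶ ACR.fromCommutativeRing R (λ _ → nothing)) where

  open CommutativeRing R
  open Solver R morphism
  open import Algebra.Properties.Semiring.Exp semiring
  open import Algebra.Properties.Ring ring using (x∙y⁻¹≈ε⇒x≈y; -0#≈0#)
  open import Relation.Binary.Reasoning.Setoid setoid
  module Sum = Fold +-commutativeMonoid
  module Product = Fold *-commutativeMonoid
  open Sum public using (diag; diag-cong; diag-∙; diag-last; diag-fold; triangle-square) renaming (fold to ∑)
  open Product public using () renaming (fold to ∏)

  ∑-* : ∀ k n f → ∑ n (λ i → k * f i) ≈ k * ∑ n f
  ∑-* k zero    f = sym (zeroʳ k)
  ∑-* k (suc n) f = trans (+-congʳ (∑-* k n f)) (sym (distribˡ k _ _))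

  diag-* : ∀ k n F → diag n (λ a b → k * F a b) ≈ k * diag n F
  diag-* k zero    F = refl
  diag-* k (suc n) F = trans (+-congˡ (diag-* k n _)) (sym (distribˡ k _ _))

  ^-distrib-* : ∀ x y n → (x * y) ^ n ≈ x ^ n * y ^ n
  ^-distrib-* x y zero    = sym (*-identityˡ 1#)
  ^-distrib-* x y (suc n) = trans (*-congˡ (^-distrib-* x y n))
    (solve 4 (λ x y a b → x :* y :* (a :* b) ⊜ x :* a :* (y :* b)) refl x y (x ^ n) (y ^ n))

  ^-vanish : ∀ x {m n} → x ^ m ≈ 0# → m ℕ.≤ n → x ^ n ≈ 0#
  ^-vanish x {m} p m≤n with ℕₚ.m≤n⇒∃[o]m+o≡n m≤n
  ... | o , ≡.refl = trans (^-homo-* x m o) (trans (*-congʳ p) (zeroˡ _))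

  -- The hypothesis says that d = f - g satisfies d = x d, hence d = x^n d = 0.
  1-nilpotent-cancel : ∀ x n {f g} → x ^ n ≈ 0# → (1# - x) * f ≈ (1# - x) * g → f ≈ g
  1-nilpotent-cancel x n {f} {g} xⁿ≈0 eq = x∙y⁻¹≈ε⇒x≈y f g (trans (iterate n) (trans (*-congʳ xⁿ≈0) (zeroˡ _)))
    where
    fixed : f - g ≈ x * (f - g)
    fixed = begin
      f - g
        ≈⟨ solve 3 (λ x f g → f :- g ⊜ (:1 :- x) :* f :- (:1 :- x) :* g :+ x :* (f :- g)) refl x f g ⟩
      (1# - x) * f - (1# - x) * g + x * (f - g)
        ≈⟨ +-congʳ (+-congʳ eq) ⟩
      (1# - x) * g - (1# - x) * g + x * (f - g)
        ≈⟨ trans (+-congʳ (-‿inverseʳ _)) (+-identityˡ _) ⟩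
      x * (f - g) ∎
    iterate : ∀ n → f - g ≈ x ^ n * (f - g)
    iterate zero    = sym (*-identityˡ _)
    iterate (suc n) = trans (iterate n) (trans (*-congˡ fixed)
      (solve 3 (λ x a d → a :* (x :* d) ⊜ x :* a :* d) refl x (x ^ n) (f - g)))

  module Nilpotent (Q : Carrier) (N : ℕ) (Q^N≈0 : Q ^ N ≈ 0#) where

    Q^-vanish : ∀ {k} → N ℕ.≤ k → Q ^ k ≈ 0#
    Q^-vanish = ^-vanish Q Q^N≈0

    rising : Carrier → ℕ → Carrier
    rising x n = ∏ n (λ i → 1# - x * Q ^ i)

    pochhammer : Carrier → Carrier
    pochhammer x = rising x N

    -- This is (Q)_∞ / (Q)_n. Thus `τ a * τ b` stands for 1 / ((Q)_a (Q)_b) up to the factor (Q)_∞²,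
    -- and [a+b; a] is `τ a * τ b` over `τ (a + b) * τ 0`, with no division performed.
    τ : ℕ → Carrier
    τ n = pochhammer (Q ^ suc n)

    rising-cong : ∀ {x y} n → x ≈ y → rising x n ≈ rising y n
    rising-cong n p = Product.fold-cong′ n (λ i → +-congˡ (-‿cong (*-congʳ p)))

    1-vanish : ∀ {x} → x ≈ 0# → 1# - x ≈ 1#
    1-vanish p = trans (+-congˡ (trans (-‿cong p) -0#≈0#)) (+-identityʳ 1#)

    rising-+ : ∀ x m n → rising x (m ℕ.+ n) ≈ rising x m * rising (x * Q ^ m) n
    rising-+ x m n = trans (Product.fold-+ m n _) (*-congˡ (Product.fold-cong′ n (λ i →
      +-congˡ (-‿cong (trans (*-congˡ (^-homo-* Q m i)) (sym (*-assoc _ _ _)))))))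

    rising-suc : ∀ x n → rising x (suc n) ≈ (1# - x) * rising (x * Q) n
    rising-suc x n = trans (rising-+ x 1 n) (*-cong
      (trans (*-identityˡ _) (+-congˡ (-‿cong (*-identityʳ x))))
      (rising-cong n (*-congˡ (*-identityʳ Q))))

    rising-stable : ∀ x {n} → N ℕ.≤ n → rising x n ≈ pochhammer x
    rising-stable x N≤n = Product.fold-pad N≤n (λ i N≤i →
      1-vanish (trans (*-congˡ (Q^-vanish N≤i)) (zeroʳ x)))

    pochhammer-suc : ∀ x → pochhammer x ≈ (1# - x) * pochhammer (x * Q)
    pochhammer-suc x = trans (sym (rising-stable x (ℕₚ.n≤1+n N))) (rising-suc x N)

    pochhammer-vanish : ∀ {x} → x ≈ 0# → pochhammer x ≈ 1#
    pochhammer-vanish {x} p = Product.fold-ε N (λ i → 1-vanish (trans (*-congʳ p) (zeroˡ _)))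

    τ-suc : ∀ n → τ n ≈ (1# - Q ^ suc n) * τ (suc n)
    τ-suc n = trans (pochhammer-suc _) (*-congˡ (rising-cong N (*-comm _ _)))

    τ-stable : ∀ {n} → N ℕ.≤ n → τ n ≈ 1#
    τ-stable N≤n = pochhammer-vanish (Q^-vanish (ℕₚ.m≤n⇒m≤1+n N≤n))

    1-Q^-cancel : ∀ k {f g} → (1# - Q ^ suc k) * f ≈ (1# - Q ^ suc k) * g → f ≈ g
    1-Q^-cancel k = 1-nilpotent-cancel (Q ^ suc k) N (trans (^-assocʳ Q (suc k) N)
      (Q^-vanish (ℕₚ.m≤m+n N (k ℕ.* N))))

    -- The factors 1 - Q^(k+1), 1 - Q^(k+2), ... are cancelled one at a time; m bounds how many
    -- remain before `τ` becomes 1.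
    τ-cancel : ∀ m k {f g} → N ℕ.≤ k ℕ.+ m → τ k * f ≈ τ k * g → f ≈ g
    τ-cancel zero k {f} {g} N≤k eq = begin
      f          ≈⟨ sym (*-identityˡ f) ⟩
      1# * f     ≈⟨ *-congʳ (sym τ≈1) ⟩
      τ k * f    ≈⟨ eq ⟩
      τ k * g    ≈⟨ *-congʳ τ≈1 ⟩
      1# * g     ≈⟨ *-identityˡ g ⟩
      g          ∎
      where τ≈1 = τ-stable (≡.subst (N ℕ.≤_) (ℕₚ.+-identityʳ k) N≤k)
    τ-cancel (suc m) k N≤k+m eq = τ-cancel m (suc k) (≡.subst (N ℕ.≤_) (ℕₚ.+-suc k m) N≤k+m)
      (1-Q^-cancel k (trans (sym (*-assoc _ _ _)) (trans (*-congʳ (sym (τ-suc k)))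
        (trans eq (trans (*-congʳ (τ-suc k)) (*-assoc _ _ _))))))

    -- The q-Pascal rule, for either way of splitting 1 - Q^(a+b) into multiples
    -- of 1 - Q^b and 1 - Q^a.
    pascal : ∀ (s t : ℕ → ℕ → Carrier) →
             (∀ a b → 1# - Q ^ (a ℕ.+ b) ≈ s a b * (1# - Q ^ b) + t a b * (1# - Q ^ a)) →
             ∀ n (g : ℕ → Carrier) → (1# - Q ^ suc n) * diag (suc n) (λ a b → g a * (τ a * τ b)) ≈
             diag n (λ a b → (s a (suc b) * g a + t (suc a) b * g (suc a)) * (τ a * τ b))
    pascal s t split n g = begin
      (1# - Q ^ suc n) * diag (suc n) (λ a b → g a * (τ a * τ b))
        ≈⟨ sym (diag-* _ (suc n) (λ a b → g a * (τ a * τ b))) ⟩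
      diag (suc n) (λ a b → (1# - Q ^ suc n) * (g a * (τ a * τ b)))
        ≈⟨ diag-cong (suc n) (λ a b a+b≡1+n → trans
             (*-congʳ (trans (+-congˡ (-‿cong (^-congʳ Q (≡.sym a+b≡1+n)))) (split a b)))
             (solve 7 (λ u v g k l s t → (s :* v :+ t :* u) :* (g :* (k :* l)) ⊜
                                         s :* g :* (k :* (v :* l)) :+ t :* g :* (u :* k :* l))
               refl (1# - Q ^ a) (1# - Q ^ b) (g a) (τ a) (τ b) (s a b) (t a b))) ⟩
      diag (suc n) (λ a b → A a b + B a b)
        ≈⟨ diag-∙ (suc n) A B ⟩
      diag (suc n) A + diag (suc n) B
        -- The end terms contain 1 - Q^0 = 0, so both antidiagonals shrink from n + 1 to n.
        ≈⟨ +-cong (trans (diag-last n A) (trans (+-congˡ A≈0) (+-identityʳ _)))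
                  (trans (+-congʳ B≈0) (+-identityˡ _)) ⟩
      diag n (λ a b → A a (suc b)) + diag n (λ a b → B (suc a) b)
        ≈⟨ sym (diag-∙ n _ _) ⟩
      diag n (λ a b → A a (suc b) + B (suc a) b)
        ≈⟨ diag-cong n (λ a b _ → trans
             (+-cong (*-congˡ (*-congˡ (sym (τ-suc b)))) (*-congˡ (*-congʳ (sym (τ-suc a)))))
             (sym (distribʳ (τ a * τ b) (s a (suc b) * g a) (t (suc a) b * g (suc a))))) ⟩
      diag n (λ a b → (s a (suc b) * g a + t (suc a) b * g (suc a)) * (τ a * τ b)) ∎
      where
      A B : ℕ → ℕ → Carrier
      A a b = s a b * g a * (τ a * ((1# - Q ^ b) * τ b))
      B a b = t a b * g a * ((1# - Q ^ a) * τ a * τ b)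
      A≈0 : A (suc n) 0 ≈ 0#
      A≈0 = trans (*-congˡ (*-congˡ (trans (*-congʳ (-‿inverseʳ 1#)) (zeroˡ _)))) (trans (*-congˡ (zeroʳ _)) (zeroʳ _))
      B≈0 : B 0 (suc n) ≈ 0#
      B≈0 = trans (*-congˡ (*-congʳ (trans (*-congʳ (-‿inverseʳ 1#)) (zeroˡ _)))) (trans (*-congˡ (zeroˡ _)) (zeroʳ _))

    pascalˡ : ∀ n (g : ℕ → Carrier) → (1# - Q ^ suc n) * diag (suc n) (λ a b → g a * (τ a * τ b)) ≈
              diag n (λ a b → (Q ^ a * g a + 1# * g (suc a)) * (τ a * τ b))
    pascalˡ = pascal (λ a _ → Q ^ a) (λ _ _ → 1#) (λ a b → trans (+-congˡ (-‿cong (^-homo-* Q a b)))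
      (solve 2 (λ u v → :1 :- u :* v ⊜ u :* (:1 :- v) :+ :1 :* (:1 :- u)) refl (Q ^ a) (Q ^ b)))

    pascalʳ : ∀ n (g : ℕ → Carrier) → (1# - Q ^ suc n) * diag (suc n) (λ a b → g a * (τ a * τ b)) ≈
              diag n (λ a b → (1# * g a + Q ^ b * g (suc a)) * (τ a * τ b))
    pascalʳ = pascal (λ _ _ → 1#) (λ _ b → Q ^ b) (λ a b → trans (+-congˡ (-‿cong (^-homo-* Q a b)))
      (solve 2 (λ u v → :1 :- u :* v ⊜ :1 :* (:1 :- v) :+ v :* (:1 :- u)) refl (Q ^ a) (Q ^ b)))

    -- Durfee's identity

    durfee-term : ℕ → ℕ → Carrier
    durfee-term h i = Q ^ (i ℕ.* i ℕ.+ h ℕ.* i) * (τ i * τ (i ℕ.+ h))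

    -- The sum of Q^(i²+hi) / ((Q)_i (Q)_(i+h)), multiplied by (Q)_∞². The symmetric form with n - j
    -- and n + j is the case i = n - j, h = 2j, up to Q^(j²).
    durfee-sum : ℕ → Carrier
    durfee-sum h = ∑ (suc N) (durfee-term h)

    -- With D h for durfee-sum h: D h - D (1+h) = - Q^(1+h) (D (1+h) - D (2+h)), and
    -- D is stationary from N on, so D is constant.
    durfee-recurrence : ∀ h → durfee-sum h + Q ^ suc h * durfee-sum (suc h) ≈
                        durfee-sum (suc h) + Q ^ suc h * durfee-sum (suc (suc h))
    durfee-recurrence h = begin
      durfee-sum h + Q ^ suc h * durfee-sum (suc h)
        ≈⟨ trans (+-congˡ (sym (∑-* _ (suc N) _))) (sym (Sum.fold-∙ (suc N) _ _)) ⟩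
      ∑ (suc N) (λ i → durfee-term h i + Q ^ suc h * durfee-term (suc h) i)
        ≈⟨ Sum.fold-cong′ (suc N) split ⟩
      ∑ (suc N) (λ i → durfee-term (suc h) i + A i)
        ≈⟨ Sum.fold-∙ (suc N) _ _ ⟩
      durfee-sum (suc h) + ∑ (suc N) A
        ≈⟨ +-congˡ (trans (Sum.fold-suc N A) (trans (+-congʳ A₀≈0) (+-identityˡ _))) ⟩
      durfee-sum (suc h) + ∑ N (λ i → A (suc i))
        -- The shift costs one term; it is restored because `A (suc N)` contains Q^((N+1)²), which
        -- is zero.
        ≈⟨ +-congˡ (sym (trans (+-congˡ A-last≈0) (+-identityʳ _))) ⟩
      durfee-sum (suc h) + ∑ (suc N) (λ i → A (suc i))
        ≈⟨ +-congˡ (trans (Sum.fold-cong′ (suc N) shift) (∑-* _ (suc N) _)) ⟩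
      durfee-sum (suc h) + Q ^ suc h * durfee-sum (suc (suc h)) ∎
      where
      e : ℕ → ℕ
      e i = i ℕ.* i ℕ.+ h ℕ.* i
      A : ℕ → Carrier
      A i = Q ^ e i * ((1# - Q ^ i) * τ i) * τ (i ℕ.+ suc h)

      A₀≈0 : A 0 ≈ 0#
      A₀≈0 = trans (*-congʳ (trans (*-congˡ (trans (*-congʳ (-‿inverseʳ 1#)) (zeroˡ _))) (zeroʳ _))) (zeroˡ _)

      A-last≈0 : A (suc N) ≈ 0#
      A-last≈0 = trans (*-congʳ (trans (*-congʳ (Q^-vanish (ℕₚ.≤-trans (ℕₚ.≤-trans (ℕₚ.n≤1+n N)
        (ℕₚ.m≤m*n (suc N) (suc N))) (ℕₚ.m≤m+n _ _)))) (zeroˡ _))) (zeroˡ _)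

      e-suc : ∀ i h → i ℕ.* i ℕ.+ suc h ℕ.* i ≡ (i ℕ.* i ℕ.+ h ℕ.* i) ℕ.+ i
      e-suc = solve-∀

      split : ∀ i → durfee-term h i + Q ^ suc h * durfee-term (suc h) i ≈ durfee-term (suc h) i + A i
      split i = begin
        Q ^ e i * (τ i * τ (i ℕ.+ h)) + Q ^ suc h * (Q ^ (i ℕ.* i ℕ.+ suc h ℕ.* i) * (τ i * τ (i ℕ.+ suc h)))
          ≈⟨ +-cong (*-congˡ (*-congˡ τ-next)) (*-congˡ (*-congʳ Q^e)) ⟩
        Q ^ e i * (τ i * ((1# - Q ^ i * Q ^ suc h) * τ (i ℕ.+ suc h))) +
        Q ^ suc h * (Q ^ e i * Q ^ i * (τ i * τ (i ℕ.+ suc h)))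
          ≈⟨ solve 5 (λ E u v s t → E :* (s :* ((:1 :- u :* v) :* t)) :+ v :* (E :* u :* (s :* t)) ⊜
                                    E :* u :* (s :* t) :+ E :* ((:1 :- u) :* s) :* t)
               refl (Q ^ e i) (Q ^ i) (Q ^ suc h) (τ i) (τ (i ℕ.+ suc h)) ⟩
        Q ^ e i * Q ^ i * (τ i * τ (i ℕ.+ suc h)) + A i
          ≈⟨ +-congʳ (*-congʳ (sym Q^e)) ⟩
        durfee-term (suc h) i + A i ∎
        where
        τ-next : τ (i ℕ.+ h) ≈ (1# - Q ^ i * Q ^ suc h) * τ (i ℕ.+ suc h)
        τ-next = begin
          τ (i ℕ.+ h)
            ≈⟨ τ-suc (i ℕ.+ h) ⟩
          (1# - Q ^ suc (i ℕ.+ h)) * τ (suc (i ℕ.+ h))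
            ≡⟨ ≡.cong (λ k → (1# - Q ^ k) * τ k) (≡.sym (ℕₚ.+-suc i h)) ⟩
          (1# - Q ^ (i ℕ.+ suc h)) * τ (i ℕ.+ suc h)
            ≈⟨ *-congʳ (+-congˡ (-‿cong (^-homo-* Q i (suc h)))) ⟩
          (1# - Q ^ i * Q ^ suc h) * τ (i ℕ.+ suc h) ∎
        Q^e : Q ^ (i ℕ.* i ℕ.+ suc h ℕ.* i) ≈ Q ^ e i * Q ^ i
        Q^e = trans (^-congʳ Q (e-suc i h)) (^-homo-* Q (e i) i)

      exponent : ∀ i h → suc i ℕ.* suc i ℕ.+ h ℕ.* suc i ≡ suc h ℕ.+ (i ℕ.* i ℕ.+ suc (suc h) ℕ.* i)
      exponent = solve-∀

      shift : ∀ i → A (suc i) ≈ Q ^ suc h * durfee-term (suc (suc h)) i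
      shift i = begin
        Q ^ e (suc i) * ((1# - Q ^ suc i) * τ (suc i)) * τ (suc i ℕ.+ suc h)
          ≈⟨ *-cong (*-cong (trans (^-congʳ Q (exponent i h)) (^-homo-* Q (suc h) _)) (sym (τ-suc i)))
                    (reflexive (≡.cong τ (≡.sym (ℕₚ.+-suc i (suc h))))) ⟩
        Q ^ suc h * Q ^ (i ℕ.* i ℕ.+ suc (suc h) ℕ.* i) * τ i * τ (i ℕ.+ suc (suc h))
          ≈⟨ solve 4 (λ u E s t → u :* E :* s :* t ⊜ u :* (E :* (s :* t))) refl (Q ^ suc h) _ (τ i) _ ⟩
        Q ^ suc h * durfee-term (suc (suc h)) i ∎

    -- Downward induction on h, with m bounding the distance to N. For h ≥ N only i = 0 survives;
    -- below, the recurrence determines the value at h from those at h + 1 and h + 2.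
    durfee : ∀ m h → N ℕ.≤ h ℕ.+ m → durfee-sum h ≈ τ 0
    durfee zero h N≤h+0 = begin
      durfee-sum h
        ≈⟨ Sum.fold-suc N (durfee-term h) ⟩
      Q ^ (h ℕ.* 0) * (τ 0 * τ h) + ∑ N (λ i → durfee-term h (suc i))
        ≈⟨ +-cong (*-cong (^-congʳ Q (ℕₚ.*-zeroʳ h)) (*-congˡ (τ-stable N≤h)))
             (Sum.fold-ε N (λ i → trans (*-congʳ (Q^-vanish (ℕₚ.≤-trans (ℕₚ.≤-trans N≤h (ℕₚ.m≤m*n h (suc i)))
               (ℕₚ.m≤n+m _ (suc i ℕ.* suc i))))) (zeroˡ _))) ⟩
      1# * (τ 0 * 1#) + 0#
        ≈⟨ trans (+-identityʳ _) (trans (*-identityˡ _) (*-identityʳ _)) ⟩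
      τ 0 ∎
      where N≤h = ≡.subst (N ℕ.≤_) (ℕₚ.+-identityʳ h) N≤h+0
    durfee (suc m) h N≤ = x∙y⁻¹≈ε⇒x≈y _ _ (begin
      durfee-sum h - τ 0
        ≈⟨ solve 3 (λ d u t → d :- t ⊜ d :+ u :* t :- (t :+ u :* t)) refl (durfee-sum h) (Q ^ suc h) (τ 0) ⟩
      durfee-sum h + Q ^ suc h * τ 0 - (τ 0 + Q ^ suc h * τ 0)
        ≈⟨ +-cong (+-congˡ (*-congˡ (sym D₁))) (-‿cong (+-cong (sym D₁) (*-congˡ (sym D₂)))) ⟩
      durfee-sum h + Q ^ suc h * durfee-sum (suc h) - (durfee-sum (suc h) + Q ^ suc h * durfee-sum (suc (suc h)))
        ≈⟨ trans (+-congʳ (durfee-recurrence h)) (-‿inverseʳ _) ⟩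
      0# ∎)
      where
      N≤′ = ≡.subst (N ℕ.≤_) (ℕₚ.+-suc h m) N≤
      D₁ = durfee m (suc h) N≤′
      D₂ = durfee m (suc (suc h)) (ℕₚ.m≤n⇒m≤1+n N≤′)

    -- Jacobi's triple product, finite and infinite

    gaussian : Carrier → ℕ → Carrier
    gaussian x j = (- x) ^ j * Q ^ triangular j

    gaussian-vanish : ∀ x {j} → N ℕ.≤ j → gaussian x (suc j) ≈ 0#
    gaussian-vanish x {j} N≤j = trans (*-congˡ (Q^-vanish (ℕₚ.≤-trans N≤j (ℕₚ.m≤n+m j (triangular j))))) (zeroʳ _)

    gaussian-suc : ∀ x j → gaussian x (suc j) ≈ - (x * Q ^ j) * gaussian x j
    gaussian-suc x j = trans (*-congˡ (^-homo-* Q (triangular j) j))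
      (solve 4 (λ x p u v → :- x :* p :* (u :* v) ⊜ :- (x :* v) :* (p :* u)) refl x ((- x) ^ j) (Q ^ triangular j) (Q ^ j))

    theta-series : Carrier → Carrier → ℕ → Carrier
    theta-series x y L = ∑ L (gaussian x) + ∑ L (λ j → gaussian y (suc j))

    module Jacobi (x y : Carrier) (xy≈Q : x * y ≈ Q) where

      -- w n a is the term (-1)^j x^j Q^(j(j-1)/2) of the theta series at j = a - n.
      w : ℕ → ℕ → Carrier
      w zero    zero    = 1#
      w zero    (suc a) = - (x * Q ^ a) * w 0 a
      w (suc n) zero    = - (y * Q ^ n) * w n 0
      w (suc n) (suc a) = w n a

      w-shift : ∀ n k → w n (n ℕ.+ k) ≡ w 0 k
      w-shift zero    k = ≡.refl
      w-shift (suc n) k = w-shift n k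

      -- Passing from n to n + 1 lowers j = a - n by one. The ratio of neighbouring terms is -x Q^j,
      -- and x y = Q turns its inverse into a multiplication: (y Q^n)(x Q^(a-n-1)) = Q^a.
      w-step : ∀ n a → Q ^ a * w (suc n) a ≈ - (y * Q ^ n) * w n a
      w-step n zero = *-identityˡ _
      w-step zero (suc a) = begin
        Q * Q ^ a * w 0 a
          ≈⟨ *-congʳ (*-congʳ (sym xy≈Q)) ⟩
        x * y * Q ^ a * w 0 a
          ≈⟨ solve 4 (λ x y u w → x :* y :* u :* w ⊜ :- (y :* :1) :* (:- (x :* u) :* w)) refl x y (Q ^ a) (w 0 a) ⟩
        - (y * 1#) * (- (x * Q ^ a) * w 0 a) ∎
      w-step (suc n) (suc a) = begin
        Q * Q ^ a * w (suc n) a        ≈⟨ *-assoc _ _ _ ⟩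
        Q * (Q ^ a * w (suc n) a)      ≈⟨ *-congˡ (w-step n a) ⟩
        Q * (- (y * Q ^ n) * w n a)
          ≈⟨ solve 4 (λ q y u w → q :* (:- (y :* u) :* w) ⊜ :- (y :* (q :* u)) :* w) refl Q y (Q ^ n) (w n a) ⟩
        - (y * (Q * Q ^ n)) * w n a    ∎

      finite-jacobi₀ : ∀ m → rising x m * (τ m * τ 0) ≈ diag m (λ a b → w 0 a * (τ a * τ b))
      finite-jacobi₀ zero    = refl
      finite-jacobi₀ (suc m) = 1-Q^-cancel m (begin
        (1# - Q ^ suc m) * (rising x m * (1# - x * Q ^ m) * (τ (suc m) * τ 0))
          ≈⟨ solve 5 (λ u r v s t → u :* (r :* v :* (s :* t)) ⊜ v :* (r :* (u :* s :* t)))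
               refl (1# - Q ^ suc m) (rising x m) (1# - x * Q ^ m) (τ (suc m)) (τ 0) ⟩
        (1# - x * Q ^ m) * (rising x m * ((1# - Q ^ suc m) * τ (suc m) * τ 0))
          ≈⟨ *-congˡ (trans (*-congˡ (*-congʳ (sym (τ-suc m)))) (finite-jacobi₀ m)) ⟩
        (1# - x * Q ^ m) * diag m (λ a b → w 0 a * (τ a * τ b))
          ≈⟨ sym (diag-* _ m _) ⟩
        diag m (λ a b → (1# - x * Q ^ m) * (w 0 a * (τ a * τ b)))
          ≈⟨ diag-cong m (λ a b a+b≡m → trans
               (*-congʳ (+-congˡ (-‿cong (*-congˡ (trans (^-congʳ Q (≡.sym a+b≡m)) (^-homo-* Q a b))))))
               (solve 5 (λ x u v w s → (:1 :- x :* (u :* v)) :* (w :* s) ⊜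
                                       (:1 :* w :+ v :* (:- (x :* u) :* w)) :* s)
                 refl x (Q ^ a) (Q ^ b) (w 0 a) (τ a * τ b))) ⟩
        diag m (λ a b → (1# * w 0 a + Q ^ b * w 0 (suc a)) * (τ a * τ b))
          ≈⟨ sym (pascalʳ m (w 0)) ⟩
        (1# - Q ^ suc m) * diag (suc m) (λ a b → w 0 a * (τ a * τ b)) ∎)

      -- Independent lengths m and n let the two products grow one factor at a time:
      -- `finite-jacobi₀` adds factors in x by `pascalʳ`, and this induction adds factors in y by
      -- `pascalˡ`.
      finite-jacobi : ∀ n m → rising x m * rising y n * (τ (n ℕ.+ m) * τ 0) ≈
                      diag (n ℕ.+ m) (λ a b → w n a * (τ a * τ b))
      finite-jacobi zero    m = trans (*-congʳ (*-identityʳ _)) (finite-jacobi₀ m)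
      finite-jacobi (suc n) m = 1-Q^-cancel (n ℕ.+ m) (begin
        (1# - Q ^ suc (n ℕ.+ m)) * (rising x m * (rising y n * (1# - y * Q ^ n)) * (τ (suc (n ℕ.+ m)) * τ 0))
          ≈⟨ solve 6 (λ u p r v s t → u :* (p :* (r :* v) :* (s :* t)) ⊜ v :* (p :* r :* (u :* s :* t)))
               refl (1# - Q ^ suc (n ℕ.+ m)) (rising x m) (rising y n) (1# - y * Q ^ n) (τ (suc (n ℕ.+ m))) (τ 0) ⟩
        (1# - y * Q ^ n) * (rising x m * rising y n * ((1# - Q ^ suc (n ℕ.+ m)) * τ (suc (n ℕ.+ m)) * τ 0))
          ≈⟨ *-congˡ (trans (*-congˡ (*-congʳ (sym (τ-suc (n ℕ.+ m))))) (finite-jacobi n m)) ⟩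
        (1# - y * Q ^ n) * diag (n ℕ.+ m) (λ a b → w n a * (τ a * τ b))
          ≈⟨ sym (diag-* _ (n ℕ.+ m) _) ⟩
        diag (n ℕ.+ m) (λ a b → (1# - y * Q ^ n) * (w n a * (τ a * τ b)))
          ≈⟨ diag-cong (n ℕ.+ m) (λ a b _ → begin
               (1# - y * Q ^ n) * (w n a * (τ a * τ b))
                 ≈⟨ solve 3 (λ u w s → (:1 :- u) :* (w :* s) ⊜ (:- u :* w :+ :1 :* w) :* s) refl (y * Q ^ n) (w n a) (τ a * τ b) ⟩
               (- (y * Q ^ n) * w n a + 1# * w n a) * (τ a * τ b)
                 ≈⟨ *-congʳ (+-congʳ (sym (w-step n a))) ⟩
               (Q ^ a * w (suc n) a + 1# * w (suc n) (suc a)) * (τ a * τ b) ∎) ⟩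
        diag (n ℕ.+ m) (λ a b → (Q ^ a * w (suc n) a + 1# * w (suc n) (suc a)) * (τ a * τ b))
          ≈⟨ sym (pascalˡ (n ℕ.+ m) (w (suc n))) ⟩
        (1# - Q ^ suc (n ℕ.+ m)) * diag (suc (n ℕ.+ m)) (λ a b → w (suc n) a * (τ a * τ b)) ∎)

      v : ℕ → Carrier
      v zero    = 1#
      v (suc j) = w 0 (suc j) + w (suc j) 0

      -- The entries a = n - j and a = n + j carry the same product of values of `t`; they merge
      -- into `v j`, with i = n - j the smaller index. Each induction step detaches both ends of the
      -- antidiagonal.
      diag-centre : ∀ n (t : ℕ → Carrier) → diag (n ℕ.+ n) (λ a b → w n a * (t a * t b)) ≈
                    diag n (λ j i → v j * (t i * t (i ℕ.+ (j ℕ.+ j))))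
      diag-centre zero    t = refl
      diag-centre (suc n) t rewrite ℕₚ.+-suc n n = begin
        w (suc n) 0 * (t 0 * t d) + diag (suc (n ℕ.+ n)) (λ a b → w n a * (t (suc a) * t b))
          ≈⟨ +-congˡ (diag-last (n ℕ.+ n) (λ a b → w n a * (t (suc a) * t b))) ⟩
        w (suc n) 0 * (t 0 * t d) + (diag (n ℕ.+ n) (λ a b → w n a * (t (suc a) * t (suc b))) + w n (suc (n ℕ.+ n)) * (t d * t 0))
          ≈⟨ +-congˡ (+-cong (diag-centre n (λ i → t (suc i)))
               (*-congʳ (reflexive (≡.trans (≡.cong (w n) (≡.sym (ℕₚ.+-suc n n))) (w-shift n (suc n)))))) ⟩
        w (suc n) 0 * (t 0 * t d) + (D + w 0 (suc n) * (t d * t 0))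
          ≈⟨ solve 5 (λ w s t D z → w :* (s :* t) :+ (D :+ z :* (t :* s)) ⊜ D :+ (z :+ w) :* (s :* t))
               refl (w (suc n) 0) (t 0) (t d) D (w 0 (suc n)) ⟩
        D + v (suc n) * (t 0 * t d)
          ≈⟨ +-congˡ (*-congˡ (*-congˡ (reflexive (≡.cong (λ k → t (suc k)) (≡.sym (ℕₚ.+-suc n n)))))) ⟩
        D + v (suc n) * (t 0 * t (suc n ℕ.+ suc n))
          ≈⟨ sym (diag-last n (λ j i → v j * (t i * t (i ℕ.+ (j ℕ.+ j))))) ⟩
        diag (suc n) (λ j i → v j * (t i * t (i ℕ.+ (j ℕ.+ j)))) ∎
        where
        d = suc (suc (n ℕ.+ n))
        D = diag n (λ j i → v j * (t (suc i) * t (suc (i ℕ.+ (j ℕ.+ j)))))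

      w-right : ∀ j → w 0 j ≈ gaussian x j
      w-right zero    = sym (*-identityʳ 1#)
      w-right (suc j) = trans (*-congˡ (w-right j)) (sym (gaussian-suc x j))

      w-left : ∀ j → w j 0 ≈ gaussian y j
      w-left zero    = sym (*-identityʳ 1#)
      w-left (suc j) = trans (*-congˡ (w-left j)) (sym (gaussian-suc y j))

      v-sum : ∀ n (f : ℕ → Carrier) → ∑ (suc n) (λ j → v j * f j) ≈
              ∑ (suc n) (λ j → gaussian x j * f j) + ∑ n (λ j → gaussian y (suc j) * f (suc j))
      v-sum n f = begin
        ∑ (suc n) (λ j → v j * f j)
          ≈⟨ Sum.fold-suc n _ ⟩
        1# * f 0 + ∑ n (λ j → v (suc j) * f (suc j))
          ≈⟨ +-cong (*-congʳ (w-right 0)) (trans (Sum.fold-cong′ n (λ j → trans (distribʳ _ _ _)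
               (+-cong (*-congʳ (w-right (suc j))) (*-congʳ (w-left (suc j)))))) (Sum.fold-∙ n _ _)) ⟩
        gaussian x 0 * f 0 + (∑ n (λ j → gaussian x (suc j) * f (suc j)) + ∑ n (λ j → gaussian y (suc j) * f (suc j)))
          ≈⟨ sym (+-assoc _ _ _) ⟩
        gaussian x 0 * f 0 + ∑ n (λ j → gaussian x (suc j) * f (suc j)) + ∑ n (λ j → gaussian y (suc j) * f (suc j))
          ≈⟨ +-congʳ (sym (Sum.fold-suc n (λ j → gaussian x j * f j))) ⟩
        ∑ (suc n) (λ j → gaussian x j * f j) + ∑ n (λ j → gaussian y (suc j) * f (suc j)) ∎

      v-vanish : ∀ {j} → N ℕ.< j → v j ≈ 0#
      v-vanish {suc j} (s≤s N≤j) = trans (+-cong (trans (w-right (suc j)) (gaussian-vanish x N≤j))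
        (trans (w-left (suc j)) (gaussian-vanish y N≤j))) (+-identityˡ 0#)

      jacobi : ∀ {L} → N ℕ.< L → pochhammer x * pochhammer y * τ 0 ≈ theta-series x y L
      jacobi {L} N<L = begin
        pochhammer x * pochhammer y * τ 0
          ≈⟨ *-cong (*-cong (sym (rising-stable x N≤n)) (sym (rising-stable y N≤n)))
               (sym (trans (*-congʳ (τ-stable (ℕₚ.≤-trans N≤n (ℕₚ.m≤m+n n n)))) (*-identityˡ _))) ⟩
        rising x n * rising y n * (τ (n ℕ.+ n) * τ 0)
          ≈⟨ finite-jacobi n n ⟩
        diag (n ℕ.+ n) (λ a b → w n a * (τ a * τ b))
          ≈⟨ diag-centre n τ ⟩
        diag n (λ j i → v j * (τ i * τ (i ℕ.+ (j ℕ.+ j))))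
          ≈⟨ diag-cong n drop-τ ⟩
        diag n (λ j i → v j * 1#)
          ≈⟨ diag-fold n _ ⟩
        ∑ (suc n) (λ j → v j * 1#)
          ≈⟨ v-sum n (λ _ → 1#) ⟩
        ∑ (suc n) (λ j → gaussian x j * 1#) + ∑ n (λ j → gaussian y (suc j) * 1#)
          ≈⟨ +-cong (Sum.fold-cong′ (suc n) (λ j → *-identityʳ _)) (Sum.fold-cong′ n (λ j → *-identityʳ _)) ⟩
        ∑ (suc n) (gaussian x) + ∑ n (λ j → gaussian y (suc j))
          ≈⟨ +-cong (trans (Sum.fold-pad (s≤s N≤n) x-tail) (sym (Sum.fold-pad N<L x-tail)))
               (trans (Sum.fold-pad N≤n y-tail) (sym (Sum.fold-pad (ℕₚ.<⇒≤ N<L) y-tail))) ⟩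
        theta-series x y L ∎
        where
        -- With n = 2N every term has either j > N, where `v j` vanishes, or i ≥ N, where both
        -- values of `τ` are 1.
        n = N ℕ.+ N
        N≤n = ℕₚ.m≤m+n N N
        x-tail : ∀ i → suc N ℕ.≤ i → gaussian x i ≈ 0#
        x-tail (suc i) (s≤s N≤i) = gaussian-vanish x N≤i
        y-tail : ∀ i → N ℕ.≤ i → gaussian y (suc i) ≈ 0#
        y-tail i = gaussian-vanish y
        drop-τ : ∀ j i → j ℕ.+ i ≡ n → v j * (τ i * τ (i ℕ.+ (j ℕ.+ j))) ≈ v j * 1#
        drop-τ j i j+i≡n with ℕₚ.≤-<-connex j N
        ... | inj₂ N<j = trans (*-congʳ (v-vanish N<j)) (trans (zeroˡ _) (sym (trans (*-congʳ (v-vanish N<j)) (zeroˡ _))))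
        ... | inj₁ j≤N = *-congˡ (trans (*-cong (τ-stable N≤i) (τ-stable (ℕₚ.≤-trans N≤i (ℕₚ.m≤m+n i _)))) (*-identityˡ 1#))
          where
          N≤i : N ℕ.≤ i
          N≤i = ℕₚ.+-cancelˡ-≤ N N i (≡.subst (ℕ._≤ N ℕ.+ i) j+i≡n (ℕₚ.+-monoˡ-≤ i j≤N))

      bailey : ∑ (suc N) (λ n → Q ^ (n ℕ.* n) * (rising x n * rising y n * τ (n ℕ.+ n))) ≈
               ∑ (suc N) (λ j → gaussian x j * Q ^ (j ℕ.* j)) +
               ∑ N (λ j → gaussian y (suc j) * Q ^ (suc j ℕ.* suc j))
      -- The extra `τ 0` is the one that `finite-jacobi` asks for, and `durfee` returns it after the
      -- summation over i.
      bailey = τ-cancel N 0 ℕₚ.≤-refl (begin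
        τ 0 * ∑ (suc N) (λ n → Q ^ (n ℕ.* n) * (rising x n * rising y n * τ (n ℕ.+ n)))
          ≈⟨ sym (∑-* (τ 0) (suc N) _) ⟩
        ∑ (suc N) (λ n → τ 0 * (Q ^ (n ℕ.* n) * (rising x n * rising y n * τ (n ℕ.+ n))))
          ≈⟨ Sum.fold-cong′ (suc N) expand ⟩
        ∑ (suc N) (λ n → diag n F)
          -- Outside the triangle Q^((j+i)²) is already zero. On the square, the inner sum over i is
          -- a complete Durfee sum with h = 2j.
          ≈⟨ triangle-square (suc N) F (λ a b N<a+b → trans (*-congʳ (Q^-vanish
               (ℕₚ.≤-trans (ℕₚ.<⇒≤ N<a+b) (square-≥ (a ℕ.+ b))))) (zeroˡ _)) ⟩
        ∑ (suc N) (λ j → ∑ (suc N) (F j))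
          ≈⟨ Sum.fold-cong′ (suc N) collapse ⟩
        ∑ (suc N) (λ j → τ 0 * (v j * Q ^ (j ℕ.* j)))
          ≈⟨ ∑-* (τ 0) (suc N) _ ⟩
        τ 0 * ∑ (suc N) (λ j → v j * Q ^ (j ℕ.* j))
          ≈⟨ *-congˡ (v-sum N (λ j → Q ^ (j ℕ.* j))) ⟩
        τ 0 * (∑ (suc N) (λ j → gaussian x j * Q ^ (j ℕ.* j)) + ∑ N (λ j → gaussian y (suc j) * Q ^ (suc j ℕ.* suc j))) ∎)
        where
        F : ℕ → ℕ → Carrier
        F j i = Q ^ ((j ℕ.+ i) ℕ.* (j ℕ.+ i)) * (v j * (τ i * τ (i ℕ.+ (j ℕ.+ j))))

        square-≥ : ∀ k → k ℕ.≤ k ℕ.* k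
        square-≥ zero    = z≤n
        square-≥ (suc k) = ℕₚ.m≤m*n (suc k) (suc k)

        expand : ∀ n → τ 0 * (Q ^ (n ℕ.* n) * (rising x n * rising y n * τ (n ℕ.+ n))) ≈ diag n F
        expand n = begin
          τ 0 * (Q ^ (n ℕ.* n) * (rising x n * rising y n * τ (n ℕ.+ n)))
            ≈⟨ solve 4 (λ s q r t → s :* (q :* (r :* t)) ⊜ q :* (r :* (t :* s))) refl
                 (τ 0) (Q ^ (n ℕ.* n)) (rising x n * rising y n) (τ (n ℕ.+ n)) ⟩
          Q ^ (n ℕ.* n) * (rising x n * rising y n * (τ (n ℕ.+ n) * τ 0))
            ≈⟨ *-congˡ (trans (finite-jacobi n n) (diag-centre n τ)) ⟩
          Q ^ (n ℕ.* n) * diag n (λ j i → v j * (τ i * τ (i ℕ.+ (j ℕ.+ j))))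
            ≈⟨ sym (diag-* _ n (λ j i → v j * (τ i * τ (i ℕ.+ (j ℕ.+ j))))) ⟩
          diag n (λ j i → Q ^ (n ℕ.* n) * (v j * (τ i * τ (i ℕ.+ (j ℕ.+ j)))))
            ≈⟨ diag-cong n (λ j i j+i≡n → *-congʳ (^-congʳ Q (≡.cong (λ k → k ℕ.* k) (≡.sym j+i≡n)))) ⟩
          diag n F ∎

        square-+ : ∀ j i → (j ℕ.+ i) ℕ.* (j ℕ.+ i) ≡ j ℕ.* j ℕ.+ (i ℕ.* i ℕ.+ (j ℕ.+ j) ℕ.* i)
        square-+ = solve-∀

        collapse : ∀ j → ∑ (suc N) (F j) ≈ τ 0 * (v j * Q ^ (j ℕ.* j))
        collapse j = begin
          ∑ (suc N) (F j)
            ≈⟨ Sum.fold-cong′ (suc N) (λ i → trans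
                 (*-congʳ (trans (^-congʳ Q (square-+ j i)) (^-homo-* Q (j ℕ.* j) _)))
                 (solve 4 (λ q e v s → q :* e :* (v :* s) ⊜ v :* q :* (e :* s)) refl (Q ^ (j ℕ.* j)) _ (v j) _)) ⟩
          ∑ (suc N) (λ i → v j * Q ^ (j ℕ.* j) * durfee-term (j ℕ.+ j) i)
            ≈⟨ ∑-* _ (suc N) _ ⟩
          v j * Q ^ (j ℕ.* j) * durfee-sum (j ℕ.+ j)
            ≈⟨ trans (*-congˡ (durfee N (j ℕ.+ j) (ℕₚ.m≤n+m N _))) (*-comm _ _) ⟩
          τ 0 * (v j * Q ^ (j ℕ.* j)) ∎

-- Splitting theta series by the index modulo 5

open import Algebra.Properties.Semiring.Exp (CommutativeRing.semiring Cyclotomic.commutativeRing)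
  using () renaming (_^_ to _^ᶻ_; ^-homo-* to ^ᶻ-homo-*)

ζ² ζ³ : Z5
ζ² = ζ *ᶻ ζ
ζ³ = ζ² *ᶻ ζ

triangular-+5 : ∀ s i → triangular (s ℕ.+ i ℕ.* 5) ≡ (10 ℕ.+ 5 ℕ.* s) ℕ.* i ℕ.+ 25 ℕ.* triangular i ℕ.+ triangular s
triangular-+5 s zero    = ≡.trans (≡.cong triangular (ℕₚ.+-identityʳ s))
  (≡.cong (λ k → k ℕ.+ 0 ℕ.+ triangular s) (≡.sym (ℕₚ.*-zeroʳ (10 ℕ.+ 5 ℕ.* s))))
triangular-+5 s (suc i) = ≡.trans (≡.cong triangular (move s i)) (≡.trans (advance (s ℕ.+ i ℕ.* 5))
  (≡.trans (≡.cong (ℕ._+ (5 ℕ.* (s ℕ.+ i ℕ.* 5) ℕ.+ 10)) (triangular-+5 s i)) (collect s i (triangular i) (triangular s))))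
  where
  move : ∀ s i → s ℕ.+ suc i ℕ.* 5 ≡ 5 ℕ.+ (s ℕ.+ i ℕ.* 5)
  move = solve-∀
  advance : ∀ k → triangular (5 ℕ.+ k) ≡ triangular k ℕ.+ (5 ℕ.* k ℕ.+ 10)
  advance k = lemma k (triangular k)
    where
    lemma : ∀ k t → t ℕ.+ k ℕ.+ (1 ℕ.+ k) ℕ.+ (2 ℕ.+ k) ℕ.+ (3 ℕ.+ k) ℕ.+ (4 ℕ.+ k) ≡ t ℕ.+ (5 ℕ.* k ℕ.+ 10)
    lemma = solve-∀
  collect : ∀ s i t u → (10 ℕ.+ 5 ℕ.* s) ℕ.* i ℕ.+ 25 ℕ.* t ℕ.+ u ℕ.+ (5 ℕ.* (s ℕ.+ i ℕ.* 5) ℕ.+ 10) ≡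
                        (10 ℕ.+ 5 ℕ.* s) ℕ.* suc i ℕ.+ 25 ℕ.* (t ℕ.+ i) ℕ.+ u
  collect = solve-∀

module Dissection {a ℓ} (R : CommutativeRing a ℓ)
  (morphism : CommutativeRing.rawRing Cyclotomic.commutativeRing ACR.-Raw-AlmostCommutative⟶ ACR.fromCommutativeRing R (λ _ → nothing))
  (q : CommutativeRing.Carrier R) (N : ℕ) where

  open CommutativeRing R
  open Solver R morphism
  open QSeries R morphism
  open ACR._-Raw-AlmostCommutative⟶_ morphism renaming (⟦_⟧ to κ)
  open import Algebra.Properties.Semiring.Exp semiring
  open import Algebra.Properties.Ring ring using (x∙y⁻¹≈ε⇒x≈y; -‿distribˡ-*)
  open import Relation.Binary.Reasoning.Setoid setoid

  κ-^ : ∀ u n → κ (u ^ᶻ n) ≈ κ u ^ n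
  κ-^ u zero    = 1-homo
  κ-^ u (suc n) = trans (*-homo _ _) (*-congˡ (κ-^ u n))

  κ-cong : ∀ {u v} → u ≡ v → κ u ≈ κ v
  κ-cong p = reflexive (≡.cong κ p)

  finite : Z5 → ℕ → ℕ → ℕ → Carrier
  finite u e d n = ∏ n (λ j → 1# - κ u * q ^ (e ℕ.+ j ℕ.* d))

  -- This is (u q^e; q^d)_∞ as soon as q^N = 0 and d ≥ 1, which is the content of `finite-stable`.
  P : Z5 → ℕ → ℕ → Carrier
  P u e d = finite u e d N

  finite-+ : ∀ u e d m n → finite u e d (m ℕ.+ n) ≈ finite u e d m * finite u (e ℕ.+ m ℕ.* d) d n
  finite-+ u e d m n = trans (Product.fold-+ m n _) (*-congˡ (Product.fold-cong′ n (λ j →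
    reflexive (≡.cong (λ k → 1# - κ u * q ^ k) (exponent e d m j)))))
    where
    exponent : ∀ e d m j → e ℕ.+ (m ℕ.+ j) ℕ.* d ≡ e ℕ.+ m ℕ.* d ℕ.+ j ℕ.* d
    exponent = solve-∀

  finite-rising : ∀ u e d n → finite u e d n ≈ ∏ n (λ j → 1# - κ u * q ^ e * (q ^ d) ^ j)
  finite-rising u e d n = Product.fold-cong′ n (λ j → +-congˡ (-‿cong (trans
    (*-congˡ (trans (^-homo-* q e (j ℕ.* d)) (*-congˡ (trans (^-congʳ q (ℕₚ.*-comm j d)) (sym (^-assocʳ q d j))))))
    (sym (*-assoc _ _ _)))))

  -- One half of a two-sided theta series to the base q^m; `Θ-series` joins two of them. It has N +
  -- 1 terms because that is what `dissect` leaves in each residue class.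
  G : ℕ → ℕ → Carrier
  G m A = ∑ (suc N) (λ i → κ ((-ᶻ 1ᶻ) ^ᶻ i) * q ^ (A ℕ.* i ℕ.+ m ℕ.* triangular i))

  G-shifted : ∀ m A e s i {k} → k ≡ A ℕ.* i ℕ.+ m ℕ.* triangular i ℕ.+ e → ∀ u →
              (u ^ᶻ 5 ≡ -ᶻ 1ᶻ) → κ (u ^ᶻ (s ℕ.+ i ℕ.* 5)) * q ^ k ≈
              κ (u ^ᶻ s) * q ^ e * (κ ((-ᶻ 1ᶻ) ^ᶻ i) * q ^ (A ℕ.* i ℕ.+ m ℕ.* triangular i))
  G-shifted m A e s i ≡.refl u u⁵≡-1 = trans
    (*-cong (trans (κ-^ u (s ℕ.+ i ℕ.* 5)) (trans (^-homo-* (κ u) s (i ℕ.* 5))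
      (*-cong (sym (κ-^ u s)) (trans (^-congʳ (κ u) (ℕₚ.*-comm i 5)) (trans (sym (^-assocʳ (κ u) 5 i))
        (trans (^-congˡ i (trans (sym (κ-^ u 5)) (κ-cong u⁵≡-1))) (sym (κ-^ (-ᶻ 1ᶻ) i))))))))
      (^-homo-* q (A ℕ.* i ℕ.+ m ℕ.* triangular i) e))
    (solve 4 (λ s t v w → s :* t :* (v :* w) ⊜ s :* w :* (t :* v)) refl
      (κ (u ^ᶻ s)) (κ ((-ᶻ 1ᶻ) ^ᶻ i)) (q ^ (A ℕ.* i ℕ.+ m ℕ.* triangular i)) (q ^ e))

  -- A quadratic exponent stays quadratic along s + 5i, and u^5 = -1 reduces the power of u to a
  -- sign. The offset k serves the half of a theta series that starts at the first power.
  dissect : ∀ u → u ^ᶻ 5 ≡ -ᶻ 1ᶻ → ∀ k m (A e : ℕ → ℕ) →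
            (∀ s i → e (s ℕ.+ i ℕ.* 5) ≡ A s ℕ.* i ℕ.+ m ℕ.* triangular i ℕ.+ e s) →
            ∑ (suc N ℕ.* 5) (λ j → κ (u ^ᶻ (k ℕ.+ j)) * q ^ e j) ≈
            ∑ 5 (λ s → κ (u ^ᶻ (k ℕ.+ s)) * (q ^ e s * G m (A s)))
  dissect u u⁵≡-1 k m A e quadratic = trans (Sum.fold-blocks 5 (suc N) _) (Sum.fold-cong′ 5 (λ s → trans
    (Sum.fold-cong′ (suc N) (λ i → trans (*-congʳ (κ-cong (≡.cong (u ^ᶻ_) (≡.sym (ℕₚ.+-assoc k s (i ℕ.* 5))))))
      (G-shifted m (A s) (e s) (k ℕ.+ s) i (quadratic s i) u u⁵≡-1)))
    (trans (∑-* _ (suc N) _) (*-assoc _ _ _))))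

  module _ (q^N≈0 : q ^ N ≈ 0#) where

    base : ∀ d → (q ^ suc d) ^ N ≈ 0#
    base d = trans (^-assocʳ q (suc d) N) (^-vanish q q^N≈0 (ℕₚ.m≤m+n N (d ℕ.* N)))

    module Base d = Nilpotent (q ^ suc d) N (base d)

    finite-stable : ∀ u e d {n} → N ℕ.≤ n → finite u e (suc d) n ≈ P u e (suc d)
    finite-stable u e d {n} N≤n = trans (finite-rising u e (suc d) n)
      (trans (Base.rising-stable d (κ u * q ^ e) N≤n) (sym (finite-rising u e (suc d) N)))

    P-split : ∀ u e d n → P u e (suc d) ≈ finite u e (suc d) n * P u (e ℕ.+ n ℕ.* suc d) (suc d)
    P-split u e d n = trans (sym (finite-stable u e d (ℕₚ.m≤n+m N n))) (finite-+ u e (suc d) n N)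

    P-blocks : ∀ k u e d → P u e (suc d) ≈ ∏ (suc k) (λ s → P u (e ℕ.+ s ℕ.* suc d) (suc k ℕ.* suc d))
    P-blocks k u e d = trans (sym (finite-stable u e d (ℕₚ.m≤m*n N (suc k)))) (trans (Product.fold-blocks (suc k) N _)
      (Product.fold-cong′ (suc k) (λ s → Product.fold-cong′ N (λ i →
        reflexive (≡.cong (λ j → 1# - κ u * q ^ j) (exponent e d k s i))))))
      where
      exponent : ∀ e d k s i → e ℕ.+ (s ℕ.+ i ℕ.* suc k) ℕ.* suc d ≡ e ℕ.+ s ℕ.* suc d ℕ.+ i ℕ.* (suc k ℕ.* suc d)
      exponent = solve-∀

    gaussian-monomial : ∀ d u e j → Base.gaussian d (κ u * q ^ e) j ≈
                        κ ((-ᶻ u) ^ᶻ j) * q ^ (e ℕ.* j ℕ.+ suc d ℕ.* triangular j)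
    gaussian-monomial d u e j = begin
      (- (κ u * q ^ e)) ^ j * (q ^ suc d) ^ triangular j
        ≈⟨ *-cong (trans (^-congˡ j (trans (-‿distribˡ-* _ _) (*-congʳ (sym (-‿homo u))))) (^-distrib-* _ _ j))
             (^-assocʳ q (suc d) (triangular j)) ⟩
      κ (-ᶻ u) ^ j * (q ^ e) ^ j * q ^ (suc d ℕ.* triangular j)
        ≈⟨ trans (*-congʳ (*-cong (sym (κ-^ (-ᶻ u) j)) (^-assocʳ q e j))) (*-assoc _ _ _) ⟩
      κ ((-ᶻ u) ^ᶻ j) * (q ^ (e ℕ.* j) * q ^ (suc d ℕ.* triangular j))
        ≈⟨ *-congˡ (sym (^-homo-* q (e ℕ.* j) _)) ⟩
      κ ((-ᶻ u) ^ᶻ j) * q ^ (e ℕ.* j ℕ.+ suc d ℕ.* triangular j) ∎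

    module _ (d : ℕ) (u u′ : Z5) (e e′ : ℕ) (uu′≡1 : u *ᶻ u′ ≡ 1ᶻ) (e+e′≡1+d : e ℕ.+ e′ ≡ suc d) where

      inverse : κ u * q ^ e * (κ u′ * q ^ e′) ≈ q ^ suc d
      inverse = begin
        κ u * q ^ e * (κ u′ * q ^ e′)
          ≈⟨ solve 4 (λ s t v w → s :* t :* (v :* w) ⊜ s :* v :* (t :* w)) refl (κ u) (q ^ e) (κ u′) (q ^ e′) ⟩
        κ u * κ u′ * (q ^ e * q ^ e′)
          ≈⟨ *-cong (trans (sym (*-homo u u′)) (trans (κ-cong uu′≡1) 1-homo))
               (trans (sym (^-homo-* q e e′)) (^-congʳ q e+e′≡1+d)) ⟩
        1# * q ^ suc d
          ≈⟨ *-identityˡ _ ⟩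
        q ^ suc d ∎

      module JacobiP = Base.Jacobi d (κ u * q ^ e) (κ u′ * q ^ e′) inverse

      -- The length L stays free so that 5(N + 1) can be chosen, which makes the five residue
      -- classes equally long.
      jacobi-P : ∀ {L} → N ℕ.< L → P u e (suc d) * P u′ e′ (suc d) * P 1ᶻ (suc d) (suc d) ≈
        ∑ L (λ j → κ ((-ᶻ u) ^ᶻ j) * q ^ (e ℕ.* j ℕ.+ suc d ℕ.* triangular j)) +
        ∑ L (λ j → κ ((-ᶻ u′) ^ᶻ suc j) * q ^ (e′ ℕ.* suc j ℕ.+ suc d ℕ.* triangular (suc j)))
      jacobi-P {L} N<L = trans
        (*-cong (*-cong (finite-rising u e (suc d) N) (finite-rising u′ e′ (suc d) N))
          (trans (finite-rising 1ᶻ (suc d) (suc d) N) (Base.rising-cong d N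
            (trans (*-congʳ 1-homo) (trans (*-identityˡ _) (sym (*-identityʳ _)))))))
        (trans (JacobiP.jacobi N<L) (+-cong
          (Sum.fold-cong′ L (gaussian-monomial d u e))
          (Sum.fold-cong′ L (λ j → gaussian-monomial d u′ e′ (suc j)))))

    Θ : ℕ → ℕ → ℕ → Carrier
    Θ e e′ m = P 1ᶻ e m * P 1ᶻ e′ m * P 1ᶻ m m

    Θ-series : ∀ d e e′ → e ℕ.+ e′ ≡ suc d → Θ e e′ (suc d) ≈ G (suc d) e - q ^ e′ * G (suc d) (e′ ℕ.+ suc d)
    Θ-series d e e′ e+e′≡1+d = trans (jacobi-P d 1ᶻ 1ᶻ e e′ ≡.refl e+e′≡1+d ℕₚ.≤-refl) (+-congˡ (begin
      ∑ (suc N) (λ j → κ ((-ᶻ 1ᶻ) ^ᶻ suc j) * q ^ (e′ ℕ.* suc j ℕ.+ suc d ℕ.* triangular (suc j)))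
        ≈⟨ Sum.fold-cong′ (suc N) (λ j → begin
             κ ((-ᶻ 1ᶻ) ^ᶻ suc j) * q ^ (e′ ℕ.* suc j ℕ.+ suc d ℕ.* triangular (suc j))
               ≈⟨ *-cong (*-homo _ _) (trans (^-congʳ q (exponent d e′ j (triangular j))) (^-homo-* q e′ _)) ⟩
             κ (-ᶻ 1ᶻ) * κ ((-ᶻ 1ᶻ) ^ᶻ j) * (q ^ e′ * q ^ ((e′ ℕ.+ suc d) ℕ.* j ℕ.+ suc d ℕ.* triangular j))
               ≈⟨ solve 3 (λ s t v → con (-ᶻ 1ᶻ) :* s :* (t :* v) ⊜ :- t :* (s :* v)) refl _ _ _ ⟩
             - q ^ e′ * (κ ((-ᶻ 1ᶻ) ^ᶻ j) * q ^ ((e′ ℕ.+ suc d) ℕ.* j ℕ.+ suc d ℕ.* triangular j)) ∎) ⟩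
      ∑ (suc N) (λ j → - q ^ e′ * (κ ((-ᶻ 1ᶻ) ^ᶻ j) * q ^ ((e′ ℕ.+ suc d) ℕ.* j ℕ.+ suc d ℕ.* triangular j)))
        ≈⟨ trans (∑-* _ (suc N) _) (sym (-‿distribˡ-* _ _)) ⟩
      - (q ^ e′ * G (suc d) (e′ ℕ.+ suc d)) ∎))
      where
      exponent : ∀ d e j t → e ℕ.* suc j ℕ.+ suc d ℕ.* (t ℕ.+ j) ≡ e ℕ.+ ((e ℕ.+ suc d) ℕ.* j ℕ.+ suc d ℕ.* t)
      exponent = solve-∀

    five-terms : ∀ f → ∑ 5 f ≈ f 0 + f 1 + f 2 + f 3 + f 4
    five-terms f = +-congʳ (+-congʳ (+-congʳ (+-congʳ (+-identityˡ _))))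

    q^Θ : ∀ b d e e′ → e ℕ.+ e′ ≡ suc d →
          q ^ b * Θ e e′ (suc d) ≈ q ^ b * G (suc d) e - q ^ (b ℕ.+ e′) * G (suc d) (e′ ℕ.+ suc d)
    q^Θ b d e e′ eq = trans (*-congˡ (Θ-series d e e′ eq)) (trans
      (solve 4 (λ s g t h → s :* (g :- t :* h) ⊜ s :* g :- s :* t :* h) refl (q ^ b) _ (q ^ e′) _)
      (+-congˡ (-‿cong (*-congʳ (sym (^-homo-* q b e′))))))

    -- The generalised pentagonal numbers j(3j-1)/2 and (j+1)(3j+4)/2, in the shape that
    -- `gaussian-monomial` and the factor q^(j²) produce.
    e₁ e₂ : ℕ → ℕ
    e₁ j = 0 ℕ.* j ℕ.+ 1 ℕ.* triangular j ℕ.+ 1 ℕ.* (j ℕ.* j)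
    e₂ j = 1 ℕ.* suc j ℕ.+ 1 ℕ.* triangular (suc j) ℕ.+ 1 ℕ.* (suc j ℕ.* suc j)

    square-+5 : ∀ s i → (s ℕ.+ i ℕ.* 5) ℕ.* (s ℕ.+ i ℕ.* 5) ≡ 10 ℕ.* s ℕ.* i ℕ.+ 25 ℕ.* (2 ℕ.* triangular i ℕ.+ i) ℕ.+ s ℕ.* s
    square-+5 s i = ≡.trans (expand s i) (≡.cong (λ k → 10 ℕ.* s ℕ.* i ℕ.+ 25 ℕ.* k ℕ.+ s ℕ.* s) (square i))
      where
      expand : ∀ s i → (s ℕ.+ i ℕ.* 5) ℕ.* (s ℕ.+ i ℕ.* 5) ≡ 10 ℕ.* s ℕ.* i ℕ.+ 25 ℕ.* (i ℕ.* i) ℕ.+ s ℕ.* s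
      expand = solve-∀
      square : ∀ i → i ℕ.* i ≡ 2 ℕ.* triangular i ℕ.+ i
      square zero    = ≡.refl
      square (suc i) = ≡.trans (next i) (≡.trans (≡.cong (λ k → k ℕ.+ (2 ℕ.* i ℕ.+ 1)) (square i)) (collect i (triangular i)))
        where
        next : ∀ i → suc i ℕ.* suc i ≡ i ℕ.* i ℕ.+ (2 ℕ.* i ℕ.+ 1)
        next = solve-∀
        collect : ∀ i t → 2 ℕ.* t ℕ.+ i ℕ.+ (2 ℕ.* i ℕ.+ 1) ≡ 2 ℕ.* (t ℕ.+ i) ℕ.+ suc i
        collect = solve-∀

    e₁-quadratic : ∀ s i → e₁ (s ℕ.+ i ℕ.* 5) ≡ (35 ℕ.+ 15 ℕ.* s) ℕ.* i ℕ.+ 75 ℕ.* triangular i ℕ.+ e₁ s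
    e₁-quadratic s i = ≡.trans (≡.cong₂ (λ t r → 1 ℕ.* t ℕ.+ 1 ℕ.* r) (triangular-+5 s i) (square-+5 s i))
      (collect s i (triangular i) (triangular s))
      where
      collect : ∀ s i t u → 1 ℕ.* ((10 ℕ.+ 5 ℕ.* s) ℕ.* i ℕ.+ 25 ℕ.* t ℕ.+ u) ℕ.+
                            1 ℕ.* (10 ℕ.* s ℕ.* i ℕ.+ 25 ℕ.* (2 ℕ.* t ℕ.+ i) ℕ.+ s ℕ.* s) ≡
                            (35 ℕ.+ 15 ℕ.* s) ℕ.* i ℕ.+ 75 ℕ.* t ℕ.+ (0 ℕ.* s ℕ.+ 1 ℕ.* u ℕ.+ 1 ℕ.* (s ℕ.* s))
      collect = solve-∀

    e₂-quadratic : ∀ s i → e₂ (s ℕ.+ i ℕ.* 5) ≡ (55 ℕ.+ 15 ℕ.* s) ℕ.* i ℕ.+ 75 ℕ.* triangular i ℕ.+ e₂ s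
    e₂-quadratic s i = ≡.trans (≡.cong₂ (λ t r → 1 ℕ.* (suc s ℕ.+ i ℕ.* 5) ℕ.+ 1 ℕ.* t ℕ.+ 1 ℕ.* r)
      (triangular-+5 (suc s) i) (square-+5 (suc s) i)) (collect s i (triangular i) (triangular (suc s)))
      where
      collect : ∀ s i t u → 1 ℕ.* (suc s ℕ.+ i ℕ.* 5) ℕ.+ 1 ℕ.* ((10 ℕ.+ 5 ℕ.* suc s) ℕ.* i ℕ.+ 25 ℕ.* t ℕ.+ u) ℕ.+
                            1 ℕ.* (10 ℕ.* suc s ℕ.* i ℕ.+ 25 ℕ.* (2 ℕ.* t ℕ.+ i) ℕ.+ suc s ℕ.* suc s) ≡
                            (55 ℕ.+ 15 ℕ.* s) ℕ.* i ℕ.+ 75 ℕ.* t ℕ.+ (1 ℕ.* suc s ℕ.+ 1 ℕ.* u ℕ.+ 1 ℕ.* (suc s ℕ.* suc s))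
      collect = solve-∀

    module _ (five-regular : ∀ f → κ (z5 (+ 5) (+ 0) (+ 0) (+ 0)) * f ≈ 0# → f ≈ 0#) where

      κ-cancel : ∀ u v → v *ᶻ u ≡ z5 (+ 5) (+ 0) (+ 0) (+ 0) → ∀ {f g} → κ u * f ≈ κ u * g → f ≈ g
      κ-cancel u v vu≡5 {f} {g} eq = x∙y⁻¹≈ε⇒x≈y f g (five-regular (f - g) (begin
        κ (z5 (+ 5) (+ 0) (+ 0) (+ 0)) * (f - g)
          ≈⟨ *-congʳ (trans (κ-cong (≡.sym vu≡5)) (*-homo v u)) ⟩
        κ v * κ u * (f - g)
          ≈⟨ solve 4 (λ v u f g → v :* u :* (f :- g) ⊜ v :* (u :* f :- u :* g)) refl (κ v) (κ u) f g ⟩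
        κ v * (κ u * f - κ u * g)
          ≈⟨ *-congˡ (trans (+-congʳ eq) (-‿inverseʳ _)) ⟩
        κ v * 0#
          ≈⟨ zeroʳ _ ⟩
        0# ∎))

      -- Triple products and Bailey sums at a fifth root of unity

      module RootPair (u u′ : Z5) (uu′≡1 : u *ᶻ u′ ≡ 1ᶻ)
        (u⁵ : (-ᶻ u) ^ᶻ 5 ≡ -ᶻ 1ᶻ) (u′⁵ : (-ᶻ u′) ^ᶻ 5 ≡ -ᶻ 1ᶻ) where

        A : ℕ → Carrier
        A s = q ^ (0 ℕ.* s ℕ.+ 1 ℕ.* triangular s) * G 25 (10 ℕ.+ 5 ℕ.* s)

        B : ℕ → Carrier
        B s = q ^ (1 ℕ.* suc s ℕ.+ 1 ℕ.* triangular (suc s)) * G 25 (20 ℕ.+ 5 ℕ.* s)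

        unfolded : P u 0 1 * P u′ 1 1 * P 1ᶻ 1 1 ≈
          (κ ((-ᶻ u) ^ᶻ 0) * A 0 + κ ((-ᶻ u) ^ᶻ 1) * A 1 + κ ((-ᶻ u) ^ᶻ 2) * A 2 + κ ((-ᶻ u) ^ᶻ 3) * A 3 + κ ((-ᶻ u) ^ᶻ 4) * A 4) +
          (κ ((-ᶻ u′) ^ᶻ 1) * B 0 + κ ((-ᶻ u′) ^ᶻ 2) * B 1 + κ ((-ᶻ u′) ^ᶻ 3) * B 2 + κ ((-ᶻ u′) ^ᶻ 4) * B 3 + κ ((-ᶻ u′) ^ᶻ 5) * B 4)
        unfolded = trans (jacobi-P 0 u u′ 0 1 uu′≡1 ≡.refl (ℕₚ.m≤m*n (suc N) 5)) (+-cong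
          (trans (dissect (-ᶻ u) u⁵ 0 25 (λ s → 10 ℕ.+ 5 ℕ.* s) _ quadratic₁) (five-terms (λ s → κ ((-ᶻ u) ^ᶻ s) * A s)))
          (trans (dissect (-ᶻ u′) u′⁵ 1 25 (λ s → 20 ℕ.+ 5 ℕ.* s) _ quadratic₂) (five-terms (λ s → κ ((-ᶻ u′) ^ᶻ suc s) * B s))))
          where
          quadratic₁ : ∀ s i → 0 ℕ.* (s ℕ.+ i ℕ.* 5) ℕ.+ 1 ℕ.* triangular (s ℕ.+ i ℕ.* 5) ≡
                       (10 ℕ.+ 5 ℕ.* s) ℕ.* i ℕ.+ 25 ℕ.* triangular i ℕ.+ (0 ℕ.* s ℕ.+ 1 ℕ.* triangular s)
          quadratic₁ s i = ≡.trans (≡.cong (1 ℕ.*_) (triangular-+5 s i)) (collect s i (triangular i) (triangular s))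
            where
            collect : ∀ s i t u → 1 ℕ.* ((10 ℕ.+ 5 ℕ.* s) ℕ.* i ℕ.+ 25 ℕ.* t ℕ.+ u) ≡
                                  (10 ℕ.+ 5 ℕ.* s) ℕ.* i ℕ.+ 25 ℕ.* t ℕ.+ (0 ℕ.* s ℕ.+ 1 ℕ.* u)
            collect = solve-∀
          quadratic₂ : ∀ s i → 1 ℕ.* (suc s ℕ.+ i ℕ.* 5) ℕ.+ 1 ℕ.* triangular (suc s ℕ.+ i ℕ.* 5) ≡
                       (20 ℕ.+ 5 ℕ.* s) ℕ.* i ℕ.+ 25 ℕ.* triangular i ℕ.+ (1 ℕ.* suc s ℕ.+ 1 ℕ.* triangular (suc s))
          quadratic₂ s i = ≡.trans (≡.cong (λ k → 1 ℕ.* (suc s ℕ.+ i ℕ.* 5) ℕ.+ 1 ℕ.* k) (triangular-+5 (suc s) i))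
            (collect s i (triangular i) (triangular (suc s)))
            where
            collect : ∀ s i t u → 1 ℕ.* (suc s ℕ.+ i ℕ.* 5) ℕ.+ 1 ℕ.* ((10 ℕ.+ 5 ℕ.* suc s) ℕ.* i ℕ.+ 25 ℕ.* t ℕ.+ u) ≡
                                  (20 ℕ.+ 5 ℕ.* s) ℕ.* i ℕ.+ 25 ℕ.* t ℕ.+ (1 ℕ.* suc s ℕ.+ 1 ℕ.* u)
            collect = solve-∀

        ten : A 0 - B 4 ≈ Θ 10 15 25
        ten = trans (sym (q^Θ 0 24 10 15 ≡.refl)) (*-identityˡ _)

        fifteen : A 1 - B 3 ≈ Θ 10 15 25
        fifteen = trans (sym (q^Θ 0 24 15 10 ≡.refl)) (trans (*-identityˡ _) (*-congʳ (*-comm _ _)))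

        twenty : A 2 - A 4 ≈ q ^ 1 * Θ 20 5 25
        twenty = sym (q^Θ 1 24 20 5 ≡.refl)

        peel : P u 0 1 ≈ (1# - κ u) * P u 1 1
        peel = trans (P-split u 0 0 1) (*-congʳ (trans (*-identityˡ _) (+-congˡ (-‿cong (*-identityʳ _)))))

        -- Seven series suffice for the ten classes, since `B 0`, `B 1`, `B 2` evaluate to `A 2`,
        -- `A 3`, `A 4`. The linear relation that `dissection` expects is checked at each concrete
        -- root, where the powers of u evaluate to normal forms.
        combination : (a₀ a₁ a₂ a₃ a₄ b₃ b₄ : Carrier) → Carrier
        combination a₀ a₁ a₂ a₃ a₄ b₃ b₄ =
          (κ ((-ᶻ u) ^ᶻ 0) * a₀ + κ ((-ᶻ u) ^ᶻ 1) * a₁ + κ ((-ᶻ u) ^ᶻ 2) * a₂ + κ ((-ᶻ u) ^ᶻ 3) * a₃ + κ ((-ᶻ u) ^ᶻ 4) * a₄) +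
          (κ ((-ᶻ u′) ^ᶻ 1) * a₂ + κ ((-ᶻ u′) ^ᶻ 2) * a₃ + κ ((-ᶻ u′) ^ᶻ 3) * a₄ + κ ((-ᶻ u′) ^ᶻ 4) * b₃ + κ ((-ᶻ u′) ^ᶻ 5) * b₄)

        -- The triple product at u carries the factor 1 - u, which is not a unit; it
        -- can be cancelled because it divides 5.
        dissection : ∀ k v → v *ᶻ (1ᶻ -ᶻ u) ≡ z5 (+ 5) (+ 0) (+ 0) (+ 0) →
          (∀ a₀ a₁ a₂ a₃ a₄ b₃ b₄ → combination a₀ a₁ a₂ a₃ a₄ b₃ b₄ ≈
            (a₀ - b₄) - κ u * (a₁ - b₃) + κ ((1ᶻ -ᶻ u) *ᶻ k) * (a₂ - a₄)) →
          P u 1 1 * P u′ 1 1 * P 1ᶻ 1 1 ≈ Θ 10 15 25 + κ k * (q ^ 1 * Θ 20 5 25)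
        dissection k v vu≡5 combine = κ-cancel (1ᶻ -ᶻ u) v vu≡5 (begin
          κ (1ᶻ -ᶻ u) * (P u 1 1 * P u′ 1 1 * P 1ᶻ 1 1)
            ≈⟨ *-congʳ 1-u ⟩
          (1# - κ u) * (P u 1 1 * P u′ 1 1 * P 1ᶻ 1 1)
            ≈⟨ trans (sym (*-assoc _ _ _)) (*-congʳ (sym (*-assoc _ _ _))) ⟩
          (1# - κ u) * P u 1 1 * P u′ 1 1 * P 1ᶻ 1 1
            ≈⟨ trans (*-congʳ (*-congʳ (sym peel))) unfolded ⟩
          combination (A 0) (A 1) (A 2) (A 3) (A 4) (B 3) (B 4)
            ≈⟨ combine (A 0) (A 1) (A 2) (A 3) (A 4) (B 3) (B 4) ⟩
          (A 0 - B 4) - κ u * (A 1 - B 3) + κ ((1ᶻ -ᶻ u) *ᶻ k) * (A 2 - A 4)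
            ≈⟨ +-cong (+-cong ten (-‿cong (*-congˡ fifteen))) (*-cong (trans (*-homo _ k) (*-congʳ 1-u)) twenty) ⟩
          Θ 10 15 25 - κ u * Θ 10 15 25 + (1# - κ u) * κ k * (q ^ 1 * Θ 20 5 25)
            ≈⟨ solve 4 (λ u k t s → t :- u :* t :+ (:1 :- u) :* k :* s ⊜ (:1 :- u) :* (t :+ k :* s)) refl
                 (κ u) (κ k) (Θ 10 15 25) (q ^ 1 * Θ 20 5 25) ⟩
          (1# - κ u) * (Θ 10 15 25 + κ k * (q ^ 1 * Θ 20 5 25))
            ≈⟨ *-congʳ (sym 1-u) ⟩
          κ (1ᶻ -ᶻ u) * (Θ 10 15 25 + κ k * (q ^ 1 * Θ 20 5 25)) ∎)
          where
          1-u : κ (1ᶻ -ᶻ u) ≈ 1# - κ u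
          1-u = trans (+-homo _ _) (+-cong 1-homo (-‿homo u))

        ψ : Carrier
        ψ = ∑ (suc N) (λ n → q ^ (n ℕ.* n) * (finite u 0 1 n * finite u′ 1 1 n * P 1ᶻ (suc (n ℕ.+ n)) 1))

        C : ℕ → Carrier
        C s = q ^ e₁ s * G 75 (35 ℕ.+ 15 ℕ.* s)

        D : ℕ → Carrier
        D s = q ^ e₂ s * G 75 (55 ℕ.+ 15 ℕ.* s)

        ψ-dissection : ψ ≈
          (κ ((-ᶻ u) ^ᶻ 0) * C 0 + κ ((-ᶻ u) ^ᶻ 1) * C 1 + κ ((-ᶻ u) ^ᶻ 2) * C 2 + κ ((-ᶻ u) ^ᶻ 3) * C 3 + κ ((-ᶻ u) ^ᶻ 4) * C 4) +
          (κ ((-ᶻ u′) ^ᶻ 1) * D 0 + κ ((-ᶻ u′) ^ᶻ 2) * D 1 + κ ((-ᶻ u′) ^ᶻ 3) * D 2 + κ ((-ᶻ u′) ^ᶻ 4) * D 3 + κ ((-ᶻ u′) ^ᶻ 5) * D 4)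
        ψ-dissection = begin
          ψ
            ≈⟨ Sum.fold-cong′ (suc N) (λ n → *-cong (q^1^ (n ℕ.* n)) (*-cong
                 (*-cong (finite-rising u 0 1 n) (finite-rising u′ 1 1 n))
                 (trans (finite-rising 1ᶻ (suc (n ℕ.+ n)) 1 N) (Base.rising-cong 0 N
                   (trans (*-congʳ 1-homo) (trans (*-identityˡ _) (q^1^ (suc (n ℕ.+ n))))))))) ⟩
          ∑ (suc N) (λ n → (q ^ 1) ^ (n ℕ.* n) * (Base.rising 0 (κ u * q ^ 0) n * Base.rising 0 (κ u′ * q ^ 1) n * Base.τ 0 (n ℕ.+ n)))
            ≈⟨ JacobiP.bailey 0 u u′ 0 1 uu′≡1 ≡.refl ⟩
          ∑ (suc N) (λ j → Base.gaussian 0 (κ u * q ^ 0) j * (q ^ 1) ^ (j ℕ.* j)) +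
          ∑ N (λ j → Base.gaussian 0 (κ u′ * q ^ 1) (suc j) * (q ^ 1) ^ (suc j ℕ.* suc j))
            ≈⟨ +-cong (sym (Sum.fold-pad (ℕₚ.m≤m*n (suc N) 5) tail₁))
                 (sym (Sum.fold-pad (ℕₚ.≤-trans (ℕₚ.n≤1+n N) (ℕₚ.m≤m*n (suc N) 5)) tail₂)) ⟩
          ∑ (suc N ℕ.* 5) (λ j → Base.gaussian 0 (κ u * q ^ 0) j * (q ^ 1) ^ (j ℕ.* j)) +
          ∑ (suc N ℕ.* 5) (λ j → Base.gaussian 0 (κ u′ * q ^ 1) (suc j) * (q ^ 1) ^ (suc j ℕ.* suc j))
            ≈⟨ +-cong (Sum.fold-cong′ (suc N ℕ.* 5) (monomial u 0)) (Sum.fold-cong′ (suc N ℕ.* 5) (λ j → monomial u′ 1 (suc j))) ⟩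
          ∑ (suc N ℕ.* 5) (λ j → κ ((-ᶻ u) ^ᶻ j) * q ^ e₁ j) + ∑ (suc N ℕ.* 5) (λ j → κ ((-ᶻ u′) ^ᶻ suc j) * q ^ e₂ j)
            ≈⟨ +-cong
                 (trans (dissect (-ᶻ u) u⁵ 0 75 (λ s → 35 ℕ.+ 15 ℕ.* s) e₁ e₁-quadratic) (five-terms (λ s → κ ((-ᶻ u) ^ᶻ s) * C s)))
                 (trans (dissect (-ᶻ u′) u′⁵ 1 75 (λ s → 55 ℕ.+ 15 ℕ.* s) e₂ e₂-quadratic) (five-terms (λ s → κ ((-ᶻ u′) ^ᶻ suc s) * D s))) ⟩
          _ ∎
          where
          q^1^ : ∀ k → q ^ k ≈ (q ^ 1) ^ k
          q^1^ k = sym (trans (^-assocʳ q 1 k) (^-congʳ q (ℕₚ.*-identityˡ k)))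
          tail₁ : ∀ j → suc N ℕ.≤ j → Base.gaussian 0 (κ u * q ^ 0) j * (q ^ 1) ^ (j ℕ.* j) ≈ 0#
          tail₁ (suc j) (s≤s N≤j) = trans (*-congʳ (Base.gaussian-vanish 0 _ N≤j)) (zeroˡ _)
          tail₂ : ∀ j → N ℕ.≤ j → Base.gaussian 0 (κ u′ * q ^ 1) (suc j) * (q ^ 1) ^ (suc j ℕ.* suc j) ≈ 0#
          tail₂ j N≤j = trans (*-congʳ (Base.gaussian-vanish 0 _ N≤j)) (zeroˡ _)
          monomial : ∀ t e j → Base.gaussian 0 (κ t * q ^ e) j * (q ^ 1) ^ (j ℕ.* j) ≈
                     κ ((-ᶻ t) ^ᶻ j) * q ^ (e ℕ.* j ℕ.+ 1 ℕ.* triangular j ℕ.+ 1 ℕ.* (j ℕ.* j))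
          monomial t e j = trans (*-cong (gaussian-monomial 0 t e j) (^-assocʳ q 1 (j ℕ.* j)))
            (trans (*-assoc _ _ _) (*-congˡ (sym (^-homo-* q (e ℕ.* j ℕ.+ 1 ℕ.* triangular j) _))))

      -- The general coefficient is -(1 + u + 1/u), which is c at u = ζ²: `A 2` occurs with u² - 1/u
      -- = -(1 - u)(1 + u + 1/u), while `A 3` occurs with 1/u² - u³ = 0.
      dissection-ζ² : P ζ² 1 1 * P ζ³ 1 1 * P 1ᶻ 1 1 ≈ Θ 10 15 25 + κ c * (q ^ 1 * Θ 20 5 25)
      dissection-ζ² = RootPair.dissection ζ² ζ³ ≡.refl ≡.refl ≡.refl c
        -- This is (1 - ζ)(1 - ζ³)(1 - ζ⁴) expanded: the four numbers 1 - ζ^i multiply to 5, the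
        -- value of the cyclotomic polynomial at 1.
        (z5 (+ 2) (-[1+ 0 ]) (+ 1) (-[1+ 1 ])) ≡.refl
        (solve 7 (λ a₀ a₁ a₂ a₃ a₄ b₃ b₄ →
           (con 1ᶻ :* a₀ :+ con (-ᶻ ζ²) :* a₁ :+ con ζ⁴ :* a₂ :+ con (-ᶻ ζ) :* a₃ :+ con ζ³ :* a₄) :+
           (con (-ᶻ ζ³) :* a₂ :+ con ζ :* a₃ :+ con (-ᶻ ζ⁴) :* a₄ :+ con ζ² :* b₃ :+ con (-ᶻ 1ᶻ) :* b₄) ⊜
           (a₀ :- b₄) :- con ζ² :* (a₁ :- b₃) :+ con ((1ᶻ -ᶻ ζ²) *ᶻ c) :* (a₂ :- a₄)) refl)

      dissection-ζ⁴ : P ζ⁴ 1 1 * P ζ 1 1 * P 1ᶻ 1 1 ≈ Θ 10 15 25 + κ (-ᶻ (1ᶻ +ᶻ c)) * (q ^ 1 * Θ 20 5 25)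
      dissection-ζ⁴ = RootPair.dissection ζ⁴ ζ ≡.refl ≡.refl ≡.refl (-ᶻ (1ᶻ +ᶻ c))
        ((1ᶻ -ᶻ ζ) *ᶻ (1ᶻ -ᶻ ζ²) *ᶻ (1ᶻ -ᶻ ζ³)) ≡.refl
        (solve 7 (λ a₀ a₁ a₂ a₃ a₄ b₃ b₄ →
           (con 1ᶻ :* a₀ :+ con (-ᶻ ζ⁴) :* a₁ :+ con ζ³ :* a₂ :+ con (-ᶻ ζ²) :* a₃ :+ con ζ :* a₄) :+
           (con (-ᶻ ζ) :* a₂ :+ con ζ² :* a₃ :+ con (-ᶻ ζ³) :* a₄ :+ con ζ⁴ :* b₃ :+ con (-ᶻ 1ᶻ) :* b₄) ⊜
           (a₀ :- b₄) :- con ζ⁴ :* (a₁ :- b₃) :+ con ((1ᶻ -ᶻ ζ⁴) *ᶻ (-ᶻ (1ᶻ +ᶻ c))) :* (a₂ :- a₄)) refl)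

      -- Pentagonal series modulo 5 and the cleared form of the sum

      C D : ℕ → Carrier
      -- The pieces do not depend on the root, so those at ζ serve for ζ⁴ and for 1 as well.
      C = RootPair.C ζ ζ⁴ ≡.refl ≡.refl ≡.refl
      D = RootPair.D ζ ζ⁴ ≡.refl ≡.refl ≡.refl

      theta-35 : Θ 35 40 75 ≈ C 0 - D 4
      theta-35 = trans (sym (*-identityˡ _)) (q^Θ 0 74 35 40 ≡.refl)
      theta-50 : q ^ 1 * Θ 50 25 75 ≈ C 1 - D 3
      theta-50 = q^Θ 1 74 50 25 ≡.refl
      theta-65 : q ^ 5 * Θ 65 10 75 ≈ C 2 - D 2
      theta-65 = q^Θ 5 74 65 10 ≡.refl
      theta-70 : q ^ 7 * Θ 70 5 75 ≈ D 1 - C 3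
      theta-70 = q^Θ 7 74 70 5 ≡.refl
      theta-55 : q ^ 2 * Θ 55 20 75 ≈ D 0 - C 4
      theta-55 = q^Θ 2 74 55 20 ≡.refl

      ψ-ζ ψ-ζ⁴ ψ-1 : Carrier
      ψ-ζ  = RootPair.ψ ζ ζ⁴ ≡.refl ≡.refl ≡.refl
      ψ-ζ⁴ = RootPair.ψ ζ⁴ ζ ≡.refl ≡.refl ≡.refl
      ψ-1  = RootPair.ψ 1ᶻ 1ᶻ ≡.refl ≡.refl ≡.refl

      -- At u = 1 the factor (1)_n kills every term but n = 0. Compared with `ψ-dissection`, this is
      -- the pentagonal number theorem, already split modulo 5.
      ψ-1≈euler : ψ-1 ≈ P 1ᶻ 1 1
      ψ-1≈euler = begin
        ψ-1
          ≈⟨ Sum.fold-suc N _ ⟩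
        1# * (1# * 1# * P 1ᶻ 1 1) + ∑ N (λ n → q ^ (suc n ℕ.* suc n) * (finite 1ᶻ 0 1 (suc n) * finite 1ᶻ 1 1 (suc n) * P 1ᶻ (suc (suc n ℕ.+ suc n)) 1))
          ≈⟨ +-cong (trans (*-identityˡ _) (trans (*-congʳ (*-identityˡ _)) (*-identityˡ _)))
               (Sum.fold-ε N (λ n → trans (*-congˡ (trans (*-congʳ (trans (*-congʳ (vanish n)) (zeroˡ _))) (zeroˡ _))) (zeroʳ _))) ⟩
        P 1ᶻ 1 1 + 0#
          ≈⟨ +-identityʳ _ ⟩
        P 1ᶻ 1 1 ∎
        where
        vanish : ∀ n → finite 1ᶻ 0 1 (suc n) ≈ 0#
        vanish n = trans (finite-+ 1ᶻ 0 1 1 n) (trans (*-congʳ (trans (*-identityˡ _)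
          (trans (+-congˡ (-‿cong (trans (*-identityʳ _) 1-homo))) (-‿inverseʳ _)))) (zeroˡ _))

      euler-dissection : P 1ᶻ 1 1 ≈ Θ 35 40 75 - q ^ 1 * Θ 50 25 75 + q ^ 5 * Θ 65 10 75 + q ^ 7 * Θ 70 5 75 - q ^ 2 * Θ 55 20 75
      euler-dissection = begin
        P 1ᶻ 1 1
          ≈⟨ trans (sym ψ-1≈euler) (RootPair.ψ-dissection 1ᶻ 1ᶻ ≡.refl ≡.refl ≡.refl) ⟩
        _
          ≈⟨ solve 10 (λ c₀ c₁ c₂ c₃ c₄ d₀ d₁ d₂ d₃ d₄ →
               (con 1ᶻ :* c₀ :+ con (-ᶻ 1ᶻ) :* c₁ :+ con 1ᶻ :* c₂ :+ con (-ᶻ 1ᶻ) :* c₃ :+ con 1ᶻ :* c₄) :+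
               (con (-ᶻ 1ᶻ) :* d₀ :+ con 1ᶻ :* d₁ :+ con (-ᶻ 1ᶻ) :* d₂ :+ con 1ᶻ :* d₃ :+ con (-ᶻ 1ᶻ) :* d₄) ⊜
               (c₀ :- d₄) :- (c₁ :- d₃) :+ (c₂ :- d₂) :+ (d₁ :- c₃) :- (d₀ :- c₄)) refl
               (C 0) (C 1) (C 2) (C 3) (C 4) (D 0) (D 1) (D 2) (D 3) (D 4) ⟩
        (C 0 - D 4) - (C 1 - D 3) + (C 2 - D 2) + (D 1 - C 3) - (D 0 - C 4)
          ≈⟨ sym (+-cong (+-cong (+-cong (+-cong theta-35 (-‿cong theta-50)) theta-65) theta-70) (-‿cong theta-55)) ⟩
        Θ 35 40 75 - q ^ 1 * Θ 50 25 75 + q ^ 5 * Θ 65 10 75 + q ^ 7 * Θ 70 5 75 - q ^ 2 * Θ 55 20 75 ∎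

      -- PP₄(ζ) multiplied by (ζq, q/ζ; q)_∞.
      cleared : Carrier
      cleared = ∑ N (λ k → q ^ (suc k ℕ.* suc k) * (finite ζ 1 1 k * finite ζ⁴ 1 1 k * P 1ᶻ (suc (suc k ℕ.+ suc k)) 1))

      -- The constant comes from (1 + ζ)(1 - ζ)(1 - 1/ζ), after the first factors of (ζ)_n and
      -- (1/ζ)_n are detached. The term n = 0, absent from PP₄, contributes (1 + ζ)(q)_∞.
      ψ-combination : κ ζ * ψ-ζ + ψ-ζ⁴ ≈ κ (1ᶻ +ᶻ ζ) * P 1ᶻ 1 1 + κ ((1ᶻ -ᶻ ζ²) *ᶻ (1ᶻ -ᶻ ζ⁴)) * cleared
      ψ-combination = begin
        κ ζ * ψ-ζ + ψ-ζ⁴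
          ≈⟨ +-cong (*-congˡ (Sum.fold-suc N _)) (Sum.fold-suc N _) ⟩
        κ ζ * (1# * (1# * 1# * P 1ᶻ 1 1) + ∑ N (term ζ ζ⁴)) + (1# * (1# * 1# * P 1ᶻ 1 1) + ∑ N (term ζ⁴ ζ))
          ≈⟨ solve 3 (λ p s t → con ζ :* (:1 :* (:1 :* :1 :* p) :+ s) :+ (:1 :* (:1 :* :1 :* p) :+ t) ⊜
                                con (1ᶻ +ᶻ ζ) :* p :+ (con ζ :* s :+ t)) refl (P 1ᶻ 1 1) _ _ ⟩
        κ (1ᶻ +ᶻ ζ) * P 1ᶻ 1 1 + (κ ζ * ∑ N (term ζ ζ⁴) + ∑ N (term ζ⁴ ζ))
          ≈⟨ +-congˡ (trans (+-congʳ (sym (∑-* (κ ζ) N (term ζ ζ⁴)))) (sym (Sum.fold-∙ N _ (term ζ⁴ ζ)))) ⟩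
        κ (1ᶻ +ᶻ ζ) * P 1ᶻ 1 1 + ∑ N (λ k → κ ζ * term ζ ζ⁴ k + term ζ⁴ ζ k)
          ≈⟨ +-congˡ (trans (Sum.fold-cong′ N combine) (∑-* _ N _)) ⟩
        κ (1ᶻ +ᶻ ζ) * P 1ᶻ 1 1 + κ ((1ᶻ -ᶻ ζ²) *ᶻ (1ᶻ -ᶻ ζ⁴)) * cleared ∎
        where
        term : Z5 → Z5 → ℕ → Carrier
        term u u′ k = q ^ (suc k ℕ.* suc k) * (finite u 0 1 (suc k) * finite u′ 1 1 (suc k) * P 1ᶻ (suc (suc k ℕ.+ suc k)) 1)

        peel : ∀ u k → finite u 0 1 (suc k) ≈ (1# - κ u) * finite u 1 1 k
        peel u k = trans (finite-+ u 0 1 1 k) (*-congʳ (trans (*-identityˡ _) (+-congˡ (-‿cong (*-identityʳ _)))))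

        combine : ∀ k → κ ζ * term ζ ζ⁴ k + term ζ⁴ ζ k ≈ κ ((1ᶻ -ᶻ ζ²) *ᶻ (1ᶻ -ᶻ ζ⁴)) *
          (q ^ (suc k ℕ.* suc k) * (finite ζ 1 1 k * finite ζ⁴ 1 1 k * P 1ᶻ (suc (suc k ℕ.+ suc k)) 1))
        combine k = trans (+-cong (*-congˡ (*-congˡ (*-congʳ (*-congʳ (peel ζ k))))) (*-congˡ (*-congʳ (*-congʳ (peel ζ⁴ k)))))
          (solve 5 (λ Q f g p x →
            con ζ :* (Q :* ((:1 :- con ζ) :* f :* (g :* (:1 :- con ζ⁴ :* x)) :* p)) :+
            Q :* ((:1 :- con ζ⁴) :* g :* (f :* (:1 :- con ζ :* x)) :* p) ⊜
            con ((1ᶻ -ᶻ ζ²) *ᶻ (1ᶻ -ᶻ ζ⁴)) :* (Q :* (f :* g :* p))) refl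
            (q ^ (suc k ℕ.* suc k)) (finite ζ 1 1 k) (finite ζ⁴ 1 1 k) (P 1ᶻ (suc (suc k ℕ.+ suc k)) 1) (q ^ (1 ℕ.+ k ℕ.* 1)))

      cleared-dissection : cleared ≈ q ^ 1 * Θ 50 25 75 - q ^ 7 * Θ 70 5 75 - κ (1ᶻ +ᶻ c) * (q ^ 5 * Θ 65 10 75)
      cleared-dissection = κ-cancel ((1ᶻ -ᶻ ζ²) *ᶻ (1ᶻ -ᶻ ζ⁴)) ((1ᶻ -ᶻ ζ) *ᶻ (1ᶻ -ᶻ ζ³)) ≡.refl (begin
        κ ((1ᶻ -ᶻ ζ²) *ᶻ (1ᶻ -ᶻ ζ⁴)) * cleared
          ≈⟨ solve 2 (λ p s → s ⊜ con (1ᶻ +ᶻ ζ) :* p :+ s :- con (1ᶻ +ᶻ ζ) :* p) refl (P 1ᶻ 1 1) _ ⟩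
        κ (1ᶻ +ᶻ ζ) * P 1ᶻ 1 1 + κ ((1ᶻ -ᶻ ζ²) *ᶻ (1ᶻ -ᶻ ζ⁴)) * cleared - κ (1ᶻ +ᶻ ζ) * P 1ᶻ 1 1
          ≈⟨ +-cong (sym ψ-combination) (-‿cong (*-congˡ (sym ψ-1≈euler))) ⟩
        -- On `C 0`, `D 4` and `C 4`, `D 0` the first two summands have 1 + ζ times the coefficients
        -- of `ψ-1`, so these two theta functions cancel and three remain.
        κ ζ * ψ-ζ + ψ-ζ⁴ - κ (1ᶻ +ᶻ ζ) * ψ-1
          ≈⟨ +-cong (+-cong (*-congˡ (RootPair.ψ-dissection ζ ζ⁴ ≡.refl ≡.refl ≡.refl)) (RootPair.ψ-dissection ζ⁴ ζ ≡.refl ≡.refl ≡.refl))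
               (-‿cong (*-congˡ (RootPair.ψ-dissection 1ᶻ 1ᶻ ≡.refl ≡.refl ≡.refl))) ⟩
        _
          ≈⟨ solve 10 (λ c₀ c₁ c₂ c₃ c₄ d₀ d₁ d₂ d₃ d₄ →
               con ζ :* ((con 1ᶻ :* c₀ :+ con (-ᶻ ζ) :* c₁ :+ con ζ² :* c₂ :+ con (-ᶻ ζ³) :* c₃ :+ con ζ⁴ :* c₄) :+
                         (con (-ᶻ ζ⁴) :* d₀ :+ con ζ³ :* d₁ :+ con (-ᶻ ζ²) :* d₂ :+ con ζ :* d₃ :+ con (-ᶻ 1ᶻ) :* d₄)) :+
               ((con 1ᶻ :* c₀ :+ con (-ᶻ ζ⁴) :* c₁ :+ con ζ³ :* c₂ :+ con (-ᶻ ζ²) :* c₃ :+ con ζ :* c₄) :+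
                (con (-ᶻ ζ) :* d₀ :+ con ζ² :* d₁ :+ con (-ᶻ ζ³) :* d₂ :+ con ζ⁴ :* d₃ :+ con (-ᶻ 1ᶻ) :* d₄)) :-
               con (1ᶻ +ᶻ ζ) :*
               ((con 1ᶻ :* c₀ :+ con (-ᶻ 1ᶻ) :* c₁ :+ con 1ᶻ :* c₂ :+ con (-ᶻ 1ᶻ) :* c₃ :+ con 1ᶻ :* c₄) :+
                (con (-ᶻ 1ᶻ) :* d₀ :+ con 1ᶻ :* d₁ :+ con (-ᶻ 1ᶻ) :* d₂ :+ con 1ᶻ :* d₃ :+ con (-ᶻ 1ᶻ) :* d₄)) ⊜
               con ((1ᶻ -ᶻ ζ²) *ᶻ (1ᶻ -ᶻ ζ⁴)) :* ((c₁ :- d₃) :- (d₁ :- c₃) :- con (1ᶻ +ᶻ c) :* (c₂ :- d₂))) refl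
               (C 0) (C 1) (C 2) (C 3) (C 4) (D 0) (D 1) (D 2) (D 3) (D 4) ⟩
        κ ((1ᶻ -ᶻ ζ²) *ᶻ (1ᶻ -ᶻ ζ⁴)) * ((C 1 - D 3) - (D 1 - C 3) - κ (1ᶻ +ᶻ c) * (C 2 - D 2))
          ≈⟨ *-congˡ (sym (+-cong (+-cong theta-50 (-‿cong theta-70)) (-‿cong (*-congˡ theta-65)))) ⟩
        κ ((1ᶻ -ᶻ ζ²) *ᶻ (1ᶻ -ᶻ ζ⁴)) * (q ^ 1 * Θ 50 25 75 - q ^ 7 * Θ 70 5 75 - κ (1ᶻ +ᶻ c) * (q ^ 5 * Θ 65 10 75)) ∎)

      root-product : P ζ² 1 1 * P ζ³ 1 1 * (P ζ⁴ 1 1 * P ζ 1 1) * P 1ᶻ 1 1 ≈ P 1ᶻ 5 5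
      root-product = begin
        P ζ² 1 1 * P ζ³ 1 1 * (P ζ⁴ 1 1 * P ζ 1 1) * P 1ᶻ 1 1
          ≈⟨ sym (trans (Product.fold-∙ N _ _) (*-congʳ (trans (Product.fold-∙ N _ _)
               (*-cong (Product.fold-∙ N _ _) (Product.fold-∙ N _ _))))) ⟩
        ∏ N (λ j → factor ζ² j * factor ζ³ j * (factor ζ⁴ j * factor ζ j) * factor 1ᶻ j)
          ≈⟨ Product.fold-cong′ N (λ j → trans
               (solve 1 (λ x → (:1 :- con ζ² :* x) :* (:1 :- con ζ³ :* x) :* ((:1 :- con ζ⁴ :* x) :* (:1 :- con ζ :* x)) :* (:1 :- con 1ᶻ :* x) ⊜
                               :1 :- con 1ᶻ :* (x :* (x :* (x :* (x :* (x :* :1)))))) refl (q ^ (1 ℕ.+ j ℕ.* 1)))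
               (+-congˡ (-‿cong (*-congˡ (trans (^-assocʳ q (1 ℕ.+ j ℕ.* 1) 5) (^-congʳ q (exponent j))))))) ⟩
        P 1ᶻ 5 5 ∎
        where
        factor : Z5 → ℕ → Carrier
        factor u j = 1# - κ u * q ^ (1 ℕ.+ j ℕ.* 1)
        exponent : ∀ j → (1 ℕ.+ j ℕ.* 1) ℕ.* 5 ≡ 5 ℕ.+ j ℕ.* 5
        exponent = solve-∀

      -- Theta identities to the base q^75

      module Assembly
        (p : Z5 → ℕ → ℕ → Carrier) (p≈P : ∀ u e d → p u e (suc d) ≈ P u e (suc d))
        (mono : ℕ → Carrier) (mono≈ : ∀ k → mono k ≈ q ^ k)
        (scale : Z5 → Carrier → Carrier) (scale≈ : ∀ u f → scale u f ≈ κ u * f)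
        (inv : Carrier → Carrier) (Unital : Carrier → Set)
        (inv-inverse : ∀ f → Unital f → f * inv f ≈ 1#)
        (unital-* : ∀ f g → Unital f → Unital g → Unital (f * g))
        (unital-p : ∀ u e d → Unital (p u (suc e) (suc d)))
        -- To be read as "a series in q^5"; `separate` then says that exponents congruent to 0 and
        -- to 2 modulo 5 cannot meet. `Unital` stands for constant term 1.
        (Five : Carrier → Set ℓ) (five-cong : ∀ {f g} → f ≈ g → Five f → Five g)
        (five-+ : ∀ f g → Five f → Five g → Five (f + g)) (five-* : ∀ f g → Five f → Five g → Five (f * g))
        (five-κ : ∀ u → Five (κ u)) (five-q : Five (q ^ 5))
        (separate : ∀ f g → Five f → Five g → f ≈ q ^ 2 * g → f ≈ 0#)
        where

        unital-cancel : ∀ f → Unital f → ∀ {x y} → f * x ≈ f * y → x ≈ y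
        unital-cancel f f-unital {x} {y} eq = begin
          x                ≈⟨ expand x ⟩
          inv f * (f * x)  ≈⟨ *-congˡ eq ⟩
          inv f * (f * y)  ≈⟨ sym (expand y) ⟩
          y                ∎
          where
          expand : ∀ x → x ≈ inv f * (f * x)
          expand x = begin
            x                ≈⟨ sym (*-identityˡ x) ⟩
            1# * x           ≈⟨ *-congʳ (sym (inv-inverse f f-unital)) ⟩
            f * inv f * x    ≈⟨ solve 3 (λ f i x → f :* i :* x ⊜ i :* (f :* x)) refl f (inv f) x ⟩
            inv f * (f * x)  ∎

        five-1 : Five 1#
        five-1 = five-cong 1-homo (five-κ 1ᶻ)

        five-minus : ∀ f g → Five f → Five g → Five (f - g)
        five-minus f g f-five g-five = five-cong (solve 2 (λ f g → f :+ con (-ᶻ 1ᶻ) :* g ⊜ f :- g) refl f g)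
          (five-+ f _ f-five (five-* _ g (five-κ (-ᶻ 1ᶻ)) g-five))

        five-^ : ∀ f n → Five f → Five (f ^ n)
        five-^ f zero    f-five = five-1
        five-^ f (suc n) f-five = five-* f (f ^ n) f-five (five-^ f n f-five)

        five-∏ : ∀ n f → (∀ i → Five (f i)) → Five (∏ n f)
        five-∏ zero    f f-five = five-1
        five-∏ (suc n) f f-five = five-* _ _ (five-∏ n f f-five) (f-five n)

        five-P : ∀ e d → Five (P 1ᶻ (5 ℕ.* e) (5 ℕ.* d))
        five-P e d = five-∏ N _ (λ j → five-minus 1# _ five-1 (five-* _ _ (five-κ 1ᶻ)
          (five-cong (trans (^-assocʳ q 5 (e ℕ.+ j ℕ.* d)) (^-congʳ q (exponent e d j))) (five-^ (q ^ 5) (e ℕ.+ j ℕ.* d) five-q))))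
          where
          exponent : ∀ e d j → 5 ℕ.* (e ℕ.+ j ℕ.* d) ≡ 5 ℕ.* e ℕ.+ j ℕ.* (5 ℕ.* d)
          exponent = solve-∀

        θ : ℕ → ℕ → Carrier
        θ e m = p 1ᶻ e m * p 1ᶻ (m ∸ e) m

        h : ℕ → Carrier
        h e = θ e 75

        five-p : ∀ e d → Five (p 1ᶻ (5 ℕ.* e) (suc (4 ℕ.+ d ℕ.* 5)))
        five-p e d = five-cong (sym (p≈P 1ᶻ (5 ℕ.* e) (4 ℕ.+ d ℕ.* 5)))
          (≡.subst (λ m → Five (P 1ᶻ (5 ℕ.* e) m)) (ℕₚ.*-comm 5 (suc d)) (five-P e (suc d)))

        -- `U` and `V` are [q^5; q^25]_∞ and [q^10; q^25]_∞ split to the base q^75. The solver sees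
        -- q and q^5 as independent variables x and y, so the power of x records the exponent modulo
        -- 5.
        T U V x y : Carrier
        T = p 1ᶻ 75 75
        U = h 5 * h 20 * h 30
        V = h 10 * h 15 * h 35
        x = q ^ 1
        y = q ^ 5

        five-h : ∀ e e′ → Five (p 1ᶻ (5 ℕ.* e) 75 * p 1ᶻ (5 ℕ.* e′) 75)
        five-h e e′ = five-* _ _ (five-p e 14) (five-p e′ 14)

        five-U : Five U
        five-U = five-* _ _ (five-* _ _ (five-h 1 14) (five-h 4 11)) (five-h 6 9)

        five-V : Five V
        five-V = five-* _ _ (five-* _ _ (five-h 2 13) (five-h 3 12)) (five-h 7 8)

        unital-h : ∀ e e′ → Unital (p 1ᶻ (suc e) 75 * p 1ᶻ (suc e′) 75)
        unital-h e e′ = unital-* _ _ (unital-p 1ᶻ e 74) (unital-p 1ᶻ e′ 74)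

        unital-U : Unital U
        unital-U = unital-* _ _ (unital-* _ _ (unital-h 4 69) (unital-h 19 54)) (unital-h 29 44)

        unital-V : Unital V
        unital-V = unital-* _ _ (unital-* _ _ (unital-h 9 64) (unital-h 14 59)) (unital-h 34 39)

        Θ≈θ : ∀ e e′ d → Θ e e′ (suc d) ≈ p 1ᶻ e (suc d) * p 1ᶻ e′ (suc d) * p 1ᶻ (suc d) (suc d)
        Θ≈θ e e′ d = sym (*-cong (*-cong (p≈P 1ᶻ e d) (p≈P 1ᶻ e′ d)) (p≈P 1ᶻ (suc d) d))

        thirds : ∀ e → p 1ᶻ e 25 ≈ p 1ᶻ e 75 * p 1ᶻ (e ℕ.+ 25) 75 * p 1ᶻ (e ℕ.+ 50) 75
        thirds e = trans (p≈P 1ᶻ e 24) (trans (P-blocks 2 1ᶻ e 24) (*-cong (*-cong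
          (trans (*-identityˡ _) (trans (reflexive (≡.cong (λ k → P 1ᶻ k 75) (ℕₚ.+-identityʳ e))) (sym (p≈P 1ᶻ e 74))))
          (sym (p≈P 1ᶻ (e ℕ.+ 25) 74))) (sym (p≈P 1ᶻ (e ℕ.+ 50) 74))))

        p₂₅≈ : p 1ᶻ 25 25 ≈ T * h 25
        p₂₅≈ = trans (thirds 25) (solve 3 (λ a b t → a :* b :* t ⊜ t :* (a :* b)) refl (p 1ᶻ 25 75) (p 1ᶻ 50 75) T)

        θ₅≈U : p 1ᶻ 20 25 * p 1ᶻ 5 25 ≈ U
        θ₅≈U = trans (*-cong (thirds 20) (thirds 5))
          (solve 6 (λ a₂₀ a₄₅ a₇₀ a₅ a₃₀ a₅₅ → a₂₀ :* a₄₅ :* a₇₀ :* (a₅ :* a₃₀ :* a₅₅) ⊜ a₅ :* a₇₀ :* (a₂₀ :* a₅₅) :* (a₃₀ :* a₄₅))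
            refl (p 1ᶻ 20 75) (p 1ᶻ 45 75) (p 1ᶻ 70 75) (p 1ᶻ 5 75) (p 1ᶻ 30 75) (p 1ᶻ 55 75))

        θ₁₀≈V : p 1ᶻ 10 25 * p 1ᶻ 15 25 ≈ V
        θ₁₀≈V = trans (*-cong (thirds 10) (thirds 15))
          (solve 6 (λ a₁₀ a₃₅ a₆₀ a₁₅ a₄₀ a₆₅ → a₁₀ :* a₃₅ :* a₆₀ :* (a₁₅ :* a₄₀ :* a₆₅) ⊜ a₁₀ :* a₆₅ :* (a₁₅ :* a₆₀) :* (a₃₅ :* a₄₀))
            refl (p 1ᶻ 10 75) (p 1ᶻ 35 75) (p 1ᶻ 60 75) (p 1ᶻ 15 75) (p 1ᶻ 40 75) (p 1ᶻ 65 75))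

        q²≈ : q ^ 2 ≈ x * x
        q²≈ = ^-homo-* q 1 1

        q⁷≈ : q ^ 7 ≈ x * x * y
        q⁷≈ = trans (^-homo-* q 2 5) (*-congʳ q²≈)

        q⁸≈ : q ^ 8 ≈ x * x * x * y
        q⁸≈ = trans (^-homo-* q 3 5) (*-congʳ (trans (^-homo-* q 2 1) (*-congʳ q²≈)))

        -- `Z₂` is the denominator (ζq, q/ζ)_∞ to be removed; its conjugate `Z₁`, together with `E`,
        -- completes it to (q^5; q^5)_∞.
        E Z₁ Z₂ : Carrier
        E  = P 1ᶻ 1 1
        Z₁ = P ζ² 1 1 * P ζ³ 1 1
        Z₂ = P ζ⁴ 1 1 * P ζ 1 1

        E≈ : E ≈ T * (h 35 - x * h 25 + y * h 10 + x * x * y * h 5 - x * x * h 20)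
        E≈ = trans euler-dissection (trans
          (+-cong (+-cong (+-cong (+-cong (Θ≈θ 35 40 74) (-‿cong (*-congˡ (Θ≈θ 50 25 74)))) (*-congˡ (Θ≈θ 65 10 74)))
            (*-cong q⁷≈ (Θ≈θ 70 5 74))) (-‿cong (*-cong q²≈ (Θ≈θ 55 20 74))))
          (solve 12 (λ h₃₅ a₂₅ a₅₀ a₁₀ a₆₅ a₅ a₇₀ a₂₀ a₅₅ T x y →
             h₃₅ :* T :- x :* (a₅₀ :* a₂₅ :* T) :+ y :* (a₆₅ :* a₁₀ :* T) :+ x :* x :* y :* (a₇₀ :* a₅ :* T) :- x :* x :* (a₅₅ :* a₂₀ :* T) ⊜
             T :* (h₃₅ :- x :* (a₂₅ :* a₅₀) :+ y :* (a₁₀ :* a₆₅) :+ x :* x :* y :* (a₅ :* a₇₀) :- x :* x :* (a₂₀ :* a₅₅)))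
             refl (h 35) (p 1ᶻ 25 75) (p 1ᶻ 50 75) (p 1ᶻ 10 75) (p 1ᶻ 65 75) (p 1ᶻ 5 75) (p 1ᶻ 70 75) (p 1ᶻ 20 75) (p 1ᶻ 55 75) T x y))

        Z₁E≈ : Z₁ * E ≈ T * h 25 * (V + κ c * (x * U))
        Z₁E≈ = trans dissection-ζ² (trans
          (+-cong (trans (Θ≈θ 10 15 24) (*-cong θ₁₀≈V p₂₅≈)) (*-congˡ (*-congˡ (trans (Θ≈θ 20 5 24) (*-cong θ₅≈U p₂₅≈)))))
          (solve 5 (λ U V x k Q → V :* Q :+ k :* (x :* (U :* Q)) ⊜ Q :* (V :+ k :* (x :* U))) refl U V x (κ c) (T * h 25)))

        Z₂E≈ : Z₂ * E ≈ T * h 25 * (V + κ (-ᶻ (1ᶻ +ᶻ c)) * (x * U))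
        Z₂E≈ = trans dissection-ζ⁴ (trans
          (+-cong (trans (Θ≈θ 10 15 24) (*-cong θ₁₀≈V p₂₅≈)) (*-congˡ (*-congˡ (trans (Θ≈θ 20 5 24) (*-cong θ₅≈U p₂₅≈)))))
          (solve 5 (λ U V x k Q → V :* Q :+ k :* (x :* (U :* Q)) ⊜ Q :* (V :+ k :* (x :* U))) refl U V x (κ (-ᶻ (1ᶻ +ᶻ c))) (T * h 25)))

        Z₁Z₂E≈ : Z₁ * Z₂ * E ≈ T * h 25 * (U * V)
        Z₁Z₂E≈ = begin
          Z₁ * Z₂ * E
            ≈⟨ root-product ⟩
          P 1ᶻ 5 5
            ≈⟨ P-blocks 4 1ᶻ 5 4 ⟩
          1# * P 1ᶻ 5 25 * P 1ᶻ 10 25 * P 1ᶻ 15 25 * P 1ᶻ 20 25 * P 1ᶻ 25 25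
            ≈⟨ sym (*-cong (*-cong (*-cong (*-cong (*-congˡ (p≈P 1ᶻ 5 24)) (p≈P 1ᶻ 10 24)) (p≈P 1ᶻ 15 24)) (p≈P 1ᶻ 20 24)) (p≈P 1ᶻ 25 24)) ⟩
          1# * p 1ᶻ 5 25 * p 1ᶻ 10 25 * p 1ᶻ 15 25 * p 1ᶻ 20 25 * p 1ᶻ 25 25
            ≈⟨ solve 5 (λ a b d e f → :1 :* a :* b :* d :* e :* f ⊜ f :* (e :* a :* (b :* d))) refl _ _ _ _ _ ⟩
          p 1ᶻ 25 25 * (p 1ᶻ 20 25 * p 1ᶻ 5 25 * (p 1ᶻ 10 25 * p 1ᶻ 15 25))
            ≈⟨ *-cong p₂₅≈ (*-cong θ₅≈U θ₁₀≈V) ⟩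
          T * h 25 * (U * V) ∎

        unital-T : Unital T
        unital-T = unital-p 1ᶻ 74 74

        unital-h₂₅ : Unital (h 25)
        unital-h₂₅ = unital-h 24 49

        -- Multiplying the two dissections gives Ramanujan's 5-dissection of (q;q)_∞.
        -- The exponents ≡ 0 and ≡ 2 modulo 5 in its comparison with the pentagonal
        -- number series are e₁-defect = 0 and e₂-defect = 0.
        euler-product : (h 35 - x * h 25 + y * h 10 + x * x * y * h 5 - x * x * h 20) * (U * V) ≈
                        h 25 * (V * V - x * U * V - x * x * U * U)
        euler-product = unital-cancel (T * (T * h 25)) (unital-* _ _ unital-T (unital-* _ _ unital-T unital-h₂₅)) (begin
          T * (T * h 25) * (S * (U * V))
            ≈⟨ solve 4 (λ T Q S W → T :* Q :* (S :* W) ⊜ Q :* W :* (T :* S)) refl T (T * h 25) S (U * V) ⟩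
          T * h 25 * (U * V) * (T * S)
            ≈⟨ *-cong (sym Z₁Z₂E≈) (sym E≈) ⟩
          Z₁ * Z₂ * E * E
            ≈⟨ solve 3 (λ a b e → a :* b :* e :* e ⊜ (a :* e) :* (b :* e)) refl Z₁ Z₂ E ⟩
          (Z₁ * E) * (Z₂ * E)
            ≈⟨ *-cong Z₁E≈ Z₂E≈ ⟩
          T * h 25 * (V + κ c * (x * U)) * (T * h 25 * (V + κ (-ᶻ (1ᶻ +ᶻ c)) * (x * U)))
            -- The numbers c and -(1 + c) are the roots of t² + t - 1, so the product has the
            -- rational coefficients 1, -1, -1.
            ≈⟨ solve 5 (λ T h U V x →
                 T :* h :* (V :+ con c :* (x :* U)) :* (T :* h :* (V :+ con (-ᶻ (1ᶻ +ᶻ c)) :* (x :* U))) ⊜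
                 T :* (T :* h) :* (h :* (V :* V :- x :* U :* V :- x :* x :* U :* U))) refl T (h 25) U V x ⟩
          T * (T * h 25) * (h 25 * (V * V - x * U * V - x * x * U * U)) ∎)
          where S = h 35 - x * h 25 + y * h 10 + x * x * y * h 5 - x * x * h 20

        e₁-defect e₂-defect : Carrier
        e₁-defect = U * (h 35 + y * h 10) - h 25 * V
        e₂-defect = V * (h 20 - y * h 5) - h 25 * U

        -- A rearrangement of `euler-product`: the terms with x to the first power, -x h₂₅ U V,
        -- agree on both sides and drop out.
        defects-related : V * e₁-defect ≈ q ^ 2 * (U * e₂-defect)
        defects-related = x∙y⁻¹≈ε⇒x≈y _ _ (begin
          V * e₁-defect - q ^ 2 * (U * e₂-defect)
            ≈⟨ +-congˡ (-‿cong (*-congʳ q²≈)) ⟩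
          V * e₁-defect - x * x * (U * e₂-defect)
            ≈⟨ solve 9 (λ h₃₅ h₂₅ h₁₀ h₅ h₂₀ U V x y →
                 V :* (U :* (h₃₅ :+ y :* h₁₀) :- h₂₅ :* V) :- x :* x :* (U :* (V :* (h₂₀ :- y :* h₅) :- h₂₅ :* U)) ⊜
                 (h₃₅ :- x :* h₂₅ :+ y :* h₁₀ :+ x :* x :* y :* h₅ :- x :* x :* h₂₀) :* (U :* V) :-
                 h₂₅ :* (V :* V :- x :* U :* V :- x :* x :* U :* U)) refl (h 35) (h 25) (h 10) (h 5) (h 20) U V x y ⟩
          (h 35 - x * h 25 + y * h 10 + x * x * y * h 5 - x * x * h 20) * (U * V) - h 25 * (V * V - x * U * V - x * x * U * U)
            ≈⟨ trans (+-congʳ euler-product) (-‿inverseʳ _) ⟩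
          0# ∎)

        V-defect≈0 : V * e₁-defect ≈ 0#
        V-defect≈0 = separate _ _
          (five-* _ _ five-V (five-minus _ _ (five-* _ _ five-U (five-+ _ _ (five-h 7 8) (five-* _ _ five-q (five-h 2 13))))
            (five-* _ _ (five-h 5 10) five-V)))
          (five-* _ _ five-U (five-minus _ _ (five-* _ _ five-V (five-minus _ _ (five-h 4 11) (five-* _ _ five-q (five-h 1 14))))
            (five-* _ _ (five-h 5 10) five-U)))
          defects-related

        e₁-defect≈0 : e₁-defect ≈ 0#
        e₁-defect≈0 = unital-cancel V unital-V (trans V-defect≈0 (sym (zeroʳ V)))

        -- The factor x² cannot be cancelled when q is nilpotent; in the final comparison the defect
        -- appears with just this factor.
        e₂-defect≈0 : x * x * e₂-defect ≈ 0#
        e₂-defect≈0 = unital-cancel U unital-U (begin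
          U * (x * x * e₂-defect)  ≈⟨ solve 3 (λ U x e → U :* (x :* x :* e) ⊜ x :* x :* (U :* e)) refl U x e₂-defect ⟩
          x * x * (U * e₂-defect)  ≈⟨ *-congʳ (sym q²≈) ⟩
          q ^ 2 * (U * e₂-defect)  ≈⟨ sym defects-related ⟩
          V * e₁-defect            ≈⟨ V-defect≈0 ⟩
          0#                       ≈⟨ sym (zeroʳ U) ⟩
          U * 0#                   ∎)

        -- Comparison of the series with the closed form

        summand : ℕ → Carrier
        summand m = mono (m ℕ.* m) * p 1ᶻ (2 ℕ.* m ℕ.+ 1) 1 * inv (p ζ m 1) * inv (p ζ⁴ m 1)

        series : Carrier
        series = ∑ N (λ k → summand (suc k))

        summand-cleared : ∀ k → Z₂ * summand (suc k) ≈
          q ^ (suc k ℕ.* suc k) * (finite ζ 1 1 k * finite ζ⁴ 1 1 k * P 1ᶻ (suc (suc k ℕ.+ suc k)) 1)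
        summand-cleared k = begin
          Z₂ * summand (suc k)
            ≈⟨ *-cong (*-cong (tail ζ⁴) (tail ζ)) (*-congʳ (*-congʳ (*-cong (mono≈ _) (trans (p≈P 1ᶻ _ 0)
                 (reflexive (≡.cong (λ m → P 1ᶻ m 1) (odd k))))))) ⟩
          finite ζ⁴ 1 1 k * p ζ⁴ (suc k) 1 * (finite ζ 1 1 k * p ζ (suc k) 1) *
          (q ^ (suc k ℕ.* suc k) * P 1ᶻ (suc (suc k ℕ.+ suc k)) 1 * inv (p ζ (suc k) 1) * inv (p ζ⁴ (suc k) 1))
            ≈⟨ solve 8 (λ f g a b i j Q P → g :* b :* (f :* a) :* (Q :* P :* i :* j) ⊜ Q :* (f :* g :* P) :* (a :* i) :* (b :* j)) refl
                 (finite ζ 1 1 k) (finite ζ⁴ 1 1 k) (p ζ (suc k) 1) (p ζ⁴ (suc k) 1) (inv (p ζ (suc k) 1)) (inv (p ζ⁴ (suc k) 1)) _ _ ⟩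
          q ^ (suc k ℕ.* suc k) * (finite ζ 1 1 k * finite ζ⁴ 1 1 k * P 1ᶻ (suc (suc k ℕ.+ suc k)) 1) *
          (p ζ (suc k) 1 * inv (p ζ (suc k) 1)) * (p ζ⁴ (suc k) 1 * inv (p ζ⁴ (suc k) 1))
            ≈⟨ *-cong (*-congˡ (inv-inverse _ (unital-p ζ k 0))) (inv-inverse _ (unital-p ζ⁴ k 0)) ⟩
          q ^ (suc k ℕ.* suc k) * (finite ζ 1 1 k * finite ζ⁴ 1 1 k * P 1ᶻ (suc (suc k ℕ.+ suc k)) 1) * 1# * 1#
            ≈⟨ trans (*-identityʳ _) (*-identityʳ _) ⟩
          q ^ (suc k ℕ.* suc k) * (finite ζ 1 1 k * finite ζ⁴ 1 1 k * P 1ᶻ (suc (suc k ℕ.+ suc k)) 1) ∎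
          where
          odd : ∀ k → 2 ℕ.* suc k ℕ.+ 1 ≡ suc (suc k ℕ.+ suc k)
          odd = solve-∀
          tail : ∀ u → P u 1 1 ≈ finite u 1 1 k * p u (suc k) 1
          tail u = trans (P-split u 1 0 k) (*-congˡ (trans
            (reflexive (≡.cong (λ e → P u (suc e) 1) (ℕₚ.*-identityʳ k))) (sym (p≈P u (suc k) 0))))

        series-cleared : Z₂ * series ≈ T * (x * h 25 - x * x * y * h 5 - κ (1ᶻ +ᶻ c) * (y * h 10))
        series-cleared = begin
          Z₂ * series
            ≈⟨ sym (∑-* Z₂ N _) ⟩
          ∑ N (λ k → Z₂ * summand (suc k))
            ≈⟨ Sum.fold-cong′ N summand-cleared ⟩
          cleared
            ≈⟨ cleared-dissection ⟩
          q ^ 1 * Θ 50 25 75 - q ^ 7 * Θ 70 5 75 - κ (1ᶻ +ᶻ c) * (q ^ 5 * Θ 65 10 75)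
            ≈⟨ +-cong (+-cong (*-congˡ (Θ≈θ 50 25 74)) (-‿cong (*-cong q⁷≈ (Θ≈θ 70 5 74)))) (-‿cong (*-congˡ (*-congˡ (Θ≈θ 65 10 74)))) ⟩
          _
            ≈⟨ solve 9 (λ a₂₅ a₅₀ a₁₀ a₆₅ a₅ a₇₀ T x y →
                 x :* (a₅₀ :* a₂₅ :* T) :- x :* x :* y :* (a₇₀ :* a₅ :* T) :- con (1ᶻ +ᶻ c) :* (y :* (a₆₅ :* a₁₀ :* T)) ⊜
                 T :* (x :* (a₂₅ :* a₅₀) :- x :* x :* y :* (a₅ :* a₇₀) :- con (1ᶻ +ᶻ c) :* (y :* (a₁₀ :* a₆₅))))
                 refl (p 1ᶻ 25 75) (p 1ᶻ 50 75) (p 1ᶻ 10 75) (p 1ᶻ 65 75) (p 1ᶻ 5 75) (p 1ᶻ 70 75) T x y ⟩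
          T * (x * h 25 - x * x * y * h 5 - κ (1ᶻ +ᶻ c) * (y * h 10)) ∎

        -- By `Z₁Z₂E≈`, dividing by `Z₂` is the same as multiplying by `Z₁ * E` and dividing by T
        -- h₂₅ U V.
        series-UV : U * V * series ≈ T * (x * h 25 - x * x * y * h 5 - κ (1ᶻ +ᶻ c) * (y * h 10)) * (V + κ c * (x * U))
        series-UV = unital-cancel (T * h 25) (unital-* _ _ unital-T unital-h₂₅) (begin
          T * h 25 * (U * V * series)
            ≈⟨ trans (sym (*-assoc _ _ _)) (*-congʳ (sym Z₁Z₂E≈)) ⟩
          Z₁ * Z₂ * E * series
            ≈⟨ solve 4 (λ a b e s → a :* b :* e :* s ⊜ (a :* e) :* (b :* s)) refl Z₁ Z₂ E series ⟩
          (Z₁ * E) * (Z₂ * series)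
            ≈⟨ *-cong Z₁E≈ series-cleared ⟩
          T * h 25 * (V + κ c * (x * U)) * (T * (x * h 25 - x * x * y * h 5 - κ (1ᶻ +ᶻ c) * (y * h 10)))
            ≈⟨ trans (*-assoc _ _ _) (*-congˡ (*-comm _ _)) ⟩
          T * h 25 * (T * (x * h 25 - x * x * y * h 5 - κ (1ᶻ +ᶻ c) * (y * h 10)) * (V + κ c * (x * U))) ∎)

        i₁ i₂ i₃ i₄ i₅ : Carrier
        i₁ = inv (h 5 * h 20 * h 25 * h 30)
        i₂ = inv (h 10 * h 15 * h 25)
        i₃ = inv (θ 10 25)
        i₄ = inv (h 5 * h 25 * h 30)
        i₅ = inv (h 10 * h 15 * h 25 * h 35)

        closed-form : Carrier
        closed-form = p 1ᶻ 25 25 *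
          ( scale (-ᶻ (1ᶻ +ᶻ c)) (mono 5 * h 10 * i₁) + mono 1 * i₂ + scale (1ᶻ +ᶻ c) (mono 2 * i₃)
          - mono 2 * i₄ - scale c (mono 8 * h 5 * i₅) )

        closed-form-UV : U * V * closed-form ≈
          T * (κ (-ᶻ (1ᶻ +ᶻ c)) * (y * h 10 * V) + x * h 35 * U + κ (1ᶻ +ᶻ c) * (x * x * h 25 * U) - x * x * h 20 * V
               - κ c * (x * x * x * y * h 5 * U))
        closed-form-UV = begin
          U * V * closed-form
            ≈⟨ *-congˡ (*-cong p₂₅≈ (+-cong (+-cong (+-cong (+-cong
                 (trans (scale≈ _ _) (*-congˡ (*-congʳ (*-congʳ (mono≈ 5)))))
                 (*-congʳ (mono≈ 1)))
                 (trans (scale≈ _ _) (*-congˡ (*-congʳ (trans (mono≈ 2) q²≈)))))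
                 (-‿cong (*-congʳ (trans (mono≈ 2) q²≈))))
                 (-‿cong (trans (scale≈ _ _) (*-congˡ (*-congʳ (*-congʳ (trans (mono≈ 8) q⁸≈)))))))) ⟩
          U * V * (T * h 25 * (κ (-ᶻ (1ᶻ +ᶻ c)) * (y * h 10 * i₁) + x * i₂ + κ (1ᶻ +ᶻ c) * (x * x * i₃) - x * x * i₄
                               - κ c * (x * x * x * y * h 5 * i₅)))
            -- The first and last denominators are U h₂₅ and V h₂₅. The second lacks h₃₅ and the
            -- fourth lacks h₂₀, which therefore reappear as numerators; the third is `V` alone and
            -- leaves h₂₅.
            ≈⟨ solve 15 (λ T x y h₅ h₁₀ h₁₅ h₂₀ h₂₅ h₃₀ h₃₅ i₁ i₂ i₃ i₄ i₅ →
                 (h₅ :* h₂₀ :* h₃₀) :* (h₁₀ :* h₁₅ :* h₃₅) :* (T :* h₂₅ :* (con (-ᶻ (1ᶻ +ᶻ c)) :* (y :* h₁₀ :* i₁) :+ x :* i₂ :+ con (1ᶻ +ᶻ c) :* (x :* x :* i₃) :- x :* x :* i₄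
                   :- con c :* (x :* x :* x :* y :* h₅ :* i₅))) ⊜
                 T :* (con (-ᶻ (1ᶻ +ᶻ c)) :* (y :* h₁₀ :* (h₁₀ :* h₁₅ :* h₃₅)) :* (h₅ :* h₂₀ :* h₂₅ :* h₃₀ :* i₁) :+
                       x :* h₃₅ :* (h₅ :* h₂₀ :* h₃₀) :* (h₁₀ :* h₁₅ :* h₂₅ :* i₂) :+
                       con (1ᶻ +ᶻ c) :* (x :* x :* h₂₅ :* (h₅ :* h₂₀ :* h₃₀)) :* (h₁₀ :* h₁₅ :* h₃₅ :* i₃) :-
                       x :* x :* h₂₀ :* (h₁₀ :* h₁₅ :* h₃₅) :* (h₅ :* h₂₅ :* h₃₀ :* i₄) :-
                       con c :* (x :* x :* x :* y :* h₅ :* (h₅ :* h₂₀ :* h₃₀)) :* (h₁₀ :* h₁₅ :* h₂₅ :* h₃₅ :* i₅)))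
                 refl T x y (h 5) (h 10) (h 15) (h 20) (h 25) (h 30) (h 35) i₁ i₂ i₃ i₄ i₅ ⟩
          T * (κ (-ᶻ (1ᶻ +ᶻ c)) * (y * h 10 * V) * (h 5 * h 20 * h 25 * h 30 * i₁) +
               x * h 35 * U * (h 10 * h 15 * h 25 * i₂) +
               κ (1ᶻ +ᶻ c) * (x * x * h 25 * U) * (V * i₃) -
               x * x * h 20 * V * (h 5 * h 25 * h 30 * i₄) -
               κ c * (x * x * x * y * h 5 * U) * (h 10 * h 15 * h 25 * h 35 * i₅))
            ≈⟨ *-congˡ (+-cong (+-cong (+-cong (+-cong (drop inverse₁) (drop inverse₂)) (drop inverse₃))
                 (-‿cong (drop inverse₄))) (-‿cong (drop inverse₅))) ⟩
          T * (κ (-ᶻ (1ᶻ +ᶻ c)) * (y * h 10 * V) + x * h 35 * U + κ (1ᶻ +ᶻ c) * (x * x * h 25 * U) - x * x * h 20 * V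
               - κ c * (x * x * x * y * h 5 * U)) ∎
          where
          drop : ∀ {f g} → g ≈ 1# → f * g ≈ f
          drop g≈1 = trans (*-congˡ g≈1) (*-identityʳ _)
          inverse₁ = inv-inverse (h 5 * h 20 * h 25 * h 30)
            (unital-* _ _ (unital-* _ _ (unital-* _ _ (unital-h 4 69) (unital-h 19 54)) unital-h₂₅) (unital-h 29 44))
          inverse₂ = inv-inverse (h 10 * h 15 * h 25) (unital-* _ _ (unital-* _ _ (unital-h 9 64) (unital-h 14 59)) unital-h₂₅)
          inverse₃ = trans (*-congʳ (sym θ₁₀≈V)) (inv-inverse (θ 10 25) (unital-* _ _ (unital-p 1ᶻ 9 24) (unital-p 1ᶻ 14 24)))
          inverse₄ = inv-inverse (h 5 * h 25 * h 30) (unital-* _ _ (unital-* _ _ (unital-h 4 69) unital-h₂₅) (unital-h 29 44))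
          inverse₅ = inv-inverse (h 10 * h 15 * h 25 * h 35)
            (unital-* _ _ (unital-* _ _ (unital-* _ _ (unital-h 9 64) (unital-h 14 59)) unital-h₂₅) (unital-h 34 39))

        series≈closed-form : series ≈ closed-form
        series≈closed-form = unital-cancel (U * V) (unital-* _ _ unital-U unital-V) (begin
          U * V * series
            ≈⟨ series-UV ⟩
          T * (x * h 25 - x * x * y * h 5 - κ (1ᶻ +ᶻ c) * (y * h 10)) * (V + κ c * (x * U))
            -- By c² + c = 1 the discrepancy between the two sides is a combination of the two
            -- defects alone.
            ≈⟨ solve 10 (λ T x y h₅ h₁₀ h₂₀ h₂₅ h₃₅ U V →
                 T :* (x :* h₂₅ :- x :* x :* y :* h₅ :- con (1ᶻ +ᶻ c) :* (y :* h₁₀)) :* (V :+ con c :* (x :* U)) ⊜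
                 T :* (con (-ᶻ (1ᶻ +ᶻ c)) :* (y :* h₁₀ :* V) :+ x :* h₃₅ :* U :+ con (1ᶻ +ᶻ c) :* (x :* x :* h₂₅ :* U) :- x :* x :* h₂₀ :* V
                   :- con c :* (x :* x :* x :* y :* h₅ :* U)) :+
                 T :* (x :* x :* (V :* (h₂₀ :- y :* h₅) :- h₂₅ :* U) :- x :* (U :* (h₃₅ :+ y :* h₁₀) :- h₂₅ :* V)))
                 refl T x y (h 5) (h 10) (h 20) (h 25) (h 35) U V ⟩
          T * (κ (-ᶻ (1ᶻ +ᶻ c)) * (y * h 10 * V) + x * h 35 * U + κ (1ᶻ +ᶻ c) * (x * x * h 25 * U) - x * x * h 20 * V
               - κ c * (x * x * x * y * h 5 * U)) + T * (x * x * e₂-defect - x * e₁-defect)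
            ≈⟨ +-cong (sym closed-form-UV) (*-congˡ (+-cong e₂-defect≈0 (-‿cong (*-congˡ e₁-defect≈0)))) ⟩
          U * V * closed-form + T * (0# - x * 0#)
            ≈⟨ trans (+-congˡ (trans (*-congˡ (trans (+-congˡ (-‿cong (zeroʳ x))) (-‿inverseʳ 0#))) (zeroʳ T))) (+-identityʳ _) ⟩
          U * V * closed-form ∎)

-- Monomials, order of vanishing and exponents divisible by 5

module Monomials (A : CommutativeRing 0ℓ 0ℓ) (mono : ℕ → ℕ → CommutativeRing.Carrier A)
  (mono-diagonal : ∀ k → CommutativeRing._≈_ A (mono k k) (CommutativeRing.1# A))
  (mono-off : ∀ k n → k ≢ n → CommutativeRing._≈_ A (mono k n) (CommutativeRing.0# A)) where

  open CommutativeRing A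

  open PowerSeries A (mono 0) (mono-diagonal 0) (λ n → mono-off 0 (suc n) (λ ())) public

  X : ℕ → Carrier
  X = mono 1

  ✶-vanish : ∀ n f g → (∀ i j → i ℕ.+ j ≡ n → f i * g j ≈ 0#) → (f ✶ g) n ≈ 0#
  ✶-vanish zero    f g p = trans (✶-zero f g) (p 0 0 ≡.refl)
  ✶-vanish (suc n) f g p = trans (✶-suc f g n) (trans
    (+-cong (p 0 (suc n) ≡.refl) (✶-vanish n (λ k → f (suc k)) g (λ i j e → p (suc i) j (≡.cong suc e)))) (+-identityˡ 0#))

  ✶-low : ∀ {k n} f g → (∀ i → i ℕ.< k → f i ≈ 0#) → n ℕ.< k → (f ✶ g) n ≈ 0#
  ✶-low {k} {n} f g p n<k = ✶-vanish n f g (λ i j i+j≡n → trans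
    (*-congʳ (p i (ℕₚ.≤-<-trans (≡.subst (i ℕ.≤_) i+j≡n (ℕₚ.m≤m+n i j)) n<k))) (zeroˡ _))

  ✶-low-suc : ∀ k f g → (∀ i → i ℕ.< k → f i ≈ 0#) → g 0 ≈ 0# → ∀ i → i ℕ.< suc k → (f ✶ g) i ≈ 0#
  ✶-low-suc k f g p g₀≈0 zero    _         = trans (✶-zero f g) (trans (*-congˡ g₀≈0) (zeroʳ _))
  ✶-low-suc k f g p g₀≈0 (suc i) (s≤s i<k) = trans (✶-sucʳ f g i) (trans
    (+-cong (✶-low f (λ j → g (suc j)) p i<k) (trans (*-congˡ g₀≈0) (zeroʳ _))) (+-identityˡ 0#))

  mono-low : ∀ k n → n ℕ.< k → mono k n ≈ 0#
  mono-low k n n<k = mono-off k n (λ k≡n → ℕₚ.<⇒≢ n<k (≡.sym k≡n))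

  X✶-zero : ∀ f → (X ✶ f) 0 ≈ 0#
  X✶-zero f = ✶-low {1} X f (mono-low 1) (s≤s z≤n)

  mono-suc-suc : ∀ k n → mono (suc k) (suc n) ≈ mono k n
  mono-suc-suc k n with k ℕ.≟ n
  ... | yes ≡.refl = trans (mono-diagonal (suc k)) (sym (mono-diagonal k))
  ... | no  k≢n    = trans (mono-off (suc k) (suc n) (λ e → k≢n (ℕₚ.suc-injective e))) (sym (mono-off k n k≢n))

  X✶-suc : ∀ f n → (X ✶ f) (suc n) ≈ f n
  X✶-suc f n = trans (✶-suc X f n) (trans (+-congʳ (trans (*-congʳ (mono-off 1 0 (λ ()))) (zeroˡ _)))
    (trans (+-identityˡ _) (trans (✶-cong n {g = f} (λ k _ → mono-suc-suc 0 k) (λ _ _ → refl)) (✶-identityˡ f n))))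

  mono-suc : ∀ k → mono (suc k) ≋ (X ✶ mono k)
  mono-suc k zero    = trans (mono-low (suc k) 0 (s≤s z≤n)) (sym (X✶-zero (mono k)))
  mono-suc k (suc n) = trans (mono-suc-suc k n) (sym (X✶-suc (mono k) n))

  module _ (N : ℕ) where

    Five : (ℕ → Carrier) → Set
    Five f = ∀ n → n ℕ.< N → ¬ (5 ∣ n) → f n ≈ 0#

    five-cong : ∀ {f g} → f ≈[ N ] g → Five f → Five g
    five-cong p f-five n n<N ∤n = trans (sym (p n n<N)) (f-five n n<N ∤n)

    five-+ : ∀ f g → Five f → Five g → Five (λ n → f n + g n)
    five-+ f g f-five g-five n n<N ∤n = trans (+-cong (f-five n n<N ∤n) (g-five n n<N ∤n)) (+-identityˡ 0#)

    five-* : ∀ f g → Five f → Five g → Five (f ✶ g)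
    five-* f g f-five g-five n n<N ∤n = ✶-vanish n f g go
      where
      go : ∀ i j → i ℕ.+ j ≡ n → f i * g j ≈ 0#
      go i j i+j≡n with 5 ∣? i
      ... | no  ∤i = trans (*-congʳ (f-five i (ℕₚ.≤-<-trans (≡.subst (i ℕ.≤_) i+j≡n (ℕₚ.m≤m+n i j)) n<N) ∤i)) (zeroˡ _)
      ... | yes ∣i = trans (*-congˡ (g-five j (ℕₚ.≤-<-trans (≡.subst (j ℕ.≤_) i+j≡n (ℕₚ.m≤n+m j i)) n<N)
                       (λ ∣j → ∤n (≡.subst (5 ∣_) i+j≡n (∣m∣n⇒∣m+n ∣i ∣j))))) (zeroʳ _)

    five-κ : ∀ u → Five (λ n → u * mono 0 n)
    five-κ u n n<N ∤n = trans (*-congˡ (mono-off 0 n (λ { ≡.refl → ∤n (5 ∣0) }))) (zeroʳ u)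

    five-mono : Five (mono 5)
    five-mono n _ ∤n = mono-off 5 n (λ { ≡.refl → ∤n ∣-refl })

    -- Coefficient n of q² g is coefficient n - 2 of g, and n and n - 2 are never both divisible by
    -- 5.
    separate : ∀ f g → Five f → Five g → f ≈[ N ] mono 2 ✶ g → f ≈[ N ] (λ _ → 0#)
    separate f g f-five g-five f≈X²g n n<N with 5 ∣? n
    ... | no  ∤n = f-five n n<N ∤n
    ... | yes ∣n = trans (f≈X²g n n<N) (trans (✶-cong n {g = g} (λ k k≤n → mono-suc 1 k) (λ _ _ → refl))
                     (trans (✶-assoc X X g n) (go n n<N ∣n)))
      where
      go : ∀ n → n ℕ.< N → 5 ∣ n → (X ✶ (X ✶ g)) n ≈ 0#
      go zero          _   _  = X✶-zero (X ✶ g)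
      go (suc zero)    _   _  = trans (X✶-suc (X ✶ g) 0) (X✶-zero g)
      go (suc (suc n)) n<N ∣n = trans (X✶-suc (X ✶ g) (suc n)) (trans (X✶-suc g n)
        (g-five n (ℕₚ.<-trans (ℕₚ.n<1+n n) (ℕₚ.<-trans (ℕₚ.n<1+n _) n<N))
          (λ ∣n′ → >⇒∤ (s≤s (s≤s (s≤s z≤n))) (∣m+n∣m⇒∣n (≡.subst (5 ∣_) (ℕₚ.+-comm 2 n) ∣n) ∣n′))))

-- Transfer to the given operations on series

-- The ring operations are separate variables here, so that instantiating them
-- with the operations of Defs yields the terms of Defs on the nose; comparing
-- them with other forms would unfold the nested convolutions.
module Interface {S : Set} {_≈_ : S → S → Set} {_+_ _*_ : S → S → S} {neg : S → S} {0# 1# : S}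
  (isCommutativeRing : IsCommutativeRing _≈_ _+_ _*_ neg 0# 1#)
  (_-_ : S → S → S) (minus : ∀ f g → (f - g) ≈ (f + neg g))
  (_·_ : Z5 → S → S)
  (·-+ : ∀ u v f → ((u +ᶻ v) · f) ≈ ((u · f) + (v · f)))
  (·-* : ∀ u v f → ((u *ᶻ v) · f) ≈ (u · (v · f)))
  (·-assoc : ∀ u f g → ((u · f) * g) ≈ (u · (f * g)))
  (·-neg : ∀ u f → ((-ᶻ u) · f) ≈ neg (u · f))
  (·-0 : ∀ f → (0ᶻ · f) ≈ 0#) (·-1 : ∀ f → (1ᶻ · f) ≈ f)
  (·-cong : ∀ u {f g} → f ≈ g → (u · f) ≈ (u · g))
  (mono : ℕ → S) (mono-0 : mono 0 ≈ 1#) (mono-suc : ∀ k → mono (suc k) ≈ (mono 1 * mono k))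
  (N : ℕ) (mono-N : mono N ≈ 0#)
  (sum prod : (ℕ → S) → ℕ → S)
  (sum-0 : ∀ t → sum t 0 ≈ 0#) (sum-suc : ∀ t k → sum t (suc k) ≈ (sum t k + t k))
  (prod-0 : ∀ t → prod t 0 ≈ 1#) (prod-suc : ∀ t k → prod t (suc k) ≈ (prod t k * t k))
  where

  private
    R : CommutativeRing 0ℓ 0ℓ
    R = record { isCommutativeRing = isCommutativeRing }
    module R = CommutativeRing R
    open R using (refl; sym; trans; *-cong; *-congˡ; *-congʳ; +-cong; +-congˡ; +-congʳ)
    open import Algebra.Properties.Semiring.Exp R.semiring using (_^_)
    open import Relation.Binary.Reasoning.Setoid R.setoid

    κ : Z5 → S
    κ u = u · 1#

    κ-* : ∀ u f → (u · f) ≈ (κ u * f)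
    κ-* u f = sym (trans (·-assoc u 1# f) (·-cong u (R.*-identityˡ f)))

    morphism : CommutativeRing.rawRing Cyclotomic.commutativeRing ACR.-Raw-AlmostCommutative⟶ ACR.fromCommutativeRing R (λ _ → nothing)
    morphism = record
      { ⟦_⟧    = κ
      ; +-homo = λ u v → ·-+ u v 1#
      ; *-homo = λ u v → trans (·-* u v 1#) (κ-* u (κ v))
      ; -‿homo = λ u → ·-neg u 1#
      ; 0-homo = ·-0 1#
      ; 1-homo = ·-1 1#
      }

    q : S
    q = mono 1

    mono≈^ : ∀ k → mono k ≈ (q ^ k)
    mono≈^ zero    = mono-0
    mono≈^ (suc k) = trans (mono-suc k) (*-congˡ (mono≈^ k))

    q^N≈0 : (q ^ N) ≈ 0#
    q^N≈0 = trans (sym (mono≈^ N)) mono-N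

    open Dissection R morphism q N
    open QSeries R morphism using (∑)

    sum≈∑ : ∀ t n → sum t n ≈ ∑ n t
    sum≈∑ t zero    = sum-0 t
    sum≈∑ t (suc n) = trans (sum-suc t n) (+-congʳ (sum≈∑ t n))

  factor : Z5 → ℕ → ℕ → ℕ → S
  factor u e d j = 1# - (u · mono (e ℕ.+ j ℕ.* d))

  prod≈finite : ∀ u e d n → prod (factor u e d) n ≈ finite u e d n
  prod≈finite u e d zero    = prod-0 _
  prod≈finite u e d (suc n) = trans (prod-suc _ n) (*-cong (prod≈finite u e d n)
    (trans (minus _ _) (+-congˡ (R.-‿cong (trans (κ-* u _) (*-congˡ (mono≈^ _)))))))

  prod-stable : ∀ u e d {n} → N ℕ.≤ n → prod (factor u e (suc d)) n ≈ prod (factor u e (suc d)) N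
  prod-stable u e d {n} N≤n = trans (prod≈finite u e (suc d) n)
    (trans (finite-stable q^N≈0 u e d N≤n) (sym (prod≈finite u e (suc d) N)))

  -- With `s k` as (1 - f)^k the sum telescopes, since f = 1 - (1 - f).
  geometric : ∀ f s → s 0 ≈ 1# → (∀ k → s (suc k) ≈ (s k * (1# - f))) → ∀ n → (f * sum s n) ≈ (1# - s n)
  geometric f s s₀≈1 s-suc zero = begin
    f * sum s 0    ≈⟨ trans (*-congˡ (sum-0 s)) (R.zeroʳ f) ⟩
    0#             ≈⟨ sym (R.-‿inverseʳ 1#) ⟩
    1# R.- 1#      ≈⟨ sym (trans (minus _ _) (+-congˡ (R.-‿cong s₀≈1))) ⟩
    1# - s 0       ∎
  geometric f s s₀≈1 s-suc (suc n) = begin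
    f * sum s (suc n)            ≈⟨ trans (*-congˡ (sum-suc s n)) (R.distribˡ f _ _) ⟩
    (f * sum s n) + (f * s n)    ≈⟨ +-congʳ (trans (geometric f s s₀≈1 s-suc n) (minus _ _)) ⟩
    (1# R.- s n) R.+ (f * s n)   ≈⟨ solve 2 (λ f s → :1 :- s :+ f :* s ⊜ :1 :- s :* (:1 :- f)) refl f (s n) ⟩
    1# R.- (s n * (1# R.- f))    ≈⟨ +-congˡ (R.-‿cong (trans (*-congˡ (sym (minus _ _))) (sym (s-suc n)))) ⟩
    1# R.- s (suc n)             ≈⟨ sym (minus _ _) ⟩
    1# - s (suc n)               ∎
    where open Solver R morphism

  module Conclusion
    (five-regular : ∀ f → (z5 (+ 5) (+ 0) (+ 0) (+ 0) · f) ≈ 0# → f ≈ 0#)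
    (p : Z5 → ℕ → ℕ → S) (p≈prod : ∀ u e d → p u e (suc d) ≈ prod (factor u e (suc d)) N)
    (θ : ℕ → ℕ → S) (θ≡ : ∀ e m → θ e m ≡ (p 1ᶻ e m * p 1ᶻ (m ∸ e) m))
    (inv : S → S) (Unital : S → Set) (inv-inverse : ∀ f → Unital f → (f * inv f) ≈ 1#)
    (unital-* : ∀ f g → Unital f → Unital g → Unital (f * g))
    (unital-p : ∀ u e d → Unital (p u (suc e) (suc d)))
    (Five : S → Set) (five-cong : ∀ {f g} → f ≈ g → Five f → Five g)
    (five-+ : ∀ f g → Five f → Five g → Five (f + g)) (five-* : ∀ f g → Five f → Five g → Five (f * g))
    (five-κ : ∀ u → Five (u · 1#)) (five-mono : Five (mono 5))
    (separate : ∀ f g → Five f → Five g → f ≈ (mono 2 * g) → f ≈ 0#)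
    (summand : ℕ → S)
    (summand≈ : ∀ n → summand n ≈ (((mono (n ℕ.* n) * p 1ᶻ (2 ℕ.* n ℕ.+ 1) 1) * inv (p ζ n 1)) * inv (p ζ⁴ n 1)))
    where

    private
      open module A = Assembly q^N≈0
        (λ f κ5f≈0 → five-regular f (trans (κ-* _ f) κ5f≈0))
        p (λ u e d → trans (p≈prod u e d) (prod≈finite u e (suc d) N))
        mono mono≈^ _·_ κ-* inv Unital inv-inverse unital-* unital-p
        Five five-cong five-+ five-* five-κ (five-cong (mono≈^ 5) five-mono)
        (λ f g f-five g-five f≈q²g → separate f g f-five g-five (trans f≈q²g (*-congʳ (sym (mono≈^ 2)))))
        using (series≈closed-form)

    series≈product : sum (λ j → summand (suc j)) N ≈
      (p 1ᶻ 25 25 *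
        ((((((-ᶻ (1ᶻ +ᶻ c)) · ((mono 5 * θ 10 75) * inv (((θ 5 75 * θ 20 75) * θ 25 75) * θ 30 75)))
        + (mono 1 * inv ((θ 10 75 * θ 15 75) * θ 25 75)))
        + ((1ᶻ +ᶻ c) · (mono 2 * inv (θ 10 25))))
        - (mono 2 * inv ((θ 5 75 * θ 25 75) * θ 30 75)))
        - (c · ((mono 8 * θ 5 75) * inv (((θ 10 75 * θ 15 75) * θ 25 75) * θ 35 75)))))
    -- `θ` is opened only at this point, where it has to match the products used in `Assembly`.
    series≈product rewrite θ≡ 5 75 | θ≡ 10 75 | θ≡ 15 75 | θ≡ 20 75 | θ≡ 25 75 | θ≡ 30 75 | θ≡ 35 75 | θ≡ 10 25 =
      trans (sum≈∑ _ N) (trans (Fold.fold-cong′ R.+-commutativeMonoid N (λ k → summand≈ (suc k))) (trans series≈closed-form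
        (*-congˡ (trans (+-congʳ (sym (minus _ _))) (sym (minus _ _))))))

-- Truncations and coefficients of the series in the theorem

qpow-diagonal : ∀ k → qpow k k ≡ 1ᶻ
qpow-diagonal k with k ℕ.≟ k
... | yes _  = ≡.refl
... | no k≢k = contradiction ≡.refl k≢k

qpow-off : ∀ k n → k ≢ n → qpow k n ≡ 0ᶻ
qpow-off k n k≢n with k ℕ.≟ n
... | yes k≡n = contradiction k≡n k≢n
... | no _    = ≡.refl

open Monomials Cyclotomic.commutativeRing qpow qpow-diagonal qpow-off

private module ℤ[ζ] = CommutativeRing Cyclotomic.commutativeRing

sumFin-pad : ∀ {m L} → m ℕ.≤ L → ∀ t n → (∀ k → m ℕ.≤ k → t k n ≡ 0ᶻ) → sumFin t L n ≡ sumFin t m n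
sumFin-pad {m} {L} m≤L t n p with ℕₚ.m≤n⇒m<n∨m≡n m≤L
... | inj₂ ≡.refl = ≡.refl
sumFin-pad {m} {suc L} m≤L t n p | inj₁ (s≤s m≤L′) = ≡.trans
  (≡.cong₂ _+ᶻ_ (sumFin-pad m≤L′ t n p) (p L m≤L′)) (ℤ[ζ].+-identityʳ (sumFin t m n))

five-multiple : ∀ x → z5 (+ 5) (+ 0) (+ 0) (+ 0) *ᶻ x ≡ 0ᶻ → x ≡ 0ᶻ
five-multiple x 5x≡0 = go x (≡.trans (≡.sym (Cyclotomic.identity x x x (const five ⊠ X′) (e5 (Κ (+ 5) :* e0 X′) (Κ (+ 5) :* e1 X′) (Κ (+ 5) :* e2 X′) (Κ (+ 5) :* e3 X′)) ≡.refl)) 5x≡0)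
  where
  open Cyclotomic using (const; _⊠_; e5) renaming (X to X′)
  open Cyclotomic.Symbolic
  open import Tactic.RingSolver.Core.Expression using (Κ) renaming (_⊗_ to _:*_)
  five = z5 (+ 5) (+ 0) (+ 0) (+ 0)
  cancel : ∀ i → (+ 5) ℤ.* i ≡ + 0 → i ≡ + 0
  cancel i eq = ℤₚ.*-cancelˡ-≡ (+ 5) i (+ 0) eq
  go : ∀ x → z5 (+ 5 ℤ.* a0 x) (+ 5 ℤ.* a1 x) (+ 5 ℤ.* a2 x) (+ 5 ℤ.* a3 x) ≡ 0ᶻ → x ≡ 0ᶻ
  go (z5 x0 x1 x2 x3) eq = cong₄ (cancel x0 (≡.cong a0 eq)) (cancel x1 (≡.cong a1 eq)) (cancel x2 (≡.cong a2 eq)) (cancel x3 (≡.cong a3 eq))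
    where
    cong₄ : ∀ {x0 x1 x2 x3 y0 y1 y2 y3} → x0 ≡ y0 → x1 ≡ y1 → x2 ≡ y2 → x3 ≡ y3 → z5 x0 x1 x2 x3 ≡ z5 y0 y1 y2 y3
    cong₄ ≡.refl ≡.refl ≡.refl ≡.refl = ≡.refl

negₛ : Series → Series
negₛ f n = negᶻ (f n)

zeroₛ : Series
zeroₛ _ = 0ᶻ

isCommutativeRing : ∀ N → IsCommutativeRing _≈[ N ]_ _⊕_ _⊛_ negₛ zeroₛ one
isCommutativeRing N = CommutativeRing.isCommutativeRing (truncatedRing N)

·-assoc : ∀ u f g → ((u · f) ⊛ g) ≈ₛ (u · (f ⊛ g))
·-assoc = *-✶

⊛-cong : ∀ n f f′ g g′ → (∀ k → k ℕ.≤ n → f k ≡ f′ k) → (∀ k → k ℕ.≤ n → g k ≡ g′ k) → (f ⊛ g) n ≡ (f′ ⊛ g′) n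
⊛-cong n f f′ g g′ = ✶-cong n {f} {f′} {g} {g′}

⊛-low : ∀ k n f g → (∀ i → i ℕ.< k → f i ≡ 0ᶻ) → n ℕ.< k → (f ⊛ g) n ≡ 0ᶻ
⊛-low k n f g = ✶-low {k} {n} f g

⊛-low-suc : ∀ k f g → (∀ i → i ℕ.< k → f i ≡ 0ᶻ) → g 0 ≡ 0ᶻ → ∀ i → i ℕ.< suc k → (f ⊛ g) i ≡ 0ᶻ
⊛-low-suc = ✶-low-suc

one-⊛ : ∀ f → (one ⊛ f) ≈ₛ f
one-⊛ = ✶-identityˡ

⊛-constant : ∀ f g → (f ⊛ g) 0 ≡ f 0 *ᶻ g 0
⊛-constant = ✶-zero

qpow-suc : ∀ k → qpow (suc k) ≈ₛ (qpow 1 ⊛ qpow k)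
qpow-suc = mono-suc

neg-* : ∀ u x → negᶻ u *ᶻ x ≡ negᶻ (u *ᶻ x)
neg-* u x = ≡.sym (-‿distribˡ-* u x)
  where open import Algebra.Properties.Ring ℤ[ζ].ring using (-‿distribˡ-*)

module Truncated (N : ℕ) = Interface (isCommutativeRing N) _⊖_ (λ _ _ _ _ → ≡.refl)
  _·_ (λ u v f n _ → ℤ[ζ].distribʳ (f n) u v) (λ u v f n _ → ℤ[ζ].*-assoc u v (f n)) (λ u f g n _ → ·-assoc u f g n)
  (λ u f n _ → neg-* u (f n)) (λ f n _ → ℤ[ζ].zeroˡ (f n)) (λ f n _ → ℤ[ζ].*-identityˡ (f n))
  (λ u f≈g n n<N → ≡.cong (u *ᶻ_) (f≈g n n<N))
  qpow (λ _ _ → ≡.refl) (λ k n _ → qpow-suc k n) N (λ n n<N → mono-low N n n<N)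
  sumFin prodFin (λ _ _ _ → ≡.refl) (λ _ _ _ _ → ≡.refl) (λ _ _ _ → ≡.refl) (λ _ _ _ _ → ≡.refl)

factor : Z5 → ℕ → ℕ → ℕ → Series
factor u e d j = one ⊖ (u · qpow (e ℕ.+ j ℕ.* d))

-- `poch` cuts the product at n + 1 factors for coefficient n, a length that varies with n. Modulo
-- q^(n+1) the factors from index n + 1 on are 1, so any common length N > n gives the same
-- coefficient.
poch≈prod : ∀ N u e d → poch u e (suc d) ≈[ N ] prodFin (factor u e (suc d)) N
poch≈prod N u e d n n<N = ≡.sym (Truncated.prod-stable (suc n) u e d n<N n ℕₚ.≤-refl)

five-regular : ∀ N f → (z5 (+ 5) (+ 0) (+ 0) (+ 0) · f) ≈[ N ] zeroₛ → f ≈[ N ] zeroₛ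
five-regular N f p n n<N = five-multiple (f n) (p n n<N)

Unital : Series → Set
Unital f = f 0 ≡ 1ᶻ

unital-⊛ : ∀ f g → Unital f → Unital g → Unital (f ⊛ g)
unital-⊛ f g p r = ≡.trans (⊛-constant f g) (≡.trans (≡.cong₂ _*ᶻ_ p r) (ℤ[ζ].*-identityˡ 1ᶻ))

unital-poch : ∀ u e d → Unital (poch u (suc e) (suc d))
unital-poch u e d = ≡.trans (one-⊛ (factor u (suc e) (suc d) 0) 0)
  (≡.cong (λ v → 1ᶻ -ᶻ v) (≡.trans (≡.cong (u *ᶻ_) (qpow-off (suc e ℕ.+ 0) 0 (λ ()))) (ℤ[ζ].zeroʳ u)))

inv-inverse : ∀ N f → Unital f → (f ⊛ inv f) ≈[ N ] one
inv-inverse N f f-unital n n<N = begin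
  (f ⊛ inv f) n
    -- `inv` cuts its geometric series at a different point for each coefficient; as 1 - f has no
    -- constant term, its k-th power vanishes below q^k and one common cut at N serves all k ≤ n.
    ≡⟨ ⊛-cong n f f (inv f) (sumFin s N) (λ _ _ → ≡.refl)
         (λ k k≤n → ≡.sym (sumFin-pad (ℕₚ.≤-<-trans k≤n n<N) s k (λ i k<i → s-low i k k<i))) ⟩
  (f ⊛ sumFin s N) n
    ≡⟨ Truncated.geometric N f s (λ _ _ → ≡.refl) (λ _ _ _ → ≡.refl) N n n<N ⟩
  one n -ᶻ s N n
    ≡⟨ ≡.cong (λ v → one n -ᶻ v) (s-low N n n<N) ⟩
  one n -ᶻ 0ᶻ
    ≡⟨ ℤ[ζ].+-identityʳ (one n) ⟩
  one n ∎
  where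
  open ≡.≡-Reasoning
  s : ℕ → Series
  s = spow (one ⊖ f)
  s-low : ∀ k i → i ℕ.< k → s k i ≡ 0ᶻ
  s-low (suc k) = ⊛-low-suc k (s k) (one ⊖ f) (s-low k) (≡.cong (λ v → 1ᶻ -ᶻ v) f-unital)

⊛-low₄ : ∀ k f g h i → (∀ n → n ℕ.< k → f n ≡ 0ᶻ) → ∀ n → n ℕ.< k → (f ⊛ g ⊛ h ⊛ i) n ≡ 0ᶻ
⊛-low₄ k f g h i p n = ⊛-low k n (f ⊛ g ⊛ h) i (λ m → ⊛-low k m (f ⊛ g) h (λ m → ⊛-low k m f g p))

PP4term-low : ∀ m n → n ℕ.< m ℕ.* m → PP4term m n ≡ 0ᶻ
PP4term-low m = ⊛-low₄ (m ℕ.* m) (qpow (m ℕ.* m)) (poch 1ᶻ (2 ℕ.* m ℕ.+ 1) 1) (inv (poch ζ m 1)) (inv (poch ζ⁴ m 1)) (mono-low (m ℕ.* m))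

PP4ζ≈sum : ∀ N → PP4ζ ≈[ N ] sumFin (λ j → PP4term (suc j)) N
PP4ζ≈sum N n n<N = ≡.sym (sumFin-pad n<N (λ j → PP4term (suc j)) n (λ j n<j →
  PP4term-low (suc j) n (ℕₚ.<-≤-trans (ℕₚ.m≤n⇒m≤1+n n<j) (ℕₚ.m≤m*n (suc j) (suc j)))))

theorem12 : PP4ζ ≈ₛ RHS
-- Coefficient n is read modulo q^(n+1), the smallest truncation that retains it.
theorem12 n = ≡.trans (PP4ζ≈sum (suc n) n ℕₚ.≤-refl) (Truncated.Conclusion.series≈product (suc n)
  (five-regular (suc n)) poch (poch≈prod (suc n)) theta (λ _ _ → ≡.refl) inv Unital (inv-inverse (suc n)) unital-⊛ unital-poch
  (Five (suc n)) (λ {f} {g} → five-cong (suc n) {f} {g}) (five-+ (suc n)) (five-* (suc n)) (five-κ (suc n)) (five-mono (suc n)) (separate (suc n))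
  PP4term (λ _ _ _ → ≡.refl) n ℕₚ.≤-refl)
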